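{- Under the standing hypotheses described in the context, the $(q-1)$-secants to $D$ in $H_\infty=\mathrm{PG}(2k-1,q)$ form a pseudoregulus: they are $\frac{q^k-1}{q-1}$ pairwise disjoint lines, and there exist exactly two $(k-1)$-dimensional subspaces of $H_\infty$ disjoint from $D$, each meeting every $(q-1)$-secant to $D$. In particular, $D$ is an $\mathbb{F}_2$-linear set of pseudoregulus type.
   Context: Standing hypotheses: $q=2^h$ with $h\ge4$, $k\ge2$; $H_\infty\cong\mathrm{PG}(2k-1,q)$ is a hyperplane of $\mathrm{PG}(2k,q)$, points outside $H_\infty$ are affine; for distinct affine points $P,R$ the point $PR\cap H_\infty$ is the direction they determine. $\mathcal{Q}$ is a set of $q^k$ affine points, $D\subseteq H_\infty$ is the set of directions determined by pairs of distinct points of $\mathcal{Q}$, $|D|=q^k-1$, and every line of $\mathrm{PG}(2k,q)$ meets $D$ in $0$, $1$, $3$ or $q-1$ points. A $(q-1)$-secant to $D$ is a line meeting $D$ in exactly $q-1$ points. Writing $H_\infty=\mathrm{PG}(\mathbb{F}_q^{2k})$: an $\mathbb{F}_2$-linear set is $\{\langle u\rangle_{\mathbb{F}_q}:u\in U\setminus\{0\}\}$ for an $\mathbb{F}_2$-subspace $U$; of rank $\dim_{\mathbb{F}_2}U$; scattered if it has $2^{\dim U}-1$ points. A scattered $\mathbb{F}_2$-linear set $S$ of rank $hk$ is of pseudoregulus type if there are $\frac{q^k-1}{q-1}$ pairwise disjoint lines each meeting $S$ in $q-1$ points, and exactly two $(k-1)$-spaces disjoint from $S$ meeting all these lines. 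-}

module Defs where

open import Level using (Level; _⊔_)
open import Data.Nat as ℕ using (ℕ; _∸_; _^_)
open import Data.Fin using (Fin; zero)
import Data.Fin as Fin
open import Data.Bool using (Bool; true; false; if_then_else_)
open import Data.Product using (Σ; ∃; ∃₂; _×_; _,_)
open import Data.Sum using (_⊎_)
open import Relation.Nullary using (¬_)
open import Relation.Binary using (Decidable)
open import Relation.Binary.PropositionalEquality using (_≡_; _≢_)
open import Algebra.Bundles using (CommutativeRing)

record FiniteField (c ℓ : Level) : Set (Level.suc (c ⊔ ℓ)) where
  field
    commRing  : CommutativeRing c ℓ
  open CommutativeRing commRing using (Carrier; _≈_; _*_; 0#; 1#)
  field
    _≟_       : Decidable _≈_
    1≉0       : ¬ (1# ≈ 0#)
    inverse   : ∀ x → ¬ (x ≈ 0#) → ∃ λ y → (x * y) ≈ 1#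
    size      : ℕ
    enum      : Fin size → Carrier
    enum-inj  : ∀ i j → enum i ≈ enum j → i ≡ j
    enum-surj : ∀ x → ∃ λ i → x ≈ enum i
  open CommutativeRing commRing public

-- Projective geometry over F.
-- PG(m,q) is modelled by nonzero vectors of F^(m+1) = (Fin (suc m) → F)
-- up to nonzero scalars.  The hyperplane at infinity H∞ is x₀ = 0
-- (coordinate index 'zero').

module Geom {c ℓ} (F : FiniteField c ℓ) where
  open FiniteField F using (Carrier; _≈_; _+_; _*_; 0#; 1#; size)

  V : ℕ → Set c
  V m = Fin (ℕ.suc m) → Carrier

  module _ {m : ℕ} where

    _≈v_ : V m → V m → Set ℓ
    x ≈v y = ∀ i → x i ≈ y i

    0v : V m
    0v _ = 0#

    _+v_ : V m → V m → V m
    (x +v y) i = x i + y i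

    _·_ : Carrier → V m → V m
    (a · x) i = a * x i

    sumV : ∀ {d} → (Fin d → V m) → V m
    sumV {ℕ.zero}  f = 0v
    sumV {ℕ.suc d} f = f zero +v sumV (λ i → f (Fin.suc i))

    NonZeroV : V m → Set ℓ
    NonZeroV x = ¬ (x ≈v 0v)

    Proportional : V m → V m → Set (c ⊔ ℓ)
    Proportional x y = ∃ λ a → ¬ (a ≈ 0#) × (x ≈v (a · y))

    InH∞ : V m → Set ℓ
    InH∞ x = x zero ≈ 0#

    NumPoints : (V m → Set (c ⊔ ℓ)) → ℕ → Set (c ⊔ ℓ)
    NumPoints P n =
      Σ (Fin n → V m) λ f →
        (∀ i → NonZeroV (f i) × P (f i)) ×
        (∀ i j → Proportional (f i) (f j) → i ≡ j) ×
        (∀ x → NonZeroV x → P x → ∃ λ i → Proportional x (f i))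

    Indep2 : V m → V m → Set (c ⊔ ℓ)
    Indep2 u v = ∀ a b → ((a · u) +v (b · v)) ≈v 0v → (a ≈ 0#) × (b ≈ 0#)

    OnLine : V m → V m → V m → Set (c ⊔ ℓ)
    OnLine u v x = ∃₂ λ a b → x ≈v ((a · u) +v (b · v))

    SameLine : V m → V m → V m → V m → Set (c ⊔ ℓ)
    SameLine u v u' v' = ∀ x → (OnLine u v x → OnLine u' v' x) × (OnLine u' v' x → OnLine u v x)

    DisjointLines : V m → V m → V m → V m → Set (c ⊔ ℓ)
    DisjointLines u v u' v' = ∀ x → NonZeroV x → OnLine u v x → ¬ OnLine u' v' x

    LineInH∞ : V m → V m → Set ℓ
    LineInH∞ u v = InH∞ u × InH∞ v

    -- Projective (d-1)-dimensional subspaces: spans of d linearly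
    -- independent vectors.
    Indep : ∀ {d} → (Fin d → V m) → Set (c ⊔ ℓ)
    Indep {d} b = ∀ (a : Fin d → Carrier) → sumV (λ i → a i · b i) ≈v 0v → ∀ i → a i ≈ 0#

    InSpan : ∀ {d} → (Fin d → V m) → V m → Set (c ⊔ ℓ)
    InSpan {d} b x = ∃ λ (a : Fin d → Carrier) → x ≈v sumV (λ i → a i · b i)

    SameSubspace : ∀ {d} → (Fin d → V m) → (Fin d → V m) → Set (c ⊔ ℓ)
    SameSubspace b b' = ∀ x → (InSpan b x → InSpan b' x) × (InSpan b' x → InSpan b x)

    SubspaceOfH∞ : ∀ {d} → (Fin d → V m) → Set (c ⊔ ℓ)
    SubspaceOfH∞ b = Indep b × (∀ i → InH∞ (b i))

    DisjointFrom : ∀ {d} → (Fin d → V m) → (V m → Set (c ⊔ ℓ)) → Set (c ⊔ ℓ)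
    DisjointFrom b P = ∀ x → NonZeroV x → InSpan b x → ¬ P x

    MeetsLine : ∀ {d} → (Fin d → V m) → V m → V m → Set (c ⊔ ℓ)
    MeetsLine b u v = ∃ λ x → NonZeroV x × InSpan b x × OnLine u v x

    ExactlyTwoSubspaces : (d : ℕ) → ((Fin d → V m) → Set (c ⊔ ℓ)) → Set (c ⊔ ℓ)
    ExactlyTwoSubspaces d Good =
      Σ (Fin d → V m) λ b₁ → Σ (Fin d → V m) λ b₂ →
        SubspaceOfH∞ b₁ × Good b₁ ×
        SubspaceOfH∞ b₂ × Good b₂ ×
        ¬ SameSubspace b₁ b₂ ×
        (∀ b → SubspaceOfH∞ b → Good b → SameSubspace b b₁ ⊎ SameSubspace b b₂)

    -- F₂-linear sets in H∞.  An F₂-subspace U of rank r is the F₂-span of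
    -- r F₂-independent vectors g (F₂ ⊆ F; F₂-combinations are subset
    -- sums).  The linear set L_U = { ⟨u⟩_F : u ∈ U ∖ {0} }.

    subsetSum : ∀ {r} → (Fin r → V m) → (Fin r → Bool) → V m
    subsetSum g s = sumV (λ i → if s i then g i else 0v)

    F₂Indep : ∀ {r} → (Fin r → V m) → Set ℓ
    F₂Indep g = ∀ s → subsetSum g s ≈v 0v → ∀ i → s i ≡ false

    InLinSet : ∀ {r} → (Fin r → V m) → V m → Set (c ⊔ ℓ)
    InLinSet g x = ∃ λ s → NonZeroV (subsetSum g s) × Proportional x (subsetSum g s)

    IsF₂LinearSetOfRank : ℕ → (V m → Set (c ⊔ ℓ)) → Set (c ⊔ ℓ)
    IsF₂LinearSetOfRank r S =
      Σ (Fin r → V m) λ g →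
        (∀ i → InH∞ (g i)) × F₂Indep g ×
        (∀ x → NonZeroV x → (S x → InLinSet g x) × (InLinSet g x → S x))

    IsScatteredOfRank : ℕ → (V m → Set (c ⊔ ℓ)) → Set (c ⊔ ℓ)
    IsScatteredOfRank r S = IsF₂LinearSetOfRank r S × NumPoints S (2 ^ r ∸ 1)

    PseudoregulusLines : (h k : ℕ) → (V m → Set (c ⊔ ℓ)) → Set (c ⊔ ℓ)
    PseudoregulusLines h k S =
      Σ ℕ λ N → (N ℕ.* (2 ^ h ∸ 1) ≡ (2 ^ h) ^ k ∸ 1) ×
      Σ (Fin N → V m) λ u → Σ (Fin N → V m) λ v →
        (∀ i → Indep2 (u i) (v i) × LineInH∞ (u i) (v i) ×
               NumPoints (λ x → OnLine (u i) (v i) x × S x) (2 ^ h ∸ 1)) ×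
        (∀ i j → i ≢ j → DisjointLines (u i) (v i) (u j) (v j)) ×
        ExactlyTwoSubspaces k (λ b → DisjointFrom b S × (∀ i → MeetsLine b (u i) (v i)))

    IsScatteredOfPseudoregulusType : (h k : ℕ) → (V m → Set (c ⊔ ℓ)) → Set (c ⊔ ℓ)
    IsScatteredOfPseudoregulusType h k S =
      IsScatteredOfRank (h ℕ.* k) S × PseudoregulusLines h k S

  module Setup (h k : ℕ) (Q : Fin ((2 ^ h) ^ k) → V (2 ℕ.* k)) where

    q : ℕ
    q = 2 ^ h

    Pt : Set c
    Pt = V (2 ℕ.* k)

    -- x is (a representative of) the direction determined by Q i ≠ Q j:
    -- the point PR ∩ H∞.
    InD : Pt → Set (c ⊔ ℓ)
    InD x = ∃₂ λ i j → i ≢ j × InH∞ x × OnLine (Q i) (Q j) x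

    StandingHypotheses : Set (c ⊔ ℓ)
    StandingHypotheses =
      (size ≡ q) × (4 ℕ.≤ h) × (2 ℕ.≤ k) ×
      (∀ i → NonZeroV (Q i) × ¬ InH∞ (Q i)) ×
      (∀ i j → Proportional (Q i) (Q j) → i ≡ j) ×
      NumPoints InD (q ^ k ∸ 1) ×
      (∀ u v → Indep2 u v →
         let P = λ x → OnLine u v x × InD x in
         NumPoints P 0 ⊎ NumPoints P 1 ⊎ NumPoints P 3 ⊎ NumPoints P (q ∸ 1))

    Secant : Pt → Pt → Set (c ⊔ ℓ)
    Secant u v = Indep2 u v × NumPoints (λ x → OnLine u v x × InD x) (q ∸ 1)

    SecantsFormPseudoregulus : Set (c ⊔ ℓ)
    SecantsFormPseudoregulus =
      Σ ℕ λ N → (N ℕ.* (q ∸ 1) ≡ q ^ k ∸ 1) ×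
      Σ (Fin N → Pt) λ u → Σ (Fin N → Pt) λ v →
        (∀ i → Secant (u i) (v i)) ×
        (∀ u' v' → Secant u' v' → ∃ λ i → SameLine u' v' (u i) (v i)) ×
        (∀ i j → i ≢ j → DisjointLines (u i) (v i) (u j) (v j)) ×
        ExactlyTwoSubspaces k (λ b → DisjointFrom b InD × (∀ u' v' → Secant u' v' → MeetsLine b u' v'))

{-# OPTIONS --safe #-}
module Submission where

-- Normalise the points of Q to affine vectors A i. Projecting a plane from a point at infinity outside D shows that it
-- holds at most q points of Q; charging the points of Q to the directions in the planes through a line with
-- three points of Q then gives too few directions, so no three points of Q are collinear and every point of Q sees
-- every direction exactly once. Two secants through a direction d would span a plane in which the directions off
-- one secant, counted by parallels to d and by parallels to a hole of that secant, give two different numbers.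
-- Hence A i + A j + A l always lies in Q: directly when the three points span a 3-secant, and otherwise through a
-- point outside their plane. So U = Q + Q is an F₂-space, and D is its scattered linear set.
--
-- If U is scattered and ζ ∉ F₂, then (x , y) ↦ x + ζ y is injective on U, so a family of N vectors of U in an
-- r-dimensional space has N² ≤ q^r. Adding multiples of f ∈ U, a similar count shows that f lies on a secant, already
-- inside the solid spanned by two secants. Inside that solid a third secant is the graph of a linear map between the
-- two lines that carries U to U, hence holes to holes. Such maps are closed under addition, so they are
-- simultaneously diagonal in the holes. So the U-vectors of one secant are p a + σ(p) b with σ a field automorphism,
-- and each vector of U is α + β with p α + σ(p) β ∈ U for all p. A basis of such splittings gives
-- U = {Σ xᵢ αᵢ + σ(xᵢ) βᵢ}, with transversal spaces ⟨αᵢ⟩ and ⟨βᵢ⟩.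

open import Defs
open import Level using (Level; _⊔_)
open import Data.Nat using (ℕ; _^_)
open import Data.Nat as ℕ using (zero; suc; _≤_; _<_; _∸_; z≤n; s≤s)
import Data.Nat.Properties as ℕₚ
open import Data.Nat.Solver using (module +-*-Solver)
open import Data.Bool using (Bool; true; false; if_then_else_; _xor_; _∧_)
open import Data.Maybe using (just; nothing)
open import Data.Fin using (Fin)
open import Data.Fin as Fin using (zero; suc; punchIn; punchOut; combine; remQuot)
import Data.Fin.Properties as Finₚ
open import Data.Fin.Permutation using (permutation)
open import Data.Product using (Σ; ∃; ∃₂; _×_; _,_; proj₁; proj₂)
open import Data.Sum using (_⊎_; inj₁; inj₂; [_,_]′)
open import Data.Empty using (⊥; ⊥-elim)
open import Data.List as List using (List; []; _∷_; length)
open import Data.List.Membership.Propositional.Properties using (∈-lookup)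
open import Data.List.Relation.Unary.All as All using (All; []; _∷_)
open import Data.List.Relation.Unary.AllPairs using (AllPairs; []; _∷_)
open import Function using (_∘_)
open import Relation.Nullary using (¬_; Dec; yes; no; does)
open import Relation.Nullary.Decidable using (¬?; _×-dec_; map′; toSum)
open import Relation.Nullary.Negation using (contradiction)
open import Relation.Binary.PropositionalEquality as ≡ using (_≡_; _≢_)
open import Algebra.Bundles using (RawRing)
open import Algebra.Solver.Ring.AlmostCommutativeRing using (fromCommutativeRing; _-Raw-AlmostCommutative⟶_; Induced-equivalence)
open import Relation.Binary.Definitions using (WeaklyDecidable)
import Algebra.Properties.Ring as RingProps
import Algebra.Properties.Semiring.Mult as Mult
import Algebra.Properties.CommutativeMonoid.Sum as CMSum
import Algebra.Solver.Ring as RingSolver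

-- Counting in finite sets

-- Two facts carry the counts. Since n² = q^(2k), the bound N² ≤ q^r is attained by U in H∞, and
-- again by the q² sums of vectors of U from two secants inside their solid. Whatever would enlarge
-- such a family, or squeeze it into a smaller space, is contradictory, and this tightness also
-- forces a secant through every vector of U. Second, a fourth point of D on a line makes it a
-- secant, and a secant has exactly (q + 1) - (q - 1) = 2 points outside D. These two holes are the
-- only candidates for points of the transversal spaces, and they supply the basis in which the
-- linear maps between secants become diagonal. The size of q enters through two inequalities: the
-- double count in the plane of two secants needs q - 4 not to divide 4, and the count through f
-- needs q > 4.

module FiniteCounting where
  open ≡ using (refl; sym; trans; cong; cong₂; subst)
  open CMSum ℕₚ.+-0-commutativeMonoid using (sum; ∑-comm)
  open +-*-Solver using (solve; _:=_; _:+_; _:*_; con)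

  private variable
    p p' : Level
    m n c : ℕ

  Inj : {A : Set p} {B : Set p'} → (A → B) → Set _
  Inj f = ∀ {x y} → f x ≡ f y → x ≡ y

  missed : n < m → (f : Fin n → Fin m) → ∃ λ y → ∀ x → f x ≢ y
  missed {n} {m} n<m f with Finₚ.all? (λ y → Finₚ.any? (λ x → f x Finₚ.≟ y))
  ... | yes hit = contradiction (Finₚ.injective⇒≤ section-inj) (ℕₚ.<⇒≱ n<m)
    where
    section-inj : Inj (λ y → proj₁ (hit y))
    section-inj {y} {y'} eq = trans (sym (proj₂ (hit y))) (trans (cong f eq) (proj₂ (hit y')))
  ... | no ¬hit with Finₚ.¬∀⟶∃¬ m _ (λ y → Finₚ.any? (λ x → f x Finₚ.≟ y)) ¬hit
  ...   | y , ¬y = y , λ x e → ¬y (x , e)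

  inj⇒surj : {f : Fin n → Fin n} → Inj f → ∀ y → ∃ λ x → f x ≡ y
  inj⇒surj {suc n} {f} inj y with Finₚ.any? (λ x → f x Finₚ.≟ y)
  ... | yes found = found
  ... | no ¬found = contradiction (Finₚ.injective⇒≤ {f = g} g-inj) ℕₚ.1+n≰n
    where
    avoids : ∀ x → y ≢ f x
    avoids x e = ¬found (x , sym e)
    g : Fin (suc n) → Fin n
    g x = punchOut (avoids x)
    g-inj : Inj g
    g-inj {x} {x'} e = inj (Finₚ.punchOut-injective (avoids x) (avoids x') e)

  others-surj : (r : Fin n) (f : ∀ s → s ≢ r → Fin (n ∸ 1)) →
    (∀ {s t} ps pt → f s ps ≡ f t pt → s ≡ t) → ∀ y → ∃ λ s → Σ (s ≢ r) λ ps → f s ps ≡ y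
  others-surj {suc n} r f inj y
    with inj⇒surj {f = λ x → f (punchIn r x) (Finₚ.punchInᵢ≢i r x)} (λ e → Finₚ.punchIn-injective r _ _ (inj _ _ e)) y
  ... | x , e = punchIn r x , Finₚ.punchInᵢ≢i r x , e

  -- `P` and `R` need not be complementary: `secant-through` runs this with "secant" against "thin".
  search : {P : Fin n → Set p} {R : Fin n → Set p'} → (∀ i → P i ⊎ R i) → ∃ P ⊎ (∀ i → R i)
  search {n = zero} d = inj₂ λ ()
  search {n = suc n} d with d zero
  ... | inj₁ x = inj₁ (zero , x)
  ... | inj₂ y with search (d ∘ suc)
  ...   | inj₁ (i , x) = inj₁ (suc i , x)
  ...   | inj₂ ys = inj₂ λ { zero → y ; (suc i) → ys i }

  earlier? : (f : Fin n → Fin m) (i : Fin n) → Dec (∃ λ l → l Fin.< i × f l ≡ f i)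
  earlier? f i = Finₚ.any? λ l → (l Finₚ.<? i) ×-dec (f l Finₚ.≟ f i)

  bit : {P : Set p} → Dec P → Fin 2
  bit (yes _) = zero
  bit (no _) = suc zero

  -- A collision of i ↦ (f i , whether the value f i occurs before i) is a collision of f preceded by a third one.
  three-in-a-fibre : m ℕ.* 2 < n → (f : Fin n → Fin m) →
    ∃ λ i → ∃₂ λ j l → i ≢ j × i ≢ l × j ≢ l × f i ≡ f j × f i ≡ f l
  three-in-a-fibre {m} {n} 2m<n f with Finₚ.pigeonhole 2m<n (λ i → combine (f i) (bit (earlier? f i)))
  ... | i , j , i<j , e with Finₚ.combine-injective (f i) _ (f j) _ e
  ... | fe , be with earlier? f i | earlier? f j
  ...   | yes (l , l<i , fl) | _ = i , j , l , Finₚ.<⇒≢ i<j , (Finₚ.<⇒≢ l<i ∘ sym) ,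
                                   (Finₚ.<⇒≢ (Finₚ.<-trans l<i i<j) ∘ sym) , fe , sym fl
  ...   | no _ | no ¬l = ⊥-elim (¬l (i , i<j , fe))
  three-in-a-fibre 2m<n f | i , j , i<j , e | fe , () | no _ | yes _

  indicator : {P : Set p} → Dec P → ℕ
  indicator d = if does d then 1 else 0

  abstract
    count : {P : Fin n → Set p} → (∀ i → Dec (P i)) → ℕ
    count P? = sum (λ i → indicator (P? i))

  record Selection {n} (P : Fin n → Set p) (c : ℕ) : Set p where
    field
      el : Fin c → Fin n
      el-sat : ∀ j → P (el j)
      el-inj : Inj el
      el-all : ∀ i → P i → ∃ λ j → el j ≡ i

  abstract
    select : {P : Fin n → Set p} (P? : ∀ i → Dec (P i)) → Selection P (count P?)
    select {n = zero} P? = record { el = λ () ; el-sat = λ () ; el-inj = λ {x} → ⊥-elim (Finₚ.¬Fin0 x) ; el-all = λ () }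
    select {n = suc n} P? with P? zero | select (P? ∘ suc)
    ... | no ¬p | s = record
      { el = suc ∘ el ; el-sat = el-sat ; el-inj = λ e → el-inj (Finₚ.suc-injective e)
      ; el-all = λ { zero p → contradiction p ¬p ; (suc i) p → let j , e = el-all i p in j , cong suc e } }
      where open Selection s
    ... | yes p | s = record
      { el = λ { zero → zero ; (suc j) → suc (el j) }
      ; el-sat = λ { zero → p ; (suc j) → el-sat j }
      ; el-inj = λ { {zero} {zero} e → refl ; {suc x} {suc y} e → cong suc (el-inj (Finₚ.suc-injective e)) ; {zero} {suc _} () ; {suc _} {zero} () }
      ; el-all = λ { zero _ → zero , refl ; (suc i) p → let j , e = el-all i p in suc j , cong suc e } }
      where open Selection s

  module _ {P : Fin n → Set p} (P? : ∀ i → Dec (P i)) where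
    open Selection (select P?)

    count-lower : (g : Fin c → Fin n) → (∀ i → P (g i)) → Inj g → c ≤ count P?
    count-lower g sat inj = Finₚ.injective⇒≤ {f = λ i → proj₁ (el-all (g i) (sat i))} λ {x} {y} e →
      inj (trans (sym (proj₂ (el-all (g x) (sat x)))) (trans (cong el e) (proj₂ (el-all (g y) (sat y)))))

    -- In the charging argument `g` is a plane coordinate, and the missed values `v`, `w` are those
    -- of two points of Q that never represent a charge; this turns the bound q into q - 2.
    count-upper : (g : ∀ i → P i → Fin m) → (∀ {i j} pi pj → g i pi ≡ g j pj → i ≡ j) →
      ∀ {v w} → v ≢ w → (∀ i pi → g i pi ≢ v) → (∀ i pi → g i pi ≢ w) → 2 ℕ.+ count P? ≤ m
    count-upper {m} g inj {v} {w} v≢w ≢v ≢w = Finₚ.injective⇒≤ {f = f} f-inj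
      where
      f : Fin (2 ℕ.+ count P?) → Fin m
      f zero = v
      f (suc zero) = w
      f (suc (suc j)) = g (el j) (el-sat j)
      f-inj : Inj f
      f-inj {zero} {zero} e = refl
      f-inj {zero} {suc zero} e = contradiction e v≢w
      f-inj {zero} {suc (suc _)} e = contradiction (sym e) (≢v _ _)
      f-inj {suc zero} {zero} e = contradiction (sym e) v≢w
      f-inj {suc zero} {suc zero} e = refl
      f-inj {suc zero} {suc (suc _)} e = contradiction (sym e) (≢w _ _)
      f-inj {suc (suc _)} {zero} e = contradiction e (≢v _ _)
      f-inj {suc (suc _)} {suc zero} e = contradiction e (≢w _ _)
      f-inj {suc (suc _)} {suc (suc _)} e = cong (λ j → suc (suc j)) (el-inj (inj _ _ e))

    count-some : 0 < count P? → ∃ P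
    count-some pos = el (Fin.fromℕ< pos) , el-sat (Fin.fromℕ< pos)

    count-none : (∀ i → ¬ P i) → count P? ≡ 0
    count-none none with count P? in eq
    ... | zero = refl
    ... | suc c = ⊥-elim (none _ (el-sat (subst Fin (sym eq) zero)))

  abstract
    count-complement : {P : Fin n → Set p} (P? : ∀ i → Dec (P i)) → count P? ℕ.+ count (λ i → ¬? (P? i)) ≡ n
    count-complement {n = zero} P? = refl
    count-complement {n = suc n} P? with P? zero | count-complement (P? ∘ suc)
    ... | yes _ | e = cong suc e
    ... | no _ | e = trans (ℕₚ.+-suc _ _) (cong suc e)

    count-suc : {P : Fin (suc n) → Set p} (P? : ∀ i → Dec (P i)) → count P? ≡ indicator (P? zero) ℕ.+ count (P? ∘ suc)
    count-suc P? = refl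

    double-count : {P : Fin m → Fin n → Set p} (P? : ∀ i j → Dec (P i j)) →
      sum (λ i → count (P? i)) ≡ sum (λ j → count (λ i → P? i j))
    double-count P? = ∑-comm (λ i j → indicator (P? i j))

  indicator-yes : {P : Set p} (d : Dec P) → P → indicator d ≡ 1
  indicator-yes (yes _) _ = refl
  indicator-yes (no ¬p) p = contradiction p ¬p

  indicator-no : {P : Set p} (d : Dec P) → ¬ P → indicator d ≡ 0
  indicator-no (yes p) ¬p = contradiction p ¬p
  indicator-no (no _) _ = refl

  count-suc-yes : {P : Fin (suc n) → Set p} (P? : ∀ i → Dec (P i)) → P zero → count P? ≡ suc (count (P? ∘ suc))
  count-suc-yes P? p = trans (count-suc P?) (cong (ℕ._+ count (P? ∘ suc)) (indicator-yes (P? zero) p))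

  count-suc-no : {P : Fin (suc n) → Set p} (P? : ∀ i → Dec (P i)) → ¬ P zero → count P? ≡ count (P? ∘ suc)
  count-suc-no P? ¬p = trans (count-suc P?) (cong (ℕ._+ count (P? ∘ suc)) (indicator-no (P? zero) ¬p))

  count-mono : {P : Fin n → Set p} {R : Fin n → Set p'} (P? : ∀ i → Dec (P i)) (R? : ∀ i → Dec (R i)) → (∀ i → P i → R i) → count P? ≤ count R?
  count-mono P? R? imp = count-lower R? el (λ j → imp _ (el-sat j)) el-inj
    where open Selection (select P?)

  count-cong : {P : Fin n → Set p} {R : Fin n → Set p'} (P? : ∀ i → Dec (P i)) (R? : ∀ i → Dec (R i)) →
    (∀ i → P i → R i) → (∀ i → R i → P i) → count P? ≡ count R?
  count-cong P? R? to from = ℕₚ.≤-antisym (count-mono P? R? to) (count-mono R? P? from)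

  sum-lower : ∀ {s} {t : Fin n → ℕ} → (∀ i → s ≤ t i) → n ℕ.* s ≤ sum t
  sum-lower {zero} _ = z≤n
  sum-lower {suc n} s≤ = ℕₚ.+-mono-≤ (s≤ zero) (sum-lower (s≤ ∘ suc))

  sum-lower-except : ∀ {s} {t : Fin n → ℕ} r → (∀ i → i ≢ r → s ≤ t i) → (n ∸ 1) ℕ.* s ≤ sum t
  sum-lower-except {suc n} {t = t} zero s≤ = ℕₚ.≤-trans (sum-lower (λ i → s≤ (suc i) λ ())) (ℕₚ.m≤n+m _ (t zero))
  sum-lower-except {suc (suc n)} (suc r) s≤ =
    ℕₚ.+-mono-≤ (s≤ zero λ ()) (sum-lower-except r (λ i i≢r → s≤ (suc i) (i≢r ∘ Finₚ.suc-injective)))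

  sum-upper : ∀ {s} {t : Fin n → ℕ} → (∀ i → t i ≤ s) → sum t ≤ n ℕ.* s
  sum-upper {zero} _ = z≤n
  sum-upper {suc n} ≤s = ℕₚ.+-mono-≤ (≤s zero) (sum-upper (≤s ∘ suc))

  sum-upper-except : ∀ {s} {t : Fin n → ℕ} r → t r ≡ 0 → (∀ i → t i ≤ s) → sum t ≤ (n ∸ 1) ℕ.* s
  sum-upper-except {suc n} zero z ≤s rewrite z = sum-upper (≤s ∘ suc)
  sum-upper-except {suc (suc n)} (suc r) z ≤s = ℕₚ.+-mono-≤ (≤s zero) (sum-upper-except r z (≤s ∘ suc))

  sum-two-valued : ∀ a w {t : Fin n → ℕ} → (∀ i → t i ≡ a ⊎ t i ≡ a ℕ.+ w) → ∃ λ e → sum t ≡ n ℕ.* a ℕ.+ e ℕ.* w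
  sum-two-valued {zero} a w _ = 0 , refl
  sum-two-valued {suc n} a w {t} two with sum-two-valued a w (two ∘ suc) | two zero
  ... | e , eq | inj₁ t₀ = e , trans (cong₂ ℕ._+_ t₀ eq) (sym (ℕₚ.+-assoc a _ _))
  ... | e , eq | inj₂ t₀ = suc e , trans (cong₂ ℕ._+_ t₀ eq)
      (solve 4 (λ a w x y → (a :+ w) :+ (x :+ y) := (a :+ x) :+ (w :+ y)) refl a w (n ℕ.* a) (e ℕ.* w))

  -- Equality would make w = N - 4 divide N, hence 4, whereas 4 < w. The coefficients 3 and 2 are
  -- the least column and row counts of the double count for two secants.
  unbalanced : ∀ {N} → 16 ≤ N → ∀ e e' → N ℕ.* 3 ℕ.+ e ℕ.* (N ∸ 4) ≢ N ℕ.* 2 ℕ.+ e' ℕ.* (N ∸ 4)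
  unbalanced {N} 16≤N e e' eq = go e e' (ℕₚ.+-cancelˡ-≡ (N ℕ.* 2) _ _ (trans (sym (shift N (e ℕ.* (N ∸ 4)))) eq))
    where
    w : ℕ
    w = N ∸ 4
    shift : ∀ N x → N ℕ.* 3 ℕ.+ x ≡ N ℕ.* 2 ℕ.+ (N ℕ.+ x)
    shift = solve 2 (λ N x → N :* con 3 :+ x := N :* con 2 :+ (N :+ x)) refl
    swap : ∀ a b x → b ℕ.+ (a ℕ.+ x) ≡ a ℕ.+ (b ℕ.+ x)
    swap = solve 3 (λ a b x → b :+ (a :+ x) := a :+ (b :+ x)) refl
    w+4 : w ℕ.+ 4 ≡ N
    w+4 = ℕₚ.m∸n+n≡m (ℕₚ.≤-trans (ℕₚ.m≤m+n 4 12) 16≤N)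
    4<w : 4 < w
    4<w = ℕₚ.≤-trans (ℕₚ.m≤m+n 5 7) (ℕₚ.∸-monoˡ-≤ 4 16≤N)
    go : ∀ e e' → N ℕ.+ e ℕ.* w ≢ e' ℕ.* w
    go (suc e) (suc e') eq = go e e' (ℕₚ.+-cancelˡ-≡ w _ _ (trans (sym (swap w N (e ℕ.* w))) eq))
    go e zero eq = ℕₚ.<⇒≢ (ℕₚ.≤-trans (ℕₚ.≤-trans (s≤s z≤n) 16≤N) (ℕₚ.m≤m+n N _)) (sym eq)
    go zero (suc zero) eq = ℕₚ.<⇒≢ (ℕₚ.m<m+n w (s≤s z≤n)) (sym (trans w+4 (trans (sym (ℕₚ.+-identityʳ N)) (trans eq (ℕₚ.+-identityʳ w)))))
    go zero (suc (suc e')) eq = ℕₚ.<⇒≢ (ℕₚ.≤-trans (ℕₚ.≤-reflexive (cong suc (trans (ℕₚ.+-identityʳ N) (sym w+4))))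
      (ℕₚ.≤-trans (ℕₚ.+-monoʳ-< w 4<w) (ℕₚ.+-monoʳ-≤ w (ℕₚ.m≤m+n w _)))) eq

  inj⇒surj-≡ : m ≡ n → {f : Fin m → Fin n} → Inj f → ∀ y → ∃ λ x → f x ≡ y
  inj⇒surj-≡ refl = inj⇒surj

  two-selected : {P : Fin n → Set p} → Selection P 2 → ∃₂ λ i j → i ≢ j × P i × P j × (∀ l → P l → l ≡ i ⊎ l ≡ j)
  two-selected s = el zero , el (suc zero) , (λ e → contradiction (el-inj e) λ ()) , el-sat zero , el-sat (suc zero) , λ l Pl → which (el-all l Pl)
    where
    open Selection s
    which : ∀ {l} → (∃ λ j → el j ≡ l) → l ≡ el zero ⊎ l ≡ el (suc zero)
    which (zero , e) = inj₁ (sym e)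
    which (suc zero , e) = inj₂ (sym e)

  q⁴≡ : ∀ q → q ℕ.^ 4 ≡ (q ℕ.* q) ℕ.* (q ℕ.* q)
  q⁴≡ = solve 1 (λ q → q :* (q :* (q :* (q :* con 1))) := (q :* q) :* (q :* q)) refl

  n*2*2<n*q : ∀ {n q} → 0 < n → 4 < q → n ℕ.* 2 ℕ.* 2 < n ℕ.* q
  n*2*2<n*q {n} {q} 0<n 4<q = subst (_< n ℕ.* q) (sym (ℕₚ.*-assoc n 2 2)) (ℕₚ.*-monoʳ-< n ⦃ ℕ.>-nonZero 0<n ⦄ 4<q)

  funToFin-cong : {f g : Fin m → Fin n} → (∀ t → f t ≡ g t) → Fin.funToFin f ≡ Fin.funToFin g
  funToFin-cong {zero} _ = refl
  funToFin-cong {suc m} e = cong₂ combine (e zero) (funToFin-cong (e ∘ suc))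

  finToFun-inj : ∀ {e e' : Fin (n ℕ.^ m)} → (∀ t → Fin.finToFun {n} {m} e t ≡ Fin.finToFun e' t) → e ≡ e'
  finToFun-inj {n} {m} {e} {e'} h = trans (sym (Finₚ.funToFin-finToFin {m} {n} e)) (trans (funToFin-cong h) (Finₚ.funToFin-finToFin {m} {n} e'))

open FiniteCounting

-- Finite fields of characteristic two

module FieldBasics {c ℓ} (F : FiniteField c ℓ) where
  open FiniteField F hiding (zero)
  open RingProps ring using (+-cancelˡ; +-cancelʳ)

  ι : Carrier → Fin size
  ι x = proj₁ (enum-surj x)

  ι-≈ : ∀ x → x ≈ enum (ι x)
  ι-≈ x = proj₂ (enum-surj x)

  ι-cong : ∀ {x y} → x ≈ y → ι x ≡ ι y
  ι-cong e = enum-inj _ _ (trans (sym (ι-≈ _)) (trans e (ι-≈ _)))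

  ι-inj : ∀ {x y} → ι x ≡ ι y → x ≈ y
  ι-inj {x} {y} e = trans (ι-≈ x) (trans (reflexive (≡.cong enum e)) (sym (ι-≈ y)))

  ι-enum : ∀ i → ι (enum i) ≡ i
  ι-enum i = enum-inj _ _ (sym (ι-≈ (enum i)))

  inv : ∀ x → ¬ x ≈ 0# → Carrier
  inv x x≉0 = proj₁ (inverse x x≉0)

  inv-r : ∀ x (x≉0 : ¬ x ≈ 0#) → x * inv x x≉0 ≈ 1#
  inv-r x x≉0 = proj₂ (inverse x x≉0)

  inv-l : ∀ x (x≉0 : ¬ x ≈ 0#) → inv x x≉0 * x ≈ 1#
  inv-l x x≉0 = trans (*-comm _ _) (inv-r x x≉0)

  inv≉0 : ∀ x (x≉0 : ¬ x ≈ 0#) → ¬ inv x x≉0 ≈ 0#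
  inv≉0 x x≉0 e = 1≉0 (trans (sym (inv-r x x≉0)) (trans (*-congˡ e) (zeroʳ x)))

  a*x≈0⇒x≈0 : ∀ {a x} → ¬ a ≈ 0# → a * x ≈ 0# → x ≈ 0#
  a*x≈0⇒x≈0 {a} {x} a≉0 e = begin
    x                    ≈⟨ sym (*-identityˡ x) ⟩
    1# * x               ≈⟨ *-congʳ (sym (inv-l a a≉0)) ⟩
    (inv a a≉0 * a) * x  ≈⟨ *-assoc _ _ _ ⟩
    inv a a≉0 * (a * x)  ≈⟨ *-congˡ e ⟩
    inv a a≉0 * 0#       ≈⟨ zeroʳ _ ⟩
    0#                   ∎
    where open import Relation.Binary.Reasoning.Setoid setoid

  *≉0 : ∀ {a b} → ¬ a ≈ 0# → ¬ b ≈ 0# → ¬ a * b ≈ 0#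
  *≉0 a≉0 b≉0 e = b≉0 (a*x≈0⇒x≈0 a≉0 e)

  open CMSum +-commutativeMonoid using (sum; sum-permute; ∑-distrib-+; sum-cong-≋; sum-replicate)
  open Mult semiring using (×1-homo-*) renaming (_×_ to _×ᶠ_)

  private
    shift-inj : Inj (λ i → ι (enum i + 1#))
    shift-inj e = enum-inj _ _ (+-cancelʳ 1# _ _ (ι-inj e))

    shift⁻¹ : ∀ j → ∃ λ i → ι (enum i + 1#) ≡ j
    shift⁻¹ = inj⇒surj shift-inj

  -- The translation by 1 permutes the field, so summing over the field gives size · 1 = 0.
  size×1≈0 : size ×ᶠ 1# ≈ 0#
  size×1≈0 = +-cancelˡ (sum enum) _ _ (begin
    sum enum + size ×ᶠ 1#             ≈⟨ +-congˡ (sym (sum-replicate size)) ⟩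
    sum enum + sum {size} (λ _ → 1#)  ≈⟨ sym (∑-distrib-+ enum (λ _ → 1#)) ⟩
    sum (λ i → enum i + 1#)           ≈⟨ sum-cong-≋ {size} {λ i → enum i + 1#} (λ i → ι-≈ (enum i + 1#)) ⟩
    sum (λ i → enum (ι (enum i + 1#))) ≈⟨ sym (sum-permute enum π) ⟩
    sum enum                          ≈⟨ sym (+-identityʳ _) ⟩
    sum enum + 0#                     ∎)
    where
    open import Relation.Binary.Reasoning.Setoid setoid
    π = permutation (λ i → ι (enum i + 1#)) (proj₁ ∘ shift⁻¹) (proj₂ ∘ shift⁻¹)
          (λ i → shift-inj (proj₂ (shift⁻¹ (ι (enum i + 1#)))))

  -- The element 2^h · 1 is a power of 1 + 1, and a field has no zero divisors.
  2^h×1≈0⇒1+1≈0 : ∀ h → (2 ℕ.^ h) ×ᶠ 1# ≈ 0# → 1# + 1# ≈ 0#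
  2^h×1≈0⇒1+1≈0 zero e = contradiction (trans (sym (+-identityʳ 1#)) e) 1≉0
  2^h×1≈0⇒1+1≈0 (suc h) e with (1# + 1#) ≟ 0#
  ... | yes e₂ = e₂
  ... | no 2≉0 = 2^h×1≈0⇒1+1≈0 h (a*x≈0⇒x≈0 2≉0
          (trans (*-congʳ (+-congˡ (sym (+-identityʳ 1#)))) (trans (sym (×1-homo-* 2 (2 ℕ.^ h))) e)))

  char2 : ∀ h → size ≡ 2 ℕ.^ h → 1# + 1# ≈ 0#
  char2 h ≡.refl = 2^h×1≈0⇒1+1≈0 h size×1≈0

  abstract
    any-scalar? : ∀ {p} {P : Carrier → Set p} → (∀ {x y} → x ≈ y → P x → P y) → (∀ x → Dec (P x)) → Dec (∃ P)
    any-scalar? resp P? = map′ (λ { (i , p) → enum i , p }) (λ { (x , p) → ι x , resp (ι-≈ x) p }) (Finₚ.any? (P? ∘ enum))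

module Char2 {c ℓ} (F : FiniteField c ℓ) (1+1≈0 : FiniteField._≈_ F (FiniteField._+_ F (FiniteField.1# F) (FiniteField.1# F)) (FiniteField.0# F)) where
  open FiniteField F hiding (zero)
  open FieldBasics F
  open RingProps ring using (+-inverseʳ-unique)

  -- The coefficient ring of the solver. With coefficients in F₂ its normal forms cancel x + x, and
  -- negation becomes the identity.
  F₂ : RawRing _ _
  F₂ = record { Carrier = Bool ; _≈_ = _≡_ ; _+_ = _xor_ ; _*_ = _∧_ ; -_ = λ b → b ; 0# = false ; 1# = true }

  F₂⟶F : F₂ -Raw-AlmostCommutative⟶ fromCommutativeRing commRing
  F₂⟶F = record
    { ⟦_⟧ = λ b → if b then 1# else 0#
    ; +-homo = λ { true true → sym 1+1≈0 ; true false → sym (+-identityʳ 1#) ; false _ → sym (+-identityˡ _) }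
    ; *-homo = λ { true _ → sym (*-identityˡ _) ; false _ → sym (zeroˡ _) }
    ; -‿homo = λ { true → +-inverseʳ-unique 1# 1# 1+1≈0 ; false → +-inverseʳ-unique 0# 0# (+-identityʳ 0#) }
    ; 0-homo = refl
    ; 1-homo = refl
    }

  F₂-≟ : WeaklyDecidable (Induced-equivalence F₂⟶F)
  F₂-≟ true true = just refl
  F₂-≟ false false = just refl
  F₂-≟ _ _ = nothing

  open RingSolver F₂ (fromCommutativeRing commRing) F₂⟶F F₂-≟ public
    using (solve; _:=_; _:+_; _:*_; con)

  x+x≈0 : ∀ x → x + x ≈ 0#
  x+x≈0 = solve 1 (λ x → x :+ x := con false) refl

  x+y≈0⇒x≈y : ∀ {x y} → x + y ≈ 0# → x ≈ y
  x+y≈0⇒x≈y {x} {y} e = trans (solve 2 (λ x y → x := (x :+ y) :+ y) refl x y) (trans (+-congʳ e) (+-identityˡ y))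

  -- In characteristic 2, l ≈ r follows from equations pᵢ ≈ qᵢ as soon as l + r is a combination of the pᵢ + qᵢ.
  private
    vanish : ∀ {c p q} → p ≈ q → c * (p + q) ≈ 0#
    vanish {c} {p} {q} e = trans (*-congˡ (trans (+-congʳ e) (x+x≈0 q))) (zeroʳ c)

  by₁ : ∀ c {p q l r} → p ≈ q → l + r ≈ c * (p + q) → l ≈ r
  by₁ c e id = x+y≈0⇒x≈y (trans id (vanish e))

  by₂ : ∀ c₁ {p₁ q₁} → p₁ ≈ q₁ → ∀ c₂ {p₂ q₂} → p₂ ≈ q₂ → ∀ {l r} →
    l + r ≈ c₁ * (p₁ + q₁) + c₂ * (p₂ + q₂) → l ≈ r
  by₂ c₁ e₁ c₂ e₂ id = x+y≈0⇒x≈y (trans id (trans (+-cong (vanish e₁) (vanish e₂)) (+-identityʳ 0#)))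

  by₃ : ∀ c₁ {p₁ q₁} → p₁ ≈ q₁ → ∀ c₂ {p₂ q₂} → p₂ ≈ q₂ → ∀ c₃ {p₃ q₃} → p₃ ≈ q₃ → ∀ {l r} →
    l + r ≈ c₁ * (p₁ + q₁) + (c₂ * (p₂ + q₂) + c₃ * (p₃ + q₃)) → l ≈ r
  by₃ c₁ e₁ c₂ e₂ c₃ e₃ id = x+y≈0⇒x≈y (trans id
      (trans (+-cong (vanish e₁) (trans (+-cong (vanish e₂) (vanish e₃)) (+-identityʳ 0#))) (+-identityʳ 0#)))

  -- Vectors, proportionality and lines in characteristic two

  module Vectors (m : ℕ) where
    open Geom F public hiding (V; module Setup)
    private V = Geom.V F m

    vrefl : {x : V} → x ≈v x
    vrefl i = refl

    vsym : {x y : V} → x ≈v y → y ≈v x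
    vsym e i = sym (e i)

    vtrans : {x y z : V} → x ≈v y → y ≈v z → x ≈v z
    vtrans e e' i = trans (e i) (e' i)

    vcong+ : {x y x' y' : V} → x ≈v x' → y ≈v y' → (x +v y) ≈v (x' +v y')
    vcong+ e e' i = +-cong (e i) (e' i)

    vcong· : ∀ {a b} {x y : V} → a ≈ b → x ≈v y → (a · x) ≈v (b · y)
    vcong· e e' i = *-cong e (e' i)

    v+v : (x : V) → (x +v x) ≈v 0v
    v+v x i = x+x≈0 (x i)

    x+y≈0⇒x≈vy : {x y : V} → (x +v y) ≈v 0v → x ≈v y
    x+y≈0⇒x≈vy e i = x+y≈0⇒x≈y (e i)

    ≈v⇒+≈0 : {x y : V} → x ≈v y → (x +v y) ≈v 0v
    ≈v⇒+≈0 {y = y} e i = trans (+-congʳ (e i)) (x+x≈0 (y i))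

    abstract
      _≟v_ : (x y : V) → Dec (x ≈v y)
      x ≟v y = Finₚ.all? (λ i → x i ≟ y i)

    nonzero-resp : {x y : V} → x ≈v y → NonZeroV x → NonZeroV y
    nonzero-resp e x≉0 y≈0 = x≉0 (vtrans e y≈0)

    a·x≈0⇒x≈0 : ∀ {a} {x : V} → ¬ a ≈ 0# → (a · x) ≈v 0v → x ≈v 0v
    a·x≈0⇒x≈0 a≉0 e i = a*x≈0⇒x≈0 a≉0 (e i)

    a·x≈0⇒a≈0 : ∀ {a} {x : V} → NonZeroV x → (a · x) ≈v 0v → a ≈ 0#
    a·x≈0⇒a≈0 {a} x≉0 e with a ≟ 0#
    ... | yes a≈0 = a≈0
    ... | no a≉0 = contradiction (a·x≈0⇒x≈0 a≉0 e) x≉0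

    0·x≈0 : ∀ {a} {x : V} → a ≈ 0# → (a · x) ≈v 0v
    0·x≈0 e i = trans (*-congʳ e) (zeroˡ _)

    ·≉0 : ∀ {a} {x : V} → ¬ a ≈ 0# → NonZeroV x → NonZeroV (a · x)
    ·≉0 a≉0 x≉0 e = x≉0 (a·x≈0⇒x≈0 a≉0 e)

    ·-cancel : ∀ {a b} {x : V} → NonZeroV x → (a · x) ≈v (b · x) → a ≈ b
    ·-cancel {a} {b} {x} x≉0 e = x+y≈0⇒x≈y (a·x≈0⇒a≈0 x≉0 λ i →
      trans (distribʳ (x i) a b) (≈v⇒+≈0 e i))

    inv-· : ∀ {a} {x y : V} (a≉0 : ¬ a ≈ 0#) → x ≈v (a · y) → y ≈v (inv a a≉0 · x)
    inv-· {a} {x} {y} a≉0 e i = by₂ (inv a a≉0) (e i) (y i) (inv-l a a≉0)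
      (solve 4 (λ a' a x y → y :+ a' :* x := a' :* (x :+ a :* y) :+ y :* (a' :* a :+ con true)) refl (inv a a≉0) a (x i) (y i))

    prop-refl : {x y : V} → x ≈v y → Proportional x y
    prop-refl e = 1# , 1≉0 , λ i → trans (e i) (sym (*-identityˡ _))

    prop-sym : {x y : V} → Proportional x y → Proportional y x
    prop-sym (a , a≉0 , e) = inv a a≉0 , inv≉0 a a≉0 , inv-· a≉0 e

    prop-trans : {x y z : V} → Proportional x y → Proportional y z → Proportional x z
    prop-trans (a , a≉0 , e) (b , b≉0 , e') = a * b , *≉0 a≉0 b≉0 ,
      λ i → trans (e i) (trans (*-congˡ (e' i)) (sym (*-assoc a b _)))

    prop-respˡ : {x x' y : V} → x ≈v x' → Proportional x y → Proportional x' y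
    prop-respˡ e p = prop-trans (prop-refl (vsym e)) p

    prop-respʳ : {x y y' : V} → y ≈v y' → Proportional x y → Proportional x y'
    prop-respʳ e p = prop-trans p (prop-refl e)

    prop-nonzero : {x y : V} → Proportional x y → NonZeroV y → NonZeroV x
    prop-nonzero (a , a≉0 , e) y≉0 x≈0 = y≉0 (a·x≈0⇒x≈0 a≉0 (vtrans (vsym e) x≈0))

    abstract
      prop? : (x y : V) → Dec (Proportional x y)
      prop? x y = any-scalar? (λ { e (a≉0 , p) → (λ b → a≉0 (trans e b)) , vtrans p (vcong· e vrefl) })
        (λ a → ¬? (a ≟ 0#) ×-dec (x ≟v (a · y)))

    ·-prop : ∀ {a} {x : V} → ¬ a ≈ 0# → Proportional (a · x) x
    ·-prop a≉0 = _ , a≉0 , vrefl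

    module _ {u v : V} where
      line-resp : {x y : V} → x ≈v y → OnLine u v x → OnLine u v y
      line-resp e (a , b , p) = a , b , vtrans (vsym e) p

      line-u : OnLine u v u
      line-u = 1# , 0# , λ i → solve 2 (λ u v → u := con true :* u :+ con false :* v) refl (u i) (v i)

      line-v : OnLine u v v
      line-v = 0# , 1# , λ i → solve 2 (λ u v → v := con false :* u :+ con true :* v) refl (u i) (v i)

      line-0 : OnLine u v 0v
      line-0 = 0# , 0# , λ i → solve 2 (λ u v → con false := con false :* u :+ con false :* v) refl (u i) (v i)

      line-+ : {x y : V} → OnLine u v x → OnLine u v y → OnLine u v (x +v y)
      line-+ (a , b , e) (a' , b' , e') = a + a' , b + b' , λ i → trans (+-cong (e i) (e' i))
        (solve 6 (λ a b a' b' u v → (a :* u :+ b :* v) :+ (a' :* u :+ b' :* v) := (a :+ a') :* u :+ (b :+ b') :* v) refl a b a' b' (u i) (v i))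

      line-· : ∀ c {x : V} → OnLine u v x → OnLine u v (c · x)
      line-· c (a , b , e) = c * a , c * b , λ i → trans (*-congˡ (e i))
        (solve 5 (λ a b c u v → c :* (a :* u :+ b :* v) := c :* a :* u :+ c :* b :* v) refl a b c (u i) (v i))

      line-·⁻¹ : ∀ {c} {x : V} → ¬ c ≈ 0# → OnLine u v (c · x) → OnLine u v x
      line-·⁻¹ c≉0 l = line-resp (vsym (inv-· c≉0 vrefl)) (line-· _ l)

      line-prop : {x y : V} → Proportional x y → OnLine u v y → OnLine u v x
      line-prop (a , _ , e) l = line-resp (vsym e) (line-· a l)

      -- x = (x + y) + y in characteristic 2.
      line-+⁻¹ : {x y : V} → OnLine u v (x +v y) → OnLine u v y → OnLine u v x
      line-+⁻¹ {x} {y} l l' = line-resp (λ i → solve 2 (λ x y → (x :+ y) :+ y := x) refl (x i) (y i)) (line-+ l l')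

      abstract
        online? : ∀ x → Dec (OnLine u v x)
        online? x = any-scalar? (λ { e (b , p) → b , λ i → trans (p i) (+-congʳ (*-congʳ e)) })
          (λ a → any-scalar? (λ e p i → trans (p i) (+-congˡ (*-congʳ e))) (λ b → x ≟v ((a · u) +v (b · v))))

    line-⊆ : {u v u' v' x : V} → OnLine u v u' → OnLine u v v' → OnLine u' v' x → OnLine u v x
    line-⊆ lu lv (a , b , e) = line-resp (vsym e) (line-+ (line-· a lu) (line-· b lv))

    line-swap : {u v x : V} → OnLine u v x → OnLine v u x
    line-swap = line-⊆ line-v line-u

    indep : {u v : V} → NonZeroV u → NonZeroV v → ¬ Proportional u v → Indep2 u v
    indep {u} {v} u≉0 v≉0 u≁v a b e with a ≟ 0# | b ≟ 0#
    ... | yes a≈0 | _ = a≈0 , a·x≈0⇒a≈0 v≉0 (vtrans (λ i → solve 2 (λ x y → y := con false :+ y) refl (a * u i) (b * v i))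
                                  (vtrans (vcong+ (vsym (0·x≈0 a≈0)) vrefl) e))
    ... | no a≉0 | yes b≈0 = contradiction (a·x≈0⇒x≈0 a≉0 (vtrans (vtrans (λ i → sym (+-identityʳ _)) (vcong+ vrefl (vsym (0·x≈0 b≈0)))) e)) u≉0
    ... | no a≉0 | no b≉0 = contradiction (prop-trans (prop-trans (prop-sym (·-prop a≉0)) (prop-refl (x+y≈0⇒x≈vy e))) (·-prop b≉0)) u≁v

    module _ {u v : V} (ind : Indep2 u v) where
      indep-u : NonZeroV u
      indep-u u≈0 = 1≉0 (proj₁ (ind 1# 0# λ i → trans (+-cong (*-congˡ (u≈0 i)) refl)
          (solve 1 (λ v → con true :* con false :+ con false :* v := con false) refl (v i))))

      indep-v : NonZeroV v
      indep-v v≈0 = 1≉0 (proj₂ (ind 0# 1# λ i → trans (+-cong refl (*-congˡ (v≈0 i)))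
          (solve 1 (λ v → con false :* v :+ con true :* con false := con false) refl (u i))))

      indep-≁ : ¬ Proportional u v
      indep-≁ (a , a≉0 , e) = 1≉0 (proj₁ (ind 1# a λ i → by₁ 1# (e i)
        (solve 3 (λ a u v → (con true :* u :+ a :* v) :+ con false := con true :* (u :+ a :* v)) refl a (u i) (v i))))

      indep-swap : Indep2 v u
      indep-swap a b e = let b≈0 , a≈0 = ind b a (λ i → trans (+-comm _ _) (e i)) in a≈0 , b≈0

      coords-unique : ∀ {a b a' b'} → ((a · u) +v (b · v)) ≈v ((a' · u) +v (b' · v)) → (a ≈ a') × (b ≈ b')
      coords-unique {a} {b} {a'} {b'} e with ind (a + a') (b + b') (λ i → by₁ 1# (e i)
        (solve 6 (λ a b a' b' u v → ((a :+ a') :* u :+ (b :+ b') :* v) :+ con false :=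
          con true :* ((a :* u :+ b :* v) :+ (a' :* u :+ b' :* v))) refl a b a' b' (u i) (v i)))
      ... | p , p' = x+y≈0⇒x≈y p , x+y≈0⇒x≈y p'

    exchange : {u v x : V} → NonZeroV x → ¬ Proportional x u → OnLine u v x → OnLine u x v
    exchange {u} {v} {x} x≉0 x≁u (a , b , e) with b ≟ 0# | a ≟ 0#
    ... | no b≉0 | _ = inv b b≉0 * a , inv b b≉0 , λ i → by₂ (inv b b≉0) (e i) (v i) (inv-l b b≉0)
            (solve 6 (λ a b b' u v x → v :+ (b' :* a :* u :+ b' :* x) := b' :* (x :+ (a :* u :+ b :* v)) :+ v :* (b' :* b :+ con true))
              refl a b (inv b b≉0) (u i) (v i) (x i))
    ... | yes b≈0 | no a≉0 = contradiction (a , a≉0 , vtrans e λ i → trans (+-congˡ (trans (*-congʳ b≈0) (zeroˡ _))) (+-identityʳ _)) x≁u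
    ... | yes b≈0 | yes a≈0 = contradiction (vtrans e λ i → trans (+-cong (trans (*-congʳ a≈0) (zeroˡ _)) (trans (*-congʳ b≈0) (zeroˡ _)))
        (+-identityʳ _)) x≉0

    -- Steinitz exchange, applied twice: u' replaces v, or u if the two are proportional, and then
    -- v' replaces the vector that is left.
    line-⊇ : {u v u' v' x : V} → Indep2 u' v' → OnLine u v u' → OnLine u v v' → OnLine u v x → OnLine u' v' x
    line-⊇ {u} {v} {u'} {v'} ind lu lv lx with prop? u' u
    ... | no u'≁u = line-⊆ u∈ (exch (λ p → indep-≁ ind (prop-sym p)) lv) lx'
      where
      u'≉0 = indep-u ind
      lv₂ : OnLine u u' v
      lv₂ = exchange u'≉0 u'≁u lu
      exch : ¬ Proportional v' u' → OnLine u v v' → OnLine u' v' u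
      exch v'≁u' l = exchange (indep-v ind) v'≁u' (line-swap (line-⊆ line-u lv₂ l))
      u∈ = line-u
      lx' : OnLine u' u _
      lx' = line-swap (line-⊆ line-u lv₂ lx)
    ... | yes u'∼u = line-⊆ (line-prop (prop-sym u'∼u) line-u) v∈ lx
      where
      v∈ : OnLine u' v' v
      v∈ = line-⊆ (line-prop (prop-sym u'∼u) line-u) line-v (exchange (indep-v ind) (λ p → indep-≁ ind (prop-trans u'∼u (prop-sym p))) lv)

-- Points and lines

module PointSets {c ℓ} (F : FiniteField c ℓ) (1+1≈0 : FiniteField._≈_ F (FiniteField._+_ F (FiniteField.1# F) (FiniteField.1# F)) (FiniteField.0# F)) (m : ℕ) where
  open FiniteField F hiding (zero)
  open FieldBasics F
  open Char2 F 1+1≈0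
  open Vectors m
  V : Set c
  V = Geom.V F m

  _∼_ : V → V → Set (c ⊔ ℓ)
  _∼_ = Proportional

  module _ {P : V → Set (c ⊔ ℓ)} {N : ℕ} (np : NumPoints P N) where
    private
      f = proj₁ np
      idx : ∀ {x} → NonZeroV x → P x → Fin N
      idx x≉0 Px = proj₁ (proj₂ (proj₂ (proj₂ np)) _ x≉0 Px)
      idx-∼ : ∀ {x} (x≉0 : NonZeroV x) (Px : P x) → x ∼ f (idx x≉0 Px)
      idx-∼ x≉0 Px = proj₂ (proj₂ (proj₂ (proj₂ np)) _ x≉0 Px)

    np-≤ : ∀ {j} (g : Fin j → V) → (∀ i → NonZeroV (g i) × P (g i)) → (∀ i i' → g i ∼ g i' → i ≡ i') → j ≤ N
    np-≤ g ok inj = Finₚ.injective⇒≤ {f = λ i → idx (proj₁ (ok i)) (proj₂ (ok i))} λ {x} {y} e →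
      inj x y (prop-trans (idx-∼ _ (proj₂ (ok x))) (prop-sym (≡.subst (λ i → g y ∼ f i) (≡.sym e) (idx-∼ _ (proj₂ (ok y))))))

    np-≥ : ∀ {j} (g : Fin j → V) → (∀ x → NonZeroV x → P x → ∃ λ i → x ∼ g i) → N ≤ j
    np-≥ g all = Finₚ.injective⇒≤ {f = λ i → proj₁ (hit i)} λ {x} {y} e →
      proj₁ (proj₂ (proj₂ np)) x y (prop-trans (proj₂ (hit x)) (prop-sym (≡.subst (λ i → f y ∼ g i) (≡.sym e) (proj₂ (hit y)))))
      where
      hit : ∀ i → ∃ λ j → f i ∼ g j
      hit i = all (f i) (proj₁ (proj₁ (proj₂ np) i)) (proj₂ (proj₁ (proj₂ np) i))

    lookup-inj : ∀ {xs} → AllPairs (λ x y → ¬ x ∼ y) xs → ∀ i j → List.lookup xs i ∼ List.lookup xs j → i ≡ j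
    lookup-inj {_ ∷ _} _ zero zero p = ≡.refl
    lookup-inj {_ ∷ xs} (≁ ∷ _) zero (suc j) p = contradiction p (All.lookup ≁ (∈-lookup j))
    lookup-inj {_ ∷ xs} (≁ ∷ _) (suc i) zero p = contradiction (prop-sym p) (All.lookup ≁ (∈-lookup i))
    lookup-inj (_ ∷ ps) (suc i) (suc j) p = ≡.cong suc (lookup-inj ps i j p)

    np-list : ∀ {xs} → All (λ x → NonZeroV x × P x) xs → AllPairs (λ x y → ¬ x ∼ y) xs → length xs ≤ N
    np-list {xs} ok ps = np-≤ (List.lookup xs) (λ i → All.lookup ok (∈-lookup i)) (lookup-inj ps)

    np-avoid : (xs : List V) → length xs < N → ∃ λ i → All (λ x → ¬ f i ∼ x) xs
    np-avoid xs |xs|<N with Finₚ.any? (λ i → All.all? (λ x → ¬? (prop? (f i) x)) xs)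
    ... | yes found = found
    ... | no ¬found = contradiction (np-≥ (List.lookup xs) cover) (ℕₚ.<⇒≱ |xs|<N)
      where
      listed : ∀ x ys → ¬ All (λ y → ¬ x ∼ y) ys → ∃ λ i → x ∼ List.lookup ys i
      listed x [] ¬all = contradiction [] ¬all
      listed x (y ∷ ys) ¬all with prop? x y
      ... | yes p = zero , p
      ... | no ¬p with listed x ys (λ all → ¬all (¬p ∷ all))
      ...   | i , p = suc i , p
      cover : ∀ x → NonZeroV x → P x → ∃ λ i → x ∼ List.lookup xs i
      cover x x≉0 Px with listed (f (idx x≉0 Px)) xs (λ all → ¬found (idx x≉0 Px , all))
      ... | i , p = i , prop-trans (idx-∼ x≉0 Px) p

  np-transport : ∀ {P R : V → Set (c ⊔ ℓ)} {N} → (∀ {x} → NonZeroV x → P x → R x) → (∀ {x} → NonZeroV x → R x → P x) → NumPoints P N → NumPoints R N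
  np-transport to from (f , ok , inj , all) = f , (λ i → proj₁ (ok i) , to (proj₁ (ok i)) (proj₂ (ok i))) , inj , λ x x≉0 Rx → all x x≉0 (from x≉0 Rx)

  module _ {u v : V} (ind : Indep2 u v) where
    shear-≉0 : ∀ a → NonZeroV (v +v (a · u))
    shear-≉0 a e = 1≉0 (proj₂ (ind a 1# λ i → by₁ 1# (e i)
      (solve 3 (λ a u v → (a :* u :+ con true :* v) :+ con false := con true :* ((v :+ a :* u) :+ con false)) refl a (u i) (v i))))

    shear-≁ : ∀ {a} → ¬ (v +v (a · u)) ∼ u
    shear-≁ {a} (s , s≉0 , e) = 1≉0 (proj₂ (ind (a + s) 1# λ i → by₁ 1# (e i)
      (solve 4 (λ a s u v → ((a :+ s) :* u :+ con true :* v) :+ con false := con true :* ((v :+ a :* u) :+ s :* u)) refl a s (u i) (v i))))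

    shear-inj : ∀ {a b} → (v +v (a · u)) ∼ (v +v (b · u)) → a ≈ b
    shear-inj {a} {b} (s , s≉0 , e) with ind (a + s * b) (1# + s) (λ i → by₁ 1# (e i)
      (solve 5 (λ a b s u v → ((a :+ s :* b) :* u :+ (con true :+ s) :* v) :+ con false := con true :*
          ((v :+ a :* u) :+ s :* (v :+ b :* u))) refl a b s (u i) (v i)))
    ... | p , p' = by₂ 1# p b p' (solve 3 (λ a b s → a :+ b := con true :* ((a :+ s :* b) :+ con false) :+ b :*
        ((con true :+ s) :+ con false)) refl a b s)

    shear-indep : ∀ a → Indep2 u (v +v (a · u))
    shear-indep a = indep (indep-u ind) (shear-≉0 a) (λ p → shear-≁ (prop-sym p))

    line-normal : ∀ {x} → NonZeroV x → ¬ x ∼ u → OnLine u v x → ∃ λ a → x ∼ (v +v (a · u))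
    line-normal {x} x≉0 x≁u (a , b , e) with b ≟ 0#
    ... | no b≉0 = inv b b≉0 * a , b , b≉0 , λ i → by₂ 1# (e i) (a * u i) (inv-r b b≉0)
          (solve 6 (λ a b b' u v x → x :+ b :* (v :+ (b' :* a) :* u) := con true :* (x :+ (a :* u :+ b :* v)) :+ (a :* u) :* (b :* b' :+ con true))
            refl a b (inv b b≉0) (u i) (v i) (x i))
    ... | yes b≈0 with a ≟ 0#
    ...   | no a≉0 = contradiction (a , a≉0 , vtrans e (λ i → trans (+-congˡ (trans (*-congʳ b≈0) (zeroˡ _))) (+-identityʳ _))) x≁u
    ...   | yes a≈0 = contradiction (vtrans e λ i → trans (+-cong (trans (*-congʳ a≈0) (zeroˡ _)) (trans (*-congʳ b≈0) (zeroˡ _)))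
        (+-identityʳ _)) x≉0

    -- The q + 1 points of the line. With u at index zero, the points other than u are indexed by
    -- scalars, so a q × q grid of points can be counted by rows and by columns.
    pt : Fin (suc size) → V
    pt zero = u
    pt (suc i) = v +v (enum i · u)

    pt-≉0 : ∀ i → NonZeroV (pt i)
    pt-≉0 zero = indep-u ind
    pt-≉0 (suc i) = shear-≉0 (enum i)

    pt-on : ∀ i → OnLine u v (pt i)
    pt-on zero = line-u
    pt-on (suc i) = line-+ line-v (line-· _ line-u)

    pt-inj : ∀ i j → pt i ∼ pt j → i ≡ j
    pt-inj zero zero p = ≡.refl
    pt-inj zero (suc j) p = contradiction (prop-sym p) shear-≁
    pt-inj (suc i) zero p = contradiction p shear-≁
    pt-inj (suc i) (suc j) p = ≡.cong suc (enum-inj i j (shear-inj p))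

    pt-all : ∀ x → NonZeroV x → OnLine u v x → ∃ λ i → x ∼ pt i
    pt-all x x≉0 lx with prop? x u
    ... | yes x∼u = zero , x∼u
    ... | no x≁u with line-normal x≉0 x≁u lx
    ...   | a , p = suc (ι a) , prop-trans p (prop-refl (vcong+ vrefl (vcong· (ι-≈ a) vrefl)))

    module _ {P : V → Set (c ⊔ ℓ)} (P-resp : ∀ {x y} → NonZeroV y → x ∼ y → P x → P y) (P? : ∀ x → NonZeroV x → Dec (P x)) where
      line-count : ∀ {N} → NumPoints (λ x → OnLine u v x × P x) N → count (λ i → P? (pt i) (pt-≉0 i)) ≡ N
      line-count {N} np = ℕₚ.≤-antisym
          (np-≤ np (pt ∘ el) (λ j → pt-≉0 (el j) , pt-on (el j) , el-sat j) (λ i j p → el-inj (pt-inj _ _ p)))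
          (count-lower Pt? (proj₁ ∘ hit) (λ j → P-resp {proj₁ np j} {pt (proj₁ (hit j))} (pt-≉0 (proj₁ (hit j))) (proj₂ (hit j))
              (proj₂ (proj₂ (ok j)))) λ {x} {y} e →
            proj₁ (proj₂ (proj₂ np)) x y (prop-trans (proj₂ (hit x)) (prop-sym (≡.subst (λ i → proj₁ np y ∼ pt i) (≡.sym e) (proj₂ (hit y))))))
        where
        Pt? = λ i → P? (pt i) (pt-≉0 i)
        open Selection (select Pt?)
        ok = proj₁ (proj₂ np)
        hit : ∀ j → ∃ λ i → proj₁ np j ∼ pt i
        hit j = pt-all _ (proj₁ (ok j)) (proj₁ (proj₂ (ok j)))

-- The hypotheses after scaling the points of Q to have zeroth coordinate 1: in characteristic two
-- the direction of two points is then simply A i + A j. `D⇒` speaks of nonzero vectors only,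
-- because the intended predicate `InD` also holds at 0v, which is no point. `n²≡` records that n =
-- q^k with m = 2k.
record DirectionSet {c ℓ} (F : FiniteField c ℓ) (m : ℕ) : Set (Level.suc (c ⊔ ℓ)) where
  open FiniteField F using (_≈_; _+_; 0#; 1#; size)
  open Geom F
  field
    1+1≈0 : 1# + 1# ≈ 0#
    n : ℕ
    A : Fin n → V m
    A-inj : ∀ {i j} → A i ≈v A j → i ≡ j
    D : V m → Set (c ⊔ ℓ)
    D⇒ : ∀ {x} → NonZeroV x → D x → ∃₂ λ i j → i ≢ j × Proportional x (A i +v A j)
    D⇐ : ∀ {x i j} → i ≢ j → Proportional x (A i +v A j) → D x
    numD : NumPoints D (n ∸ 1)
    lines : ∀ u v → Indep2 u v → let P = λ x → OnLine u v x × D x in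
      NumPoints P 0 ⊎ NumPoints P 1 ⊎ NumPoints P 3 ⊎ NumPoints P (size ∸ 1)
    16≤q : 16 ≤ size
    q<n : size < n
    A-affine : ∀ i → A i zero ≈ 1#
    n²≡ : n ℕ.* n ≡ size ℕ.^ m

-- Directions, holes and the planes through them

module Directions {c ℓ} {F : FiniteField c ℓ} {m : ℕ} (S : DirectionSet F m) where
  open DirectionSet S public
  open FiniteField F hiding (zero)
  open FieldBasics F
  open Char2 F 1+1≈0
  open Vectors m
  open PointSets F 1+1≈0 m

  ∂ : Fin n → Fin n → V
  ∂ i j = A i +v A j

  ∂-≉0 : ∀ {i j} → i ≢ j → NonZeroV (∂ i j)
  ∂-≉0 i≢j e = i≢j (A-inj (x+y≈0⇒x≈vy e))

  ∂-comm : ∀ i j → ∂ i j ≈v ∂ j i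
  ∂-comm i j t = +-comm _ _

  ∂-trans : ∀ i j l → ∂ i l ≈v (∂ i j +v ∂ j l)
  ∂-trans i j l t = solve 3 (λ x y z → x :+ z := (x :+ y) :+ (y :+ z)) refl (A i t) (A j t) (A l t)

  ∂-D : ∀ {i j} → i ≢ j → D (∂ i j)
  ∂-D i≢j = D⇐ i≢j (prop-refl vrefl)

  D-resp : ∀ {x y} → NonZeroV y → x ∼ y → D x → D y
  D-resp y≉0 x∼y Dx = let i , j , i≢j , p = D⇒ (prop-nonzero x∼y y≉0) Dx in D⇐ i≢j (prop-trans (prop-sym x∼y) p)

  dpt : Fin (n ∸ 1) → V
  dpt = proj₁ numD

  abstract
    D? : ∀ x → NonZeroV x → Dec (D x)
    D? x x≉0 = map′ (λ { (y , p) → D-resp x≉0 (prop-sym p) (proj₂ (proj₁ (proj₂ numD) y)) })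
                    (proj₂ (proj₂ (proj₂ numD)) x x≉0) (Finₚ.any? (λ y → prop? x (dpt y)))

  LineD : V → V → V → Set (c ⊔ ℓ)
  LineD u v x = OnLine u v x × D x

  Is-secant : V → V → Set (c ⊔ ℓ)
  Is-secant u v = NumPoints (LineD u v) (size ∸ 1)

  3≤q-1 : 3 ≤ size ∸ 1
  3≤q-1 = ℕₚ.≤-trans (s≤s (s≤s (s≤s z≤n))) (ℕₚ.∸-monoˡ-≤ 1 16≤q)

  4≤q-1 : 4 ≤ size ∸ 1
  4≤q-1 = ℕₚ.≤-trans (s≤s (s≤s (s≤s (s≤s z≤n)))) (ℕₚ.∸-monoˡ-≤ 1 16≤q)

  2-points⇒ : ∀ {u v x y} → Indep2 u v → NonZeroV x → NonZeroV y → LineD u v x → LineD u v y → ¬ x ∼ y →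
    NumPoints (LineD u v) 3 ⊎ Is-secant u v
  2-points⇒ {u} {v} ind x≉0 y≉0 lx ly x≁y with lines u v ind
  ... | inj₁ np = contradiction (np-list np ((x≉0 , lx) ∷ (y≉0 , ly) ∷ []) ((x≁y ∷ []) ∷ [] ∷ [])) λ ()
  ... | inj₂ (inj₁ np) = contradiction (np-list np ((x≉0 , lx) ∷ (y≉0 , ly) ∷ []) ((x≁y ∷ []) ∷ [] ∷ [])) λ { (s≤s ()) }
  ... | inj₂ (inj₂ s) = s

  4-points⇒ : ∀ {u v w x y z} → Indep2 u v → All (λ x → NonZeroV x × LineD u v x) (w ∷ x ∷ y ∷ z ∷ []) →
    AllPairs (λ x y → ¬ x ∼ y) (w ∷ x ∷ y ∷ z ∷ []) → Is-secant u v
  4-points⇒ {u} {v} ind ok@((w≉0 , lw) ∷ (x≉0 , lx) ∷ _) ps@((w≁x ∷ _) ∷ _) with 2-points⇒ ind w≉0 x≉0 lw lx w≁x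
  ... | inj₁ np = contradiction (np-list np ok ps) λ { (s≤s (s≤s (s≤s ()))) }
  ... | inj₂ s = s

  pt-D? : ∀ {u v} (ind : Indep2 u v) i → Dec (D (pt ind i))
  pt-D? ind i = D? (pt ind i) (pt-≉0 ind i)

  line-size≤ : ∀ u v → Indep2 u v → ∃ λ N → N ≤ size ∸ 1 × NumPoints (LineD u v) N
  line-size≤ u v ind with lines u v ind
  ... | inj₁ np = 0 , z≤n , np
  ... | inj₂ (inj₁ np) = 1 , ℕₚ.≤-trans (s≤s z≤n) 3≤q-1 , np
  ... | inj₂ (inj₂ (inj₁ np)) = 3 , 3≤q-1 , np
  ... | inj₂ (inj₂ (inj₂ np)) = size ∸ 1 , ℕₚ.≤-refl , np

  pts-in-D : ∀ {u v} (ind : Indep2 u v) {N} → NumPoints (LineD u v) N → count (pt-D? ind) ≡ N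
  pts-in-D ind np = line-count ind {P = D} D-resp D? np

  pts-off-D : ∀ {u v} (ind : Indep2 u v) {N} → NumPoints (LineD u v) N → N ℕ.+ count (λ i → ¬? (pt-D? ind i)) ≡ suc size
  pts-off-D ind np = ≡.trans (≡.cong (ℕ._+ count (λ i → ¬? (pt-D? ind i))) (≡.sym (pts-in-D ind np))) (count-complement (pt-D? ind))

  private
    off>0 : ∀ {N a s} → N ≤ s ∸ 1 → N ℕ.+ a ≡ suc s → 0 < a
    off>0 {N} {zero} {s} N≤ e = contradiction (ℕₚ.≤-trans N≤ (ℕₚ.m∸n≤m s 1)) (ℕₚ.<⇒≱ (ℕₚ.≤-reflexive (≡.trans (≡.sym e) (ℕₚ.+-identityʳ N))))
    off>0 {a = suc a} _ _ = s≤s z≤n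

  abstract
    -- Of the q + 1 points of a line at most q - 1 belong to D.
    hole : ∀ {u v} (ind : Indep2 u v) → ∃ λ i → ¬ D (pt ind i)
    hole {u} {v} ind = count-some {P = λ i → ¬ D (pt ind i)} (λ i → ¬? (pt-D? ind i)) pos
      where
      pos : 0 < count (λ i → ¬? (pt-D? ind i))
      pos = let N , N≤ , np = line-size≤ u v ind in off>0 N≤ (pts-off-D ind np)

    hole-beside : ∀ {d g} → D d → Indep2 d g → ∃ λ a → ¬ D (g +v (a · d))
    hole-beside {d} {g} Dd ind = beside (hole ind)
      where
      beside : (∃ λ i → ¬ D (pt ind i)) → ∃ λ a → ¬ D (g +v (a · d))
      beside (zero , ¬Dd) = contradiction Dd ¬Dd
      beside (suc i , ¬Dz) = enum i , ¬Dz

  parallel-inj : ∀ {z} → NonZeroV z → ¬ D z → ∀ {x y b} → ∂ x y ≈v (b · z) → x ≡ y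
  parallel-inj {z} z≉0 ¬Dz {x} {y} {b} e with x Finₚ.≟ y
  ... | yes x≡y = x≡y
  ... | no x≢y with b ≟ 0#
  ...   | yes b≈0 = contradiction (vtrans e (0·x≈0 b≈0)) (∂-≉0 x≢y)
  ...   | no b≉0 = contradiction (D-resp z≉0 (b , b≉0 , e) (∂-D x≢y)) ¬Dz

  -- Projection from the hole z: points of Q with equal d-coordinates differ by a multiple of z, and
  -- z is not a direction. So the plane r + ⟨d,z⟩ holds at most q points of Q.
  plane-inj : ∀ {d z} → NonZeroV z → ¬ D z → ∀ {r x y a a' b b'} → ∂ x r ≈v ((a · d) +v (b · z)) → ∂ y r ≈v ((a' · d) +v (b' · z)) → a ≈ a' → x ≡ y
  plane-inj {d} {z} z≉0 ¬Dz {r} {x} {y} {a} {a'} {b} {b'} e e' a≈a' = parallel-inj z≉0 ¬Dz {b = b + b'} λ i →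
    by₃ 1# (e i) 1# (e' i) (d i) a≈a' (solve 9 (λ x y r d z a b a' b' → (x :+ y) :+ (b :+ b') :* z :=
      con true :* ((x :+ r) :+ (a :* d :+ b :* z)) :+ (con true :* ((y :+ r) :+ (a' :* d :+ b' :* z)) :+ d :* (a :+ a')))
      refl (A x i) (A y i) (A r i) (d i) (z i) a b a' b')

  abstract
    -- Otherwise all n points of Q lie in one plane whose line at infinity has a hole, and n ≤ q.
    off-plane : ∀ {d g} → D d → Indep2 d g → ∀ r → ∃ λ x → ¬ OnLine d g (∂ x r)
    off-plane {d} {g} Dd ind r =
      [ (λ all → ⊥-elim (not-all all (hole-beside Dd ind))) , Finₚ.¬∀⟶∃¬ n _ (λ x → online? (∂ x r)) ]′
          (toSum (Finₚ.all? (λ x → online? {d} {g} (∂ x r))))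
      where
      not-all : (∀ x → OnLine d g (∂ x r)) → ¬ ∃ λ a → ¬ D (g +v (a · d))
      not-all all (a , ¬Dz) = contradiction (Finₚ.injective⇒≤ {f = ι ∘ proj₁ ∘ on} λ e →
            plane-inj (shear-≉0 ind a) ¬Dz (proj₂ (proj₂ (on _))) (proj₂ (proj₂ (on _))) (ι-inj e)) (ℕₚ.<⇒≱ q<n)
        where
        on : ∀ x → OnLine d (g +v (a · d)) (∂ x r)
        on x = line-⊇ (shear-indep ind a) line-u (line-+ line-v (line-· a line-u)) (all x)

-- No three points of Q are collinear

module Collinear {c ℓ} {F : FiniteField c ℓ} {m : ℕ} (S : DirectionSet F m)
  {r₁ r₂ r₃ : Fin (DirectionSet.n S)} (1≢2 : r₁ ≢ r₂) (1≢3 : r₁ ≢ r₃) (2≢3 : r₂ ≢ r₃)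
  (coll : Geom.Proportional F (Directions.∂ S r₃ r₁) (Directions.∂ S r₂ r₁)) where
  open Directions S
  open FiniteField F hiding (zero)
  open FieldBasics F
  open Char2 F 1+1≈0
  open Vectors m
  open PointSets F 1+1≈0 m

  d : V
  d = ∂ r₂ r₁

  d≉0 : NonZeroV d
  d≉0 = ∂-≉0 (1≢2 ∘ ≡.sym)

  Dd : D d
  Dd = ∂-D (1≢2 ∘ ≡.sym)

  On-ℓ : Fin n → Set (c ⊔ ℓ)
  On-ℓ x = ∃ λ a → ∂ x r₁ ≈v (a · d)

  abstract
    on-ℓ? : ∀ x → Dec (On-ℓ x)
    on-ℓ? x = any-scalar? (λ e p → vtrans p (vcong· e vrefl)) (λ a → ∂ x r₁ ≟v (a · d))

  off-indep : ∀ {x} → ¬ On-ℓ x → Indep2 d (∂ x r₁)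
  off-indep ¬on = indep d≉0 (λ e → ¬on (0# , vtrans e (vsym (0·x≈0 refl)))) λ p → ¬on (let a , _ , e = prop-sym p in a , e)

  -- Seen from x, the points r₁, r₂, r₃ lie in three different directions on the line at infinity of
  -- the plane of ℓ and x. Together with d these are four points of D.
  off-secant : ∀ {x} → ¬ On-ℓ x → Is-secant d (∂ x r₁)
  off-secant {x} ¬on = 4-points⇒ ind
      ((d≉0 , line-u , Dd) ∷ point x≢1 (0# , e₁) ∷ point x≢2 (1# , e₂) ∷ point x≢3 (s , e₃) ∷ [])
      ((≁d e₁ ∷ ≁d e₂ ∷ ≁d e₃ ∷ []) ∷ (≁ (λ p → 1≉0 (sym p)) e₁ e₂ ∷ ≁ (λ p → s≉0 (sym p)) e₁ e₃ ∷ []) ∷ (≁ 1≉s e₂ e₃ ∷ []) ∷ [] ∷ [])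
    where
    s = proj₁ coll
    s≉0 = proj₁ (proj₂ coll)
    e = proj₂ (proj₂ coll)
    ind = off-indep ¬on
    g = ∂ x r₁
    1≉s : ¬ 1# ≈ s
    1≉s 1≈s = 2≢3 (A-inj λ i → by₂ 1# (e i) (A r₂ i + A r₁ i) 1≈s
      (solve 4 (λ x y z s → y :+ z := con true :* ((z :+ x) :+ s :* (y :+ x)) :+ (y :+ x) :* (con true :+ s)) refl (A r₁ i) (A r₂ i) (A r₃ i) s))
    e₁ : ∂ x r₁ ≈v (g +v (0# · d))
    e₁ i = solve 2 (λ g d → g := g :+ con false :* d) refl (g i) (d i)
    e₂ : ∂ x r₂ ≈v (g +v (1# · d))
    e₂ i = solve 3 (λ x y z → z :+ y := (z :+ x) :+ con true :* (y :+ x)) refl (A r₁ i) (A r₂ i) (A x i)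
    e₃ : ∂ x r₃ ≈v (g +v (s · d))
    e₃ i = by₁ 1# (e i) (solve 4 (λ x z w sd → (w :+ z) :+ ((w :+ x) :+ sd) := con true :* ((z :+ x) :+ sd)) refl (A r₁ i) (A r₃ i) (A x i) (s * d i))
    x≢1 : x ≢ r₁
    x≢1 p = ¬on (0# , λ i → trans (≈v⇒+≈0 (λ t → reflexive (≡.cong (λ y → A y t) p)) i) (sym (zeroˡ _)))
    x≢2 : x ≢ r₂
    x≢2 ≡.refl = ¬on (1# , λ i → sym (*-identityˡ _))
    x≢3 : x ≢ r₃
    x≢3 ≡.refl = ¬on (s , e)
    point : ∀ {j} → x ≢ j → (∃ λ a → ∂ x j ≈v (g +v (a · d))) → NonZeroV (∂ x j) × LineD d g (∂ x j)
    point x≢j (a , p) = ∂-≉0 x≢j , line-resp (vsym p) (line-+ line-v (line-· a line-u)) , ∂-D x≢j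
    ≁d : ∀ {y a} → y ≈v (g +v (a · d)) → ¬ d ∼ y
    ≁d p q = shear-≁ ind (prop-sym (prop-respʳ p q))
    ≁ : ∀ {y z a b} → ¬ a ≈ b → y ≈v (g +v (a · d)) → z ≈v (g +v (b · d)) → ¬ y ∼ z
    ≁ a≉b p p' q = a≉b (shear-inj ind (prop-respˡ p (prop-respʳ p' q)))

  abstract
    x₀-off : ∃ λ x → ¬ On-ℓ x
    x₀-off with Finₚ.all? on-ℓ?
    ... | no ¬all = Finₚ.¬∀⟶∃¬ n _ on-ℓ? ¬all
    ... | yes all = contradiction (Finₚ.injective⇒≤ {f = λ x → ι (proj₁ (all x))} λ {x} {y} e →
            A-inj λ i → by₃ 1# (proj₂ (all x) i) 1# (proj₂ (all y) i) (d i) (ι-inj e)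
              (solve 6 (λ x y r d a b → x :+ y := con true :* ((x :+ r) :+ a :* d) :+ (con true :* ((y :+ r) :+ b :* d) :+ d :* (a :+ b)))
                refl (A x i) (A y i) (A r₁ i) (d i) (proj₁ (all x)) (proj₁ (all y)))) (ℕₚ.<⇒≱ q<n)

  x₀ : Fin n
  x₀ = proj₁ x₀-off

  abstract
    x₁-off : ∃ λ x → ¬ OnLine d (∂ x₀ r₁) (∂ x r₁)
    x₁-off = off-plane Dd (off-indep (proj₂ x₀-off)) r₁

  x₁ : Fin n
  x₁ = proj₁ x₁-off

  -- The plane through ℓ to which x is charged: points of ℓ are charged to the plane of x₀, except that r₁ is
  -- charged to the plane of x₁; in the count below r₁ stands for a second copy of r₃.
  Home : Fin n → Fin n → Set (c ⊔ ℓ)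
  Home x h = (x ≡ r₁ × h ≡ x₁) ⊎ (x ≢ r₁ × On-ℓ x × h ≡ x₀) ⊎ (¬ On-ℓ x × h ≡ x)

  abstract
    home′ : ∀ x → ∃ (Home x)
    home′ x = decide (x Finₚ.≟ r₁) (on-ℓ? x)
      where
      decide : Dec (x ≡ r₁) → Dec (On-ℓ x) → ∃ (Home x)
      decide (yes p) _ = x₁ , inj₁ (p , ≡.refl)
      decide (no ≢1) (yes on) = x₀ , inj₂ (inj₁ (≢1 , on , ≡.refl))
      decide (no _) (no ¬on) = x , inj₂ (inj₂ (¬on , ≡.refl))

  home : Fin n → Fin n
  home x = proj₁ (home′ x)

  home-off : ∀ x → ¬ On-ℓ (home x)
  home-off x = off (proj₂ (home′ x))
    where
    off : ∀ {h} → Home x h → ¬ On-ℓ h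
    off (inj₁ (_ , ≡.refl)) (a , e) = proj₂ x₁-off (line-resp (vsym e) (line-· a line-u))
    off (inj₂ (inj₁ (_ , _ , ≡.refl))) = proj₂ x₀-off
    off (inj₂ (inj₂ (¬on , ≡.refl))) = ¬on

  -- Coordinates in a plane through ℓ are measured from `r₁`, whose own value 0 has to stay free.
  -- When `r₁` is charged it borrows the coordinate of `r₃`, whose own charge goes to a different
  -- plane.
  Stand : Fin n → Fin n → Set
  Stand x s = (x ≡ r₁ × s ≡ r₃) ⊎ (x ≢ r₁ × s ≡ x)

  abstract
    stand′ : ∀ x → ∃ (Stand x)
    stand′ x with x Finₚ.≟ r₁
    ... | yes p = r₃ , inj₁ (p , ≡.refl)
    ... | no ¬p = x , inj₂ (¬p , ≡.refl)

  stand : Fin n → Fin n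
  stand x = proj₁ (stand′ x)

  stand≢1 : ∀ {x s} → Stand x s → s ≢ r₁
  stand≢1 (inj₁ (_ , ≡.refl)) = 1≢3 ∘ ≡.sym
  stand≢1 (inj₂ (≢1 , ≡.refl)) = ≢1

  stand≢2 : ∀ {x s} → Stand x s → x ≢ r₂ → s ≢ r₂
  stand≢2 (inj₁ (_ , ≡.refl)) _ = 2≢3 ∘ ≡.sym
  stand≢2 (inj₂ (_ , ≡.refl)) x≢2 = x≢2

  on₃ : On-ℓ r₃
  on₃ = proj₁ coll , proj₂ (proj₂ coll)

  Beside : Fin n → Fin (n ∸ 1) → Set (c ⊔ ℓ)
  Beside x y = ¬ dpt y ∼ d × OnLine d (∂ (home x) r₁) (dpt y)

  beside? : ∀ x y → Dec (Beside x y)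
  beside? x y = ¬? (prop? (dpt y) d) ×-dec online? (dpt y)

  -- Every point but r₂ is charged to at least q - 2 directions beside d, and each of the q^k - 2 directions other
  -- than d receives at most q - 2 charges.
  Charged : Fin n → Fin (n ∸ 1) → Set (c ⊔ ℓ)
  Charged x y = x ≢ r₂ × Beside x y

  charged? : ∀ x y → Dec (Charged x y)
  charged? x y = ¬? (x Finₚ.≟ r₂) ×-dec beside? x y

  row : ∀ x → x ≢ r₂ → size ∸ 1 ∸ 1 ≤ count (charged? x)
  row x x≢2 = go (off-secant (home-off x))
    where
    go : ∀ {N} → NumPoints (LineD d (∂ (home x) r₁)) N → N ∸ 1 ≤ count (charged? x)
    go {zero} np = z≤n
    go {suc N} (f , ok , inj , all) = count-lower (charged? x) (proj₁ ∘ hit)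
        (λ j → x≢2 , (λ p → Finₚ.punchInᵢ≢i i_d j (inj _ _ (prop-trans (proj₂ (hit j)) (prop-trans p (proj₂ (all d d≉0 (line-u , Dd)))))))
                   , line-prop (prop-sym (proj₂ (hit j))) (proj₁ (proj₂ (ok _))))
        λ {j} {j'} e → Finₚ.punchIn-injective i_d j j'
            (inj _ _ (prop-trans (proj₂ (hit j)) (prop-sym (≡.subst (λ y → f (punchIn i_d j') ∼ dpt y) (≡.sym e) (proj₂ (hit j'))))))
      where
      i_d = proj₁ (all d d≉0 (line-u , Dd))
      hit : ∀ j → ∃ λ y → f (punchIn i_d j) ∼ dpt y
      hit j = proj₂ (proj₂ (proj₂ numD)) _ (proj₁ (ok _)) (proj₂ (proj₂ (ok _)))

  column≁ : ∀ y → ¬ dpt y ∼ d → count (λ x → charged? x y) ≤ size ∸ 1 ∸ 1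
  -- The coordinate runs along d with origin `r₁`. A stand-in is neither `r₁`, at 0, nor `r₂`, at 1,
  -- so at most q - 2 values remain.
  column≁ y y≁d = ≡.subst (count (λ x → charged? x y) ≤_) (≡.sym (ℕₚ.∸-+-assoc size 1 1)) (ℕₚ.m+n≤o⇒m≤o∸n _ (≡.subst (_≤ size) (ℕₚ.+-comm 2 _)
      (count-upper (λ x → charged? x y) (λ x ch → ι (coord x ch)) coord-inj {ι 0#} {ι 1#} (λ e → 1≉0 (sym (ι-inj e))) ≢0 ≢1)))
    where
    y≉0 : NonZeroV (dpt y)
    y≉0 = proj₁ (proj₁ (proj₂ numD) y)
    ind : Indep2 d (dpt y)
    ind = indep d≉0 y≉0 (y≁d ∘ prop-sym)
    a = proj₁ (hole-beside Dd ind)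
    ¬Dz = proj₂ (hole-beside Dd ind)
    z = dpt y +v (a · d)
    z≉0 = shear-≉0 ind a
    Plane : Fin n → Set (c ⊔ ℓ)
    Plane x = OnLine d z (∂ x r₁)
    to-z : ∀ {x} → OnLine d (dpt y) x → OnLine d z x
    to-z = line-⊇ (shear-indep ind a) line-u (line-+ line-v (line-· a line-u))
    ℓ⊆ : ∀ {x} → On-ℓ x → Plane x
    ℓ⊆ (s , e) = line-resp (vsym e) (line-· s line-u)
    plane′ : ∀ {x h s} → Home x h → Stand x s → OnLine d (∂ h r₁) (dpt y) → Plane s
    plane′ _ (inj₁ (_ , ≡.refl)) _ = ℓ⊆ on₃
    plane′ (inj₁ (p , _)) (inj₂ (¬p , _)) _ = contradiction p ¬p
    plane′ (inj₂ (inj₁ (_ , on , _))) (inj₂ (_ , ≡.refl)) _ = ℓ⊆ on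
    plane′ (inj₂ (inj₂ (_ , ≡.refl))) (inj₂ (_ , ≡.refl)) on = to-z (exchange y≉0 y≁d on)
    plane : ∀ x → Charged x y → Plane (stand x)
    plane x ch = plane′ (proj₂ (home′ x)) (proj₂ (stand′ x)) (proj₂ (proj₂ ch))
    coord : ∀ x → Charged x y → Carrier
    coord x ch = proj₁ (plane x ch)
    at : ∀ x → (on : Plane x) → ∀ {x'} → (on' : Plane x') → proj₁ on ≈ proj₁ on' → x ≡ x'
    at x (_ , _ , e) (_ , _ , e') = plane-inj z≉0 ¬Dz e e'
    -- `r₁` and `r₃` share a stand-in, but they are charged to the planes of `x₁` and `x₀`. Since
    -- `x₁` is off the plane of `x₀`, the two lines at infinity share only d, and y is another
    -- direction.
    not-both : ∀ {x x' h h'} → x ≡ r₁ → x' ≡ r₃ → Home x h → Home x' h' → OnLine d (∂ h r₁) (dpt y) → OnLine d (∂ h' r₁) (dpt y) → ⊥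
    not-both ≡.refl _ (inj₂ (inj₁ (¬p , _))) _ _ _ = ¬p ≡.refl
    not-both ≡.refl _ (inj₂ (inj₂ (¬on , _))) _ _ _ = ¬on (0# , λ i → trans (x+x≈0 _) (sym (zeroˡ _)))
    not-both _ ≡.refl _ (inj₁ (p , _)) _ _ = 1≢3 (≡.sym p)
    not-both _ ≡.refl _ (inj₂ (inj₂ (¬on , _))) _ _ = ¬on on₃
    not-both _ _ (inj₁ (_ , ≡.refl)) (inj₂ (inj₁ (_ , _ , ≡.refl))) on on' = proj₂ x₁-off (line-⊆ line-u on' (exchange y≉0 y≁d on))
    stand-inj : ∀ {x x' h h' s s'} → Home x h → Home x' h' → Stand x s → Stand x' s' →
      OnLine d (∂ h r₁) (dpt y) → OnLine d (∂ h' r₁) (dpt y) → s ≡ s' → x ≡ x'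
    stand-inj _ _ (inj₁ (p , _)) (inj₁ (p' , _)) _ _ _ = ≡.trans p (≡.sym p')
    stand-inj H H' (inj₁ (p , ≡.refl)) (inj₂ (_ , ≡.refl)) on on' e = ⊥-elim (not-both p (≡.sym e) H H' on on')
    stand-inj H H' (inj₂ (_ , ≡.refl)) (inj₁ (p' , ≡.refl)) on on' e = ⊥-elim (not-both p' e H' H on' on)
    stand-inj _ _ (inj₂ (_ , ≡.refl)) (inj₂ (_ , ≡.refl)) _ _ e = e
    coord-inj : ∀ {x x'} ch ch' → ι (coord x ch) ≡ ι (coord x' ch') → x ≡ x'
    coord-inj {x} {x'} ch ch' e = stand-inj (proj₂ (home′ x)) (proj₂ (home′ x')) (proj₂ (stand′ x)) (proj₂ (stand′ x')) (proj₂ (proj₂ ch))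
        (proj₂ (proj₂ ch')) (at _ (plane x ch) (plane x' ch') (ι-inj e))
    ≢0 : ∀ x ch → ι (coord x ch) ≢ ι 0#
    ≢0 x ch e = stand≢1 (proj₂ (stand′ x)) (at _ (plane x ch)
        (0# , 0# , λ i → solve 3 (λ r d z → r :+ r := con false :* d :+ con false :* z) refl (A r₁ i) (d i) (z i)) (ι-inj e))
    ≢1 : ∀ x ch → ι (coord x ch) ≢ ι 1#
    ≢1 x ch e = stand≢2 (proj₂ (stand′ x)) (proj₁ ch)
        (at _ (plane x ch) (1# , 0# , λ i → solve 2 (λ d z → d := con true :* d :+ con false :* z) refl (d i) (z i)) (ι-inj e))

  column : ∀ y → count (λ x → charged? x y) ≤ size ∸ 1 ∸ 1
  column y = [ (λ p → ℕₚ.≤-trans (ℕₚ.≤-reflexive (count-none (λ x → charged? x y) (λ { x (_ , ≁ , _) → ≁ p }))) z≤n) , column≁ y ]′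
      (toSum (prop? (dpt y) d))

  impossible : ⊥
  -- The rows yield at least (n - 1)(q - 2) charges. There are n - 1 columns, that of d is empty,
  -- and the others hold at most q - 2 each: at most (n - 2)(q - 2) in all.
  impossible = ℕₚ.<-irrefl ≡.refl (ℕₚ.≤-trans
      (ℕₚ.*-monoˡ-< _ ⦃ nz ⦄ (pred< (n ∸ 1) (ℕₚ.∸-monoˡ-≤ 1 (ℕₚ.≤-trans (s≤s (ℕₚ.≤-trans (s≤s z≤n) 16≤q)) q<n))))
    (ℕₚ.≤-trans (sum-lower-except r₂ row)
      (ℕₚ.≤-trans (ℕₚ.≤-reflexive (double-count charged?)) (sum-upper-except y_d none column))))
    where
    pred< : ∀ N → 1 ≤ N → N ∸ 1 < N
    pred< (suc N) _ = ℕₚ.≤-refl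
    nz : ℕ.NonZero (size ∸ 1 ∸ 1)
    nz = ℕ.>-nonZero (ℕₚ.∸-monoˡ-≤ 1 (ℕₚ.≤-trans (s≤s (s≤s z≤n)) 3≤q-1))
    y_d = proj₁ (proj₂ (proj₂ (proj₂ numD)) d d≉0 Dd)
    none : count (λ x → charged? x y_d) ≡ 0
    none = count-none (λ x → charged? x y_d) λ { x (_ , ≁ , _) → ≁ (prop-sym (proj₂ (proj₂ (proj₂ (proj₂ numD)) d d≉0 Dd))) }

-- Two secants do not share a direction

module Translations {c ℓ} {F : FiniteField c ℓ} {m : ℕ} (S : DirectionSet F m) where
  open Directions S
  open FiniteField F hiding (zero)
  open FieldBasics F
  open Char2 F 1+1≈0
  open Vectors m
  open PointSets F 1+1≈0 m

  no-three-collinear : ∀ {i j l} → i ≢ l → j ≢ l → i ≢ j → ¬ ∂ i l ∼ ∂ j l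
  no-three-collinear i≢l j≢l i≢j p = Collinear.impossible S (j≢l ∘ ≡.sym) (i≢l ∘ ≡.sym) (i≢j ∘ ≡.sym) p

  see-unique : ∀ {r s t} → s ≢ r → t ≢ r → ∂ s r ∼ ∂ t r → s ≡ t
  see-unique {r} {s} {t} s≢r t≢r p with s Finₚ.≟ t
  ... | yes s≡t = s≡t
  ... | no s≢t = contradiction p (no-three-collinear s≢r t≢r s≢t)

  abstract
    -- By `see-unique` the n - 1 points other than r determine distinct directions with r, and D has
    -- only n - 1 points, so none is left unseen.
    see : ∀ r {x} → NonZeroV x → D x → ∃ λ s → s ≢ r × x ∼ ∂ s r
    see r {x} x≉0 Dx = seen (others-surj r (λ s s≢r → proj₁ (idx s s≢r)) inj (proj₁ y))
      where
      all : ∀ x → NonZeroV x → D x → ∃ λ y → x ∼ dpt y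
      all = proj₂ (proj₂ (proj₂ numD))
      idx : ∀ s → s ≢ r → ∃ λ y → ∂ s r ∼ dpt y
      idx s s≢r = all (∂ s r) (∂-≉0 s≢r) (∂-D s≢r)
      y : ∃ λ y → x ∼ dpt y
      y = all x x≉0 Dx
      inj : ∀ {s t} ps pt → proj₁ (idx s ps) ≡ proj₁ (idx t pt) → s ≡ t
      inj {s} {t} ps pt e = see-unique ps pt (prop-trans (proj₂ (idx s ps)) (prop-sym (≡.subst (λ y → ∂ t r ∼ dpt y) (≡.sym e) (proj₂ (idx t pt)))))
      seen : (∃ λ s → Σ (s ≢ r) λ ps → proj₁ (idx s ps) ≡ proj₁ y) → ∃ λ s → s ≢ r × x ∼ ∂ s r
      seen (s , ps , e) = s , ps , prop-trans (proj₂ y) (prop-sym (≡.subst (λ y → ∂ s r ∼ dpt y) e (proj₂ (idx s ps))))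

  some-point : Fin n
  some-point = Fin.fromℕ< (ℕₚ.≤-trans (s≤s z≤n) q<n)

  secant-resp : ∀ {u v u' v'} → Indep2 u v → Indep2 u' v' → OnLine u v u' → OnLine u v v' → Is-secant u v → Is-secant u' v'
  secant-resp ind ind' lu lv = np-transport (λ _ → λ { (l , Dx) → line-⊇ ind' lu lv l , Dx }) (λ _ → λ { (l , Dx) → line-⊆ lu lv l , Dx })

  not-both-secants : ∀ {u v} → NumPoints (LineD u v) 3 → ¬ Is-secant u v
  not-both-secants np3 (f , ok , inj , _) = contradiction (np-≤ np3 f ok inj) (ℕₚ.<⇒≱ 4≤q-1)

  module TwoSecants {d g g' : V} (Dd : D d) (ind : Indep2 d g) (sec : Is-secant d g)
    (ind' : Indep2 d g') (sec' : Is-secant d g') (g'∉ : ¬ OnLine d g g') where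

    d≉0 : NonZeroV d
    d≉0 = indep-u ind

    a₀ : Carrier
    a₀ = proj₁ (hole-beside Dd ind)

    z : V
    z = g +v (a₀ · d)

    ¬Dz : ¬ D z
    ¬Dz = proj₂ (hole-beside Dd ind)

    indz : Indep2 d z
    indz = shear-indep ind a₀

    z-on : OnLine d g z
    z-on = line-+ line-v (line-· a₀ line-u)

    secz : Is-secant d z
    secz = secant-resp ind indz line-u z-on sec

    g'∉z : ¬ OnLine d z g'
    g'∉z l = g'∉ (line-⊆ line-u z-on l)

    comb : Carrier → Carrier → Carrier → V
    comb a b s = ((a · d) +v (b · z)) +v (s · g')

    comb-+ : ∀ {a b s a' b' s'} → (comb a b s +v comb a' b' s') ≈v comb (a + a') (b + b') (s + s')
    comb-+ {a} {b} {s} {a'} {b'} {s'} i = solve 9 (λ a b s a' b' s' d z g → ((a :* d :+ b :* z) :+ s :* g) :+ ((a' :* d :+ b' :* z) :+ s' :* g)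
      := ((a :+ a') :* d :+ (b :+ b') :* z) :+ (s :+ s') :* g) refl a b s a' b' s' (d i) (z i) (g' i)

    comb≈0 : ∀ {a b s} → comb a b s ≈v 0v → (a ≈ 0# × b ≈ 0#) × s ≈ 0#
    comb≈0 {a} {b} {s} e with s ≟ 0#
    ... | yes s≈0 = indz a b (λ i → by₂ 1# (e i) (g' i) s≈0
            (solve 6 (λ a b s d z g → (a :* d :+ b :* z) :+ con false := con true :* (((a :* d :+ b :* z) :+ s :* g) :+ con false) :+ g :*
                (s :+ con false)) refl a b s (d i) (z i) (g' i))) , s≈0
    ... | no s≉0 = contradiction (line-·⁻¹ s≉0 (a , b , λ i → sym (x+y≈0⇒x≈y (e i)))) g'∉z

    r : Fin n
    r = some-point

    -- Three points of Q in the plane r + ⟨d,g'⟩, no two of them on a line through d.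
    record Apart : Set (c ⊔ ℓ) where
      field
        R : Fin 3 → Fin n
        α s : Fin 3 → Carrier
        R-eq : ∀ i → ∂ (R i) r ≈v ((α i · d) +v (s i · g'))
        s-inj : ∀ {i j} → s i ≈ s j → i ≡ j

    abstract
      -- The parallel to d through r₁ carries only one further point of Q, called r₁'. The third
      -- point r₂ is seen from r in a direction of ⟨d,g'⟩ other than d, that of r₁ and that of r₁',
      -- so it is on the parallel to d neither through r nor through r₁. This takes four directions
      -- on the second secant.
      apart : Apart
      apart = build (see r (np≉0 i₁) (np-D i₁))
        where
        f : Fin (size ∸ 1) → V
        f = proj₁ sec'
        np≉0 : ∀ i → NonZeroV (f i)
        np≉0 i = proj₁ (proj₁ (proj₂ sec') i)
        np-D : ∀ i → D (f i)
        np-D i = proj₂ (proj₂ (proj₁ (proj₂ sec') i))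
        np-on : ∀ i → OnLine d g' (f i)
        np-on i = proj₁ (proj₂ (proj₁ (proj₂ sec') i))
        avoid₁ : ∃ λ i → All (λ x → ¬ f i ∼ x) (d ∷ [])
        avoid₁ = np-avoid sec' (d ∷ []) (ℕₚ.≤-trans (s≤s (s≤s z≤n)) 3≤q-1)
        i₁ : Fin (size ∸ 1)
        i₁ = proj₁ avoid₁
        not-d : ∀ {i x a s} → ¬ f i ∼ d → f i ∼ x → x ≈v ((a · d) +v (s · g')) → ¬ s ≈ 0#
        not-d {i} {x} {a} {s} ≁d f∼x e s≈0 = ≁d (prop-trans f∼x (a , a≉0 , x≈))
          where
          x≈ : x ≈v (a · d)
          x≈ i = trans (e i) (trans (+-congˡ (trans (*-congʳ s≈0) (zeroˡ _))) (+-identityʳ _))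
          a≉0 : ¬ a ≈ 0#
          a≉0 a≈0 = prop-nonzero (prop-sym f∼x) (np≉0 i) (vtrans x≈ (0·x≈0 a≈0))
        build : (∃ λ r₁ → r₁ ≢ r × f i₁ ∼ ∂ r₁ r) → Apart
        build (r₁ , r₁≢r , p₁) = build′ (see r₁ d≉0 Dd)
          where
          build′ : (∃ λ r₁' → r₁' ≢ r₁ × d ∼ ∂ r₁' r₁) → Apart
          build′ (r₁' , r₁'≢r₁ , p') = build″ (np-avoid sec' (d ∷ f i₁ ∷ ∂ r₁' r ∷ []) 4≤q-1)
            where
            build″ : (∃ λ i → All (λ x → ¬ f i ∼ x) (d ∷ f i₁ ∷ ∂ r₁' r ∷ [])) → Apart
            build″ (i₂ , ≁d ∷ ≁₁ ∷ ≁' ∷ []) = build‴ (see r (np≉0 i₂) (np-D i₂))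
              where
              build‴ : (∃ λ r₂ → r₂ ≢ r × f i₂ ∼ ∂ r₂ r) → Apart
              build‴ (r₂ , r₂≢r , p₂) = record
                { R = λ { zero → r ; (suc zero) → r₁ ; (suc (suc zero)) → r₂ }
                ; α = λ { zero → 0# ; (suc zero) → a₁ ; (suc (suc zero)) → a₂ }
                ; s = λ { zero → 0# ; (suc zero) → s₁ ; (suc (suc zero)) → s₂ }
                ; R-eq = λ { zero i → solve 3 (λ r d g → r :+ r := con false :* d :+ con false :* g) refl (A r i) (d i) (g' i)
                    ; (suc zero) → e₁ ; (suc (suc zero)) → e₂ }
                ; s-inj = λ { {zero} {zero} _ → ≡.refl ; {zero} {suc zero} e → contradiction (sym e) s₁≉0
                    ; {zero} {suc (suc zero)} e → contradiction (sym e) s₂≉0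
                            ; {suc zero} {zero} e → contradiction e s₁≉0 ; {suc zero} {suc zero} _ → ≡.refl
                                ; {suc zero} {suc (suc zero)} e → contradiction e s₁≉s₂
                            ; {suc (suc zero)} {zero} e → contradiction e s₂≉0 ; {suc (suc zero)} {suc zero} e → contradiction (sym e) s₁≉s₂
                                ; {suc (suc zero)} {suc (suc zero)} _ → ≡.refl }
                }
                where
                c₁ : OnLine d g' (∂ r₁ r)
                c₁ = line-prop (prop-sym p₁) (np-on i₁)
                c₂ : OnLine d g' (∂ r₂ r)
                c₂ = line-prop (prop-sym p₂) (np-on i₂)
                a₁ a₂ s₁ s₂ : Carrier
                a₁ = proj₁ c₁
                a₂ = proj₁ c₂
                s₁ = proj₁ (proj₂ c₁)
                s₂ = proj₁ (proj₂ c₂)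
                e₁ : ∂ r₁ r ≈v ((a₁ · d) +v (s₁ · g'))
                e₁ = proj₂ (proj₂ c₁)
                e₂ : ∂ r₂ r ≈v ((a₂ · d) +v (s₂ · g'))
                e₂ = proj₂ (proj₂ c₂)
                s₁≉0 : ¬ s₁ ≈ 0#
                s₁≉0 = not-d (All.head (proj₂ avoid₁)) p₁ e₁
                s₂≉0 : ¬ s₂ ≈ 0#
                s₂≉0 = not-d ≁d p₂ e₂
                r₂≢r₁ : r₂ ≢ r₁
                r₂≢r₁ ≡.refl = ≁₁ (prop-trans p₂ (prop-sym p₁))
                s₁≉s₂ : ¬ s₁ ≈ s₂
                s₁≉s₂ s₁≈s₂ = ≁' (≡.subst (λ t → f i₂ ∼ ∂ t r) r₂≡r₁' p₂)
                  where
                  diff : ∂ r₂ r₁ ≈v ((a₁ + a₂) · d)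
                  diff i = by₃ 1# (e₁ i) 1# (e₂ i) (g' i) s₁≈s₂ (solve 9 (λ x y r d g a₁ s₁ a₂ s₂ → (y :+ x) :+ (a₁ :+ a₂) :* d :=
                    con true :* ((x :+ r) :+ (a₁ :* d :+ s₁ :* g)) :+ (con true :* ((y :+ r) :+ (a₂ :* d :+ s₂ :* g)) :+ g :* (s₁ :+ s₂)))
                    refl (A r₁ i) (A r₂ i) (A r i) (d i) (g' i) a₁ s₁ a₂ s₂)
                  a≉0 : ¬ a₁ + a₂ ≈ 0#
                  a≉0 e = ∂-≉0 r₂≢r₁ (vtrans diff (0·x≈0 e))
                  r₂≡r₁' : r₂ ≡ r₁'
                  r₂≡r₁' = see-unique r₂≢r₁ r₁'≢r₁ (prop-trans (_ , a≉0 , diff) p')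

    open Apart apart

    f : Fin (size ∸ 1) → V
    f = proj₁ secz

    seen : ∀ i j → ∃ λ t → t ≢ R i × f j ∼ ∂ t (R i)
    seen i j = see (R i) (proj₁ (proj₁ (proj₂ secz) j)) (proj₂ (proj₂ (proj₁ (proj₂ secz) j)))

    q' : ℕ
    q' = suc (size ∸ 1)

    -- The plane R i + ⟨d,z⟩ contains R i and one point of Q in each of the q - 1 directions of the
    -- secant, q points together. Writing q as `suc (size ∸ 1)` lets index zero be R i.
    P : Fin 3 → Fin q' → Fin n
    P i zero = R i
    P i (suc j) = proj₁ (seen i j)

    P-eq : ∀ i j → ∃₂ λ a b → ∂ (P i j) r ≈v comb a b (s i)
    P-eq i j = shifted (on j)
      where
      on : ∀ j → OnLine d z (∂ (P i j) (R i))
      on zero = line-resp (vsym (v+v (A (R i)))) line-0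
      on (suc j) = line-prop (prop-sym (proj₂ (proj₂ (seen i j)))) (proj₁ (proj₂ (proj₁ (proj₂ secz) j)))
      shifted : OnLine d z (∂ (P i j) (R i)) → ∃₂ λ a b → ∂ (P i j) r ≈v comb a b (s i)
      shifted (a , b , e) = a + α i , b , λ t → by₂ 1# (e t) 1# (R-eq i t)
            (solve 10 (λ p R r a α b s d z g → (p :+ r) :+ (((a :+ α) :* d :+ b :* z) :+ s :* g) := con true :*
                ((p :+ R) :+ (a :* d :+ b :* z)) :+ con true :* ((R :+ r) :+ (α :* d :+ s :* g)))
              refl (A (P i j) t) (A (R i) t) (A r t) a (α i) b (s i) (d t) (z t) (g' t))

    P-inj₂ : ∀ i {j j'} → P i j ≡ P i j' → j ≡ j'
    P-inj₂ i {zero} {zero} e = ≡.refl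
    P-inj₂ i {zero} {suc j'} e = contradiction (≡.sym e) (proj₁ (proj₂ (seen i j')))
    P-inj₂ i {suc j} {zero} e = contradiction e (proj₁ (proj₂ (seen i j)))
    P-inj₂ i {suc j} {suc j'} e = ≡.cong suc (proj₁ (proj₂ (proj₂ secz)) j j'
      (prop-trans (proj₂ (proj₂ (seen i j))) (prop-sym (≡.subst (λ t → f j' ∼ ∂ t (R i)) (≡.sym e) (proj₂ (proj₂ (seen i j')))))))

    P-diff : ∀ i j i' j' → ∃₂ λ a b → ∃₂ λ a' b' → ∂ (P i j) r ≈v comb a b (s i) × ∂ (P i' j') r ≈v comb a' b' (s i') ×
      ∂ (P i j) (P i' j') ≈v comb (a + a') (b + b') (s i + s i')
    P-diff i j i' j' = let a , b , e = P-eq i j ; a' , b' , e' = P-eq i' j' in a , b , a' , b' , e , e' , vtrans (∂-trans (P i j) r (P i' j')) (vtrans (vcong+ e (vtrans (∂-comm r (P i' j')) e')) comb-+)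

    P-inj : ∀ i j i' j' → P i j ≡ P i' j' → i ≡ i' × j ≡ j'
    P-inj i j i' j' e = same-s (s-inj (s-eq (P-diff i j i' j')))
      where
      s-eq : (∃₂ λ a b → ∃₂ λ a' b' → ∂ (P i j) r ≈v comb a b (s i) × ∂ (P i' j') r ≈v comb a' b' (s i') ×
        ∂ (P i j) (P i' j') ≈v comb (a + a') (b + b') (s i + s i')) → s i ≈ s i'
      s-eq (_ , _ , _ , _ , _ , _ , d≈) = x+y≈0⇒x≈y (proj₂ (comb≈0 (vtrans (vsym d≈) (≈v⇒+≈0 (λ t → reflexive (≡.cong (λ p → A p t) e))))))
      same-s : i ≡ i' → i ≡ i' × j ≡ j'
      same-s ≡.refl = ≡.refl , P-inj₂ i e

    -- A plane of the parallel class of a functional contains at least three of the 3q points P i j.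
    two-directions : ∀ kx ky ks {u v} → Indep2 u v → (∀ {a b t} → kx * a + (ky * b + ks * t) ≈ 0# → OnLine u v (comb a b t)) →
      NumPoints (LineD u v) 3 ⊎ Is-secant u v
    two-directions kx ky ks {u} {v} indu on = found (three-in-a-fibre 2q<3q val)
      where
      2q<3q : size ℕ.* 2 < 3 ℕ.* q'
      2q<3q = go size 16≤q
        where
        go : ∀ N → 16 ≤ N → N ℕ.* 2 < 3 ℕ.* suc (N ∸ 1)
        go (suc N) _ = ≡.subst (_< 3 ℕ.* suc N) (ℕₚ.*-comm 2 (suc N)) (ℕₚ.*-monoˡ-< (suc N) {2} {3} ℕₚ.≤-refl)
      I : Fin (3 ℕ.* q') → Fin 3 × Fin q'
      I = remQuot {3} q'
      I-inj : ∀ {e e'} → I e ≡ I e' → e ≡ e'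
      I-inj {e} {e'} p = ≡.trans (≡.sym (Finₚ.combine-remQuot {3} q' e))
          (≡.trans (≡.cong (λ (i , j) → combine i j) p) (Finₚ.combine-remQuot {3} q' e'))
      Pt : Fin (3 ℕ.* q') → Fin n
      Pt e = P (proj₁ (I e)) (proj₂ (I e))
      Pt-inj : ∀ {e e'} → Pt e ≡ Pt e' → e ≡ e'
      Pt-inj {e} {e'} p = I-inj (≡.cong₂ _,_ (proj₁ q) (proj₂ q))
        where q = P-inj (proj₁ (I e)) (proj₂ (I e)) (proj₁ (I e')) (proj₂ (I e')) p
      co : ∀ e → ∃₂ λ a b → ∂ (Pt e) r ≈v comb a b (s (proj₁ (I e)))
      co e = P-eq (proj₁ (I e)) (proj₂ (I e))
      value : ∀ e → Carrier
      value e = kx * proj₁ (co e) + (ky * proj₁ (proj₂ (co e)) + ks * s (proj₁ (I e)))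
      val : Fin (3 ℕ.* q') → Fin size
      val e = ι (value e)
      on-line : ∀ e e' → val e ≡ val e' → OnLine u v (∂ (Pt e') (Pt e))
      on-line e e' p = line-resp (vsym (vtrans (∂-trans (Pt e') r (Pt e))
          (vtrans (vcong+ (proj₂ (proj₂ (co e'))) (vtrans (∂-comm r (Pt e)) (proj₂ (proj₂ (co e))))) comb-+)))
        (on (by₁ 1# (ι-inj p) (solve 9 (λ kx ky ks a b t a' b' t' → (kx :* (a' :+ a) :+ (ky :* (b' :+ b) :+ ks :* (t' :+ t))) :+ con false :=
          con true :* ((kx :* a :+ (ky :* b :+ ks :* t)) :+ (kx :* a' :+ (ky :* b' :+ ks :* t'))))
          refl kx ky ks (proj₁ (co e)) (proj₁ (proj₂ (co e))) (s (proj₁ (I e))) (proj₁ (co e')) (proj₁ (proj₂ (co e'))) (s (proj₁ (I e'))))))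
      found : (∃ λ i → ∃₂ λ j l → i ≢ j × i ≢ l × j ≢ l × val i ≡ val j × val i ≡ val l) → NumPoints (LineD u v) 3 ⊎ Is-secant u v
      found (i , j , l , i≢j , i≢l , j≢l , vj , vl) = 2-points⇒ indu (∂-≉0 j≢i) (∂-≉0 l≢i) (on-line i j vj , ∂-D j≢i) (on-line i l vl , ∂-D l≢i)
        (no-three-collinear j≢i l≢i (j≢l ∘ Pt-inj))
        where
        j≢i = i≢j ∘ ≡.sym ∘ Pt-inj
        l≢i = i≢l ∘ ≡.sym ∘ Pt-inj

    col-indep : ∀ t → Indep2 z (g' +v (t · d))
    col-indep t a b e = proj₂ (proj₁ p) , proj₂ p
      where
      p = comb≈0 {b * t} {a} {b} λ i → by₁ 1# (e i)
          (solve 6 (λ a b t d z g → ((b :* t :* d :+ a :* z) :+ b :* g) :+ con false := con true :*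
              ((a :* z :+ b :* (g :+ t :* d)) :+ con false)) refl a b t (d i) (z i) (g' i))

    row-indep : ∀ t → Indep2 d (g' +v (t · z))
    row-indep t a b e = proj₁ (proj₁ p) , proj₂ p
      where
      p = comb≈0 {a} {b * t} {b} λ i → by₁ 1# (e i)
          (solve 6 (λ a b t d z g → ((a :* d :+ b :* t :* z) :+ b :* g) :+ con false := con true :*
              ((a :* d :+ b :* (g :+ t :* z)) :+ con false)) refl a b t (d i) (z i) (g' i))

    col : ∀ t → NumPoints (LineD z (g' +v (t · d))) 3 ⊎ Is-secant z (g' +v (t · d))
    col t = two-directions 1# 0# t (col-indep t) λ {a} {b} {s} e → b , s , λ i → by₁ (d i) e
      (solve 7 (λ a b s t d z g → ((a :* d :+ b :* z) :+ s :* g) :+ (b :* z :+ s :* (g :+ t :* d)) := d :*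
          ((con true :* a :+ (con false :* b :+ t :* s)) :+ con false)) refl a b s t (d i) (z i) (g' i))

    row : ∀ t → NumPoints (LineD d (g' +v (t · z))) 3 ⊎ Is-secant d (g' +v (t · z))
    row t = two-directions 0# 1# t (row-indep t) λ {a} {b} {s} e → a , s , λ i → by₁ (z i) e
      (solve 7 (λ a b s t d z g → ((a :* d :+ b :* z) :+ s :* g) :+ (a :* d :+ s :* (g :+ t :* z)) := z :*
          ((con false :* a :+ (con true :* b :+ t :* s)) :+ con false)) refl a b s t (d i) (z i) (g' i))

    -- Columns hold 3 or q - 1 points of D, as z ∉ D; rows hold 2 or q - 2 besides d.
    E? : ∀ x y → Dec (D (pt (col-indep (enum x)) (suc y)))
    E? x y = pt-D? (col-indep (enum x)) (suc y)

    col-count : ∀ x → count (E? x) ≡ 3 ⊎ count (E? x) ≡ 3 ℕ.+ (size ∸ 4)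
    col-count x = by-size (col (enum x))
      where
      total : ∀ {N} → NumPoints (LineD z (g' +v (enum x · d))) N → count (E? x) ≡ N
      total np = ≡.trans (≡.sym (count-suc-no (pt-D? (col-indep (enum x))) ¬Dz)) (pts-in-D (col-indep (enum x)) np)
      by-size : NumPoints (LineD z (g' +v (enum x · d))) 3 ⊎ Is-secant z (g' +v (enum x · d)) → count (E? x) ≡ 3 ⊎ count (E? x) ≡ 3 ℕ.+ (size ∸ 4)
      by-size (inj₁ np) = inj₁ (total np)
      by-size (inj₂ np) = inj₂ (≡.trans (total np) (go size 16≤q))
        where
        go : ∀ N → 16 ≤ N → N ∸ 1 ≡ 3 ℕ.+ (N ∸ 4)
        go (suc (suc (suc (suc N)))) _ = ≡.refl
        go (suc (suc (suc zero))) (s≤s (s≤s (s≤s ())))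
        go (suc (suc zero)) (s≤s (s≤s ()))
        go (suc zero) (s≤s ())
        go zero ()

    row-count : ∀ y → count (λ x → E? x y) ≡ 2 ⊎ count (λ x → E? x y) ≡ 2 ℕ.+ (size ∸ 4)
    row-count y = by-size (row (enum y))
      where
      ri = row-indep (enum y)
      same : ∀ x → pt ri (suc x) ≈v pt (col-indep (enum x)) (suc y)
      same x i = solve 3 (λ g a b → (g :+ a) :+ b := (g :+ b) :+ a) refl (g' i) (enum y * z i) (enum x * d i)
      total : ∀ {N} → NumPoints (LineD d (g' +v (enum y · z))) N → suc (count (λ x → E? x y)) ≡ N
      total np = ≡.trans (≡.cong suc (count-cong (λ x → E? x y) (λ x → pt-D? ri (suc x))
          (λ x → D-resp (pt-≉0 ri (suc x)) (prop-refl (vsym (same x)))) (λ x → D-resp (pt-≉0 (col-indep (enum x)) (suc y)) (prop-refl (same x)))))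
        (≡.trans (≡.sym (count-suc-yes (pt-D? ri) Dd)) (pts-in-D ri np))
      by-size : NumPoints (LineD d (g' +v (enum y · z))) 3 ⊎ Is-secant d (g' +v (enum y · z)) → count (λ x → E? x y) ≡ 2 ⊎ count
          (λ x → E? x y) ≡ 2 ℕ.+ (size ∸ 4)
      by-size (inj₁ np) = inj₁ (ℕₚ.suc-injective (total np))
      by-size (inj₂ np) = inj₂ (go size 16≤q (total np))
        where
        go : ∀ {k} N → 16 ≤ N → suc k ≡ N ∸ 1 → k ≡ 2 ℕ.+ (N ∸ 4)
        go (suc (suc (suc (suc N)))) _ ≡.refl = ≡.refl
        go (suc (suc (suc zero))) (s≤s (s≤s (s≤s ())))
        go (suc (suc zero)) (s≤s (s≤s ()))
        go (suc zero) (s≤s ())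
        go zero ()

    impossible : ⊥
    impossible =
      let e , eq = sum-two-valued 3 (size ∸ 4) col-count ; e' , eq' = sum-two-valued 2 (size ∸ 4) row-count
      in unbalanced 16≤q e e' (≡.trans (≡.sym eq) (≡.trans (double-count E?) eq'))

-- Q is a coset of an F₂-space

module Additive {c ℓ} {F : FiniteField c ℓ} {m : ℕ} (S : DirectionSet F m) where
  open Directions S
  open Translations S hiding (module TwoSecants)
  open FiniteField F hiding (zero)
  open FieldBasics F
  open Char2 F 1+1≈0
  open Vectors m
  open PointSets F 1+1≈0 m

  share : ∀ {d g g'} → D d → Indep2 d g → Is-secant d g → Indep2 d g' → Is-secant d g' → OnLine d g g'
  share {d} {g} {g'} Dd ind sec ind' sec' = decide (online? g')
    where
    decide : Dec (OnLine d g g') → OnLine d g g'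
    decide (yes on) = on
    decide (no ¬on) = ⊥-elim (Translations.TwoSecants.impossible S Dd ind sec ind' sec' ¬on)

  other-point : ∀ {u v d} → Indep2 u v → NonZeroV d → ∃ λ g → OnLine u v g × Indep2 d g
  other-point {u} {v} {d} ind d≉0 = decide (prop? d u)
    where
    decide : Dec (d ∼ u) → ∃ λ g → OnLine u v g × Indep2 d g
    decide (no d≁u) = u , line-u , indep d≉0 (indep-u ind) d≁u
    decide (yes d∼u) = v , line-v , indep d≉0 (indep-v ind) (λ d∼v → indep-≁ ind (prop-trans (prop-sym d∼u) d∼v))

  same-secant : ∀ {u v u' v' d} → Indep2 u v → Is-secant u v → Indep2 u' v' → Is-secant u' v' →
    NonZeroV d → D d → OnLine u v d → OnLine u' v' d → ∀ {x} → OnLine u v x → OnLine u' v' x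
  same-secant ind sec ind' sec' d≉0 Dd ld ld' lx with other-point ind d≉0 | other-point ind' d≉0
  ... | g , lg , indg | g' , lg' , indg' = line-⊆ ld' lg' (line-⊆ line-u
      (share Dd indg' (secant-resp ind' indg' ld' lg' sec') indg (secant-resp ind indg ld lg sec)) (line-⊇ indg ld lg lx))

  -- Let p be seen from j in the direction of i and l, and p' from l in the direction of i and j.
  -- From i, both are seen in a point of D on the line of d and e other than d and e. There is only
  -- one such point, so p = p', and this is the fourth vertex of the parallelogram on i, j, l.
  off-secant-sum : ∀ {i j l} → i ≢ j → i ≢ l → j ≢ l → ¬ Is-secant (∂ j i) (∂ l i) → ∃ λ p → A p ≈v (A i +v (A j +v A l))
  off-secant-sum {i} {j} {l} i≢j i≢l j≢l ¬sec = build (see j (∂-≉0 l≢i) (∂-D l≢i)) (see l (∂-≉0 j≢i) (∂-D j≢i))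
    where
    j≢i = i≢j ∘ ≡.sym
    l≢i = i≢l ∘ ≡.sym
    d e : V
    d = ∂ j i
    e = ∂ l i
    d≁e : ¬ d ∼ e
    d≁e = no-three-collinear j≢i l≢i j≢l
    ind : Indep2 d e
    ind = indep (∂-≉0 j≢i) (∂-≉0 l≢i) d≁e
    build : (∃ λ p → p ≢ j × e ∼ ∂ p j) → (∃ λ p → p ≢ l × d ∼ ∂ p l) → ∃ λ p → A p ≈v (A i +v (A j +v A l))
    build (p , p≢j , e∼) (p' , p'≢l , d∼) = p , λ t → by₂ 1# (pj t) (e t) μ≈1
        (solve 5 (λ p i j l μ → p :+ (i :+ (j :+ l)) := con true :* ((p :+ j) :+ μ :* (l :+ i)) :+ (l :+ i) :* (μ :+ con true)) refl (A p t)
            (A i t) (A j t) (A l t) μ)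
      where
      μ ν : Carrier
      μ = proj₁ (prop-sym e∼)
      ν = proj₁ (prop-sym d∼)
      μ≉0 : ¬ μ ≈ 0#
      μ≉0 = proj₁ (proj₂ (prop-sym e∼))
      ν≉0 : ¬ ν ≈ 0#
      ν≉0 = proj₁ (proj₂ (prop-sym d∼))
      pj : ∂ p j ≈v (μ · e)
      pj = proj₂ (proj₂ (prop-sym e∼))
      p'l : ∂ p' l ≈v (ν · d)
      p'l = proj₂ (proj₂ (prop-sym d∼))
      f≈ : ∂ p i ≈v ((1# · d) +v (μ · e))
      f≈ t = by₁ 1# (pj t) (solve 4 (λ p i j μe → (p :+ i) :+ (con true :* (j :+ i) :+ μe) := con true :* ((p :+ j) :+ μe)) refl (A p t)
          (A i t) (A j t) (μ * e t))
      f'≈ : ∂ p' i ≈v ((ν · d) +v (1# · e))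
      f'≈ t = by₁ 1# (p'l t) (solve 4 (λ p i l νd → (p :+ i) :+ (νd :+ con true :* (l :+ i)) := con true :* ((p :+ l) :+ νd)) refl (A p' t)
          (A i t) (A l t) (ν * d t))
      d≈ : d ≈v ((1# · d) +v (0# · e))
      d≈ t = solve 2 (λ d e → d := con true :* d :+ con false :* e) refl (d t) (e t)
      e≈ : e ≈v ((0# · d) +v (1# · e))
      e≈ t = solve 2 (λ d e → e := con false :* d :+ con true :* e) refl (d t) (e t)
      coords : ∀ {x y a b a' b'} → x ≈v ((a · d) +v (b · e)) → y ≈v ((a' · d) +v (b' · e)) → x ∼ y → ∃ λ s → ¬ s ≈ 0# × a ≈ s * a' × b ≈ s * b'
      coords {x} {y} {a} {b} {a'} {b'} ex ey (s , s≉0 , p) = s , s≉0 , coords-unique ind {a} {b} {s * a'} {s * b'}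
          (vtrans (vsym ex) (vtrans p λ t → trans (*-congˡ (ey t))
        (solve 5 (λ s a b d e → s :* (a :* d :+ b :* e) := s :* a :* d :+ s :* b :* e) refl s a' b' (d t) (e t))))
      d≁f : ¬ d ∼ ∂ p i
      d≁f q = let s , s≉0 , _ , q₂ = coords d≈ f≈ q in *≉0 s≉0 μ≉0 (sym q₂)
      e≁f : ¬ e ∼ ∂ p i
      e≁f q = let s , s≉0 , q₁ , _ = coords e≈ f≈ q in *≉0 s≉0 1≉0 (sym q₁)
      d≁f' : ¬ d ∼ ∂ p' i
      d≁f' q = let s , s≉0 , _ , q₂ = coords d≈ f'≈ q in *≉0 s≉0 1≉0 (sym q₂)
      e≁f' : ¬ e ∼ ∂ p' i
      e≁f' q = let s , s≉0 , q₁ , _ = coords e≈ f'≈ q in *≉0 s≉0 ν≉0 (sym q₁)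
      p≢i : p ≢ i
      p≢i p≡i = 1≉0 (proj₁ (ind 1# μ (vtrans (vsym f≈) (≈v⇒+≈0 (λ t → reflexive (≡.cong (λ x → A x t) p≡i))))))
      p'≢i : p' ≢ i
      p'≢i p'≡i = 1≉0 (proj₂ (ind ν 1# (vtrans (vsym f'≈) (≈v⇒+≈0 (λ t → reflexive (≡.cong (λ x → A x t) p'≡i))))))
      f∼f' : ∂ p i ∼ ∂ p' i
      f∼f' = decide (prop? (∂ p i) (∂ p' i))
        where
        decide : Dec (∂ p i ∼ ∂ p' i) → ∂ p i ∼ ∂ p' i
        decide (yes q) = q
        decide (no ¬q) = contradiction (4-points⇒ ind
          ((∂-≉0 j≢i , line-u , ∂-D j≢i) ∷ (∂-≉0 l≢i , line-v , ∂-D l≢i) ∷ (∂-≉0 p≢i , (_ , _ , f≈) , ∂-D p≢i) ∷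
              (∂-≉0 p'≢i , (_ , _ , f'≈) , ∂-D p'≢i) ∷ [])
          ((d≁e ∷ d≁f ∷ d≁f' ∷ []) ∷ (e≁f ∷ e≁f' ∷ []) ∷ (¬q ∷ []) ∷ [] ∷ [])) ¬sec
      μ≈1 : μ ≈ 1#
      μ≈1 = proj₂ (coords-unique ind {1#} {μ} {ν} {1#}
          (vtrans (vsym f≈) (vtrans (λ t → reflexive (≡.cong (λ x → A x t + A i t) (see-unique p≢i p'≢i f∼f'))) f'≈)))

  secant? : ∀ {i j l} → i ≢ j → i ≢ l → j ≢ l → Is-secant (∂ j i) (∂ l i) ⊎ ¬ Is-secant (∂ j i) (∂ l i)
  secant? {i} {j} {l} i≢j i≢l j≢l = [ inj₂ ∘ not-both-secants , inj₁ ]′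
      (2-points⇒ (indep (∂-≉0 j≢i) (∂-≉0 l≢i) j≁l) (∂-≉0 j≢i) (∂-≉0 l≢i) (line-u , ∂-D j≢i) (line-v , ∂-D l≢i) j≁l)
    where
    j≢i = i≢j ∘ ≡.sym
    l≢i = i≢l ∘ ≡.sym
    j≁l = no-three-collinear j≢i l≢i j≢l

  -- On a secant, the sum is reached in two steps through a point s outside the plane of i, j, l.
  on-secant-sum : ∀ {i j l} → i ≢ j → i ≢ l → j ≢ l → Is-secant (∂ j i) (∂ l i) → ∃ λ p → A p ≈v (A i +v (A j +v A l))
  on-secant-sum {i} {j} {l} i≢j i≢l j≢l sec = via (off-plane (∂-D j≢i) ind i)
    where
    j≢i = i≢j ∘ ≡.sym
    l≢i = i≢l ∘ ≡.sym
    d e : V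
    d = ∂ j i
    e = ∂ l i
    ind : Indep2 d e
    ind = indep (∂-≉0 j≢i) (∂-≉0 l≢i) (no-three-collinear j≢i l≢i j≢l)
    via : (∃ λ s → ¬ OnLine d e (∂ s i)) → ∃ λ p → A p ≈v (A i +v (A j +v A l))
    via (s , s∉) = step (off-secant-sum i≢j i≢s j≢s ¬sec₁)
      where
      i≢s : i ≢ s
      i≢s ≡.refl = s∉ (line-resp (vsym (v+v (A i))) line-0)
      j≢s : j ≢ s
      j≢s ≡.refl = s∉ line-u
      l≢s : l ≢ s
      l≢s ≡.refl = s∉ line-v
      ind₁ : Indep2 d (∂ s i)
      ind₁ = indep (∂-≉0 j≢i) (∂-≉0 (i≢s ∘ ≡.sym)) (no-three-collinear j≢i (i≢s ∘ ≡.sym) j≢s)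
      -- d already lies on the secant of i, j, l, and two secants share no direction. The same
      -- reason excludes the second plane, because `p₁` is A i + A j + A s and therefore ∂ p₁ s is
      -- again d.
      ¬sec₁ : ¬ Is-secant d (∂ s i)
      ¬sec₁ sec₁ = s∉ (share (∂-D j≢i) ind sec ind₁ sec₁)
      step : (∃ λ p → A p ≈v (A i +v (A j +v A s))) → ∃ λ p → A p ≈v (A i +v (A j +v A l))
      step (p₁ , e₁) = finish (off-secant-sum s≢p₁ (l≢s ∘ ≡.sym) p₁≢l ¬sec₂)
        where
        p₁s : ∂ p₁ s ≈v d
        p₁s t = by₁ 1# (e₁ t) (solve 4 (λ p i j s → (p :+ s) :+ (j :+ i) := con true :* (p :+ (i :+ (j :+ s)))) refl (A p₁ t) (A i t) (A j t) (A s t))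
        s≢p₁ : s ≢ p₁
        s≢p₁ s≡p₁ = ∂-≉0 j≢i (vtrans (vsym p₁s) (≈v⇒+≈0 (λ t → reflexive (≡.cong (λ x → A x t) (≡.sym s≡p₁)))))
        ls : (∂ l s +v e) ≈v ∂ s i
        ls t = solve 3 (λ i l s → (l :+ s) :+ (l :+ i) := s :+ i) refl (A i t) (A l t) (A s t)
        p₁≢l : p₁ ≢ l
        p₁≢l p₁≡l = s∉ (line-resp ls (line-+ (line-resp (vtrans (vsym p₁s) (λ t → reflexive (≡.cong (λ x → A x t + A s t) p₁≡l))) line-u) line-v))
        d≁ls : ¬ d ∼ ∂ l s
        d≁ls q = s∉ (line-resp ls (line-+ (line-prop (prop-sym q) line-u) line-v))
        ind₂ : Indep2 d (∂ l s)
        ind₂ = indep (∂-≉0 j≢i) (∂-≉0 l≢s) d≁ls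
        ind₂' : Indep2 (∂ p₁ s) (∂ l s)
        ind₂' = indep (nonzero-resp (vsym p₁s) (∂-≉0 j≢i)) (∂-≉0 l≢s) (d≁ls ∘ prop-respˡ p₁s)
        ¬sec₂ : ¬ Is-secant (∂ p₁ s) (∂ l s)
        ¬sec₂ sec₂ = s∉ (line-resp ls (line-+ (share (∂-D j≢i) ind sec ind₂ (secant-resp ind₂' ind₂ (line-resp p₁s line-u) line-v sec₂)) line-v))
        finish : (∃ λ p → A p ≈v (A s +v (A p₁ +v A l))) → ∃ λ p → A p ≈v (A i +v (A j +v A l))
        finish (p , e₂) = p , λ t → by₂ 1# (e₂ t) 1# (e₁ t)
            (solve 6 (λ p p₁ i j l s → p :+ (i :+ (j :+ l)) := con true :* (p :+ (s :+ (p₁ :+ l))) :+ con true :* (p₁ :+ (i :+ (j :+ s))))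
          refl (A p t) (A p₁ t) (A i t) (A j t) (A l t) (A s t))

  abstract
    sum₃ : ∀ i j l → ∃ λ p → A p ≈v (A i +v (A j +v A l))
    sum₃ i j l = decide (i Finₚ.≟ j) (i Finₚ.≟ l) (j Finₚ.≟ l)
      where
      cancel : ∀ x y → x ≈ y + (y + x)
      cancel = solve 2 (λ x y → x := y :+ (y :+ x)) refl
      decide : Dec (i ≡ j) → Dec (i ≡ l) → Dec (j ≡ l) → ∃ λ p → A p ≈v (A i +v (A j +v A l))
      decide (yes ≡.refl) _ _ = l , λ t → cancel (A l t) (A i t)
      decide _ (yes ≡.refl) _ = j , λ t → trans (cancel (A j t) (A i t)) (+-congˡ (+-comm _ _))
      decide _ _ (yes ≡.refl) = i , λ t → solve 2 (λ x y → x := x :+ (y :+ y)) refl (A i t) (A j t)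
      decide (no i≢j) (no i≢l) (no j≢l) = [ on-secant-sum i≢j i≢l j≢l , off-secant-sum i≢j i≢l j≢l ]′ (secant? i≢j i≢l j≢l)

  o : Fin n
  o = some-point

  u : Fin n → V
  u i = ∂ i o

  u-o : u o ≈v 0v
  u-o = v+v (A o)

  u-inj : ∀ {i j} → u i ≈v u j → i ≡ j
  u-inj {i} {j} e = A-inj λ t → by₁ 1# (e t) (solve 3 (λ i j o → i :+ j := con true :* ((i :+ o) :+ (j :+ o))) refl (A i t) (A j t) (A o t))

  u-≉0 : ∀ {i} → i ≢ o → NonZeroV (u i)
  u-≉0 = ∂-≉0

  u-≢o : ∀ {i} → NonZeroV (u i) → i ≢ o
  u-≢o u≉0 ≡.refl = u≉0 u-o

  u-D : ∀ {i} → NonZeroV (u i) → D (u i)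
  u-D u≉0 = ∂-D (u-≢o u≉0)

  abstract
    u-+ : ∀ i j → ∃ λ l → u l ≈v (u i +v u j)
    u-+ i j = let l , e = sum₃ i j o in l , λ t → by₁ 1# (e t)
      (solve 4 (λ l i j o → (l :+ o) :+ ((i :+ o) :+ (j :+ o)) := con true :* (l :+ (i :+ (j :+ o)))) refl (A l t) (A i t) (A j t) (A o t))

  D⇒u : ∀ {x} → NonZeroV x → D x → ∃ λ i → NonZeroV (u i) × x ∼ u i
  D⇒u x≉0 Dx = let i , i≢o , p = see o x≉0 Dx in i , u-≉0 i≢o , p

  scattered : ∀ {i j} → NonZeroV (u i) → NonZeroV (u j) → u i ∼ u j → i ≡ j
  scattered ui uj p = see-unique (u-≢o ui) (u-≢o uj) p

-- Scattered sets in small spaces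

module Scattered {c ℓ} {F : FiniteField c ℓ} {m : ℕ} (S : DirectionSet F m) where
  open Directions S
  open Translations S using (not-both-secants)
  open Additive S using (u; o; u-o; u-inj; u-+; u-D; D⇒u; scattered)
  open FiniteField F hiding (zero)
  open FieldBasics F
  open Char2 F 1+1≈0
  open Vectors m
  open PointSets F 1+1≈0 m

  InU : V → Set ℓ
  InU x = ∃ λ i → x ≈v u i

  abstract
    inU? : ∀ x → Dec (InU x)
    inU? x = Finₚ.any? (λ i → x ≟v u i)

  U-resp : ∀ {x y} → x ≈v y → InU x → InU y
  U-resp e (i , p) = i , vtrans (vsym e) p

  U-0 : InU 0v
  U-0 = o , vsym u-o

  U-+ : ∀ {x y} → InU x → InU y → InU (x +v y)
  U-+ (i , p) (j , q) = let l , e = u-+ i j in l , vtrans (vcong+ p q) (vsym e)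

  U-D : ∀ {x} → NonZeroV x → InU x → D x
  U-D x≉0 (i , p) = D-resp x≉0 (prop-refl (vsym p)) (u-D (nonzero-resp p x≉0))

  D⇒U : ∀ {x} → NonZeroV x → D x → ∃ λ y → InU y × NonZeroV y × x ∼ y
  D⇒U x≉0 Dx = let i , ui≉0 , p = D⇒u x≉0 Dx in u i , (i , vrefl) , ui≉0 , p

  U-scattered : ∀ {x y} → InU x → InU y → NonZeroV x → NonZeroV y → x ∼ y → x ≈v y
  U-scattered (i , p) (j , q) x≉0 y≉0 x∼y = vtrans p (vtrans (λ t → reflexive (≡.cong (λ l → u l t)
    (scattered (nonzero-resp p x≉0) (nonzero-resp q y≉0) (prop-respˡ p (prop-respʳ q x∼y))))) (vsym q))

  U-multiple : ∀ {x y a} → InU x → InU y → NonZeroV y → x ≈v (a · y) → x ≈v 0v ⊎ x ≈v y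
  U-multiple {x} {y} {a} Ux Uy y≉0 e = decide (a ≟ 0#)
    where
    decide : Dec (a ≈ 0#) → x ≈v 0v ⊎ x ≈v y
    decide (yes a≈0) = inj₁ (vtrans e (0·x≈0 a≈0))
    decide (no a≉0) = inj₂ (U-scattered Ux Uy (nonzero-resp (vsym e) (·≉0 a≉0 y≉0)) y≉0 (a , a≉0 , e))

  U-index : ∀ {x} → InU x → Fin n
  U-index = proj₁

  U-index-cong : ∀ {x y} (Ux : InU x) (Uy : InU y) → x ≈v y → U-index Ux ≡ U-index Uy
  U-index-cong (i , p) (j , q) e = u-inj (vtrans (vsym p) (vtrans e q))

  U-index-inj : ∀ {x y} (Ux : InU x) (Uy : InU y) → U-index Ux ≡ U-index Uy → x ≈v y
  U-index-inj (i , p) (.i , q) ≡.refl = vtrans p (vsym q)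

  abstract
    scalar-avoiding : (xs : List Carrier) → length xs < size → ∃ λ x → All (λ y → ¬ x ≈ y) xs
    scalar-avoiding xs <q = let i , ≢ = missed <q (ι ∘ List.lookup xs) in enum i , avoids xs λ j e → ≢ j (≡.trans (ι-cong (sym e)) (ι-enum i))
      where
      avoids : ∀ {x} ys → (∀ j → ¬ x ≈ List.lookup ys j) → All (λ y → ¬ x ≈ y) ys
      avoids [] _ = []
      avoids (y ∷ ys) ≉ = ≉ zero ∷ avoids ys (≉ ∘ suc)

    ζ-exists : ∃ λ x → All (λ y → ¬ x ≈ y) (0# ∷ 1# ∷ [])
    ζ-exists = scalar-avoiding _ (ℕₚ.≤-trans (s≤s (s≤s (s≤s z≤n))) 16≤q)

  ζ : Carrier
  ζ = proj₁ ζ-exists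

  ζ≉0 : ¬ ζ ≈ 0#
  ζ≉0 = All.head (proj₂ ζ-exists)

  1+ζ≉0 : ¬ 1# + ζ ≈ 0#
  1+ζ≉0 e = All.head (All.tail (proj₂ ζ-exists)) (sym (x+y≈0⇒x≈y e))

  -- A parametrisation of a subspace by r scalars. Injectivity is not asked for, as the bounds only
  -- use that equal parameters give equal vectors; both spans of listed vectors and the coordinates
  -- of H∞ fit.
  record LinearMap (r : ℕ) : Set (c ⊔ ℓ) where
    field
      L : (Fin r → Carrier) → V
      L-cong : ∀ {x y} → (∀ t → x t ≈ y t) → L x ≈v L y
      L-+ : ∀ x y → L (λ t → x t + y t) ≈v (L x +v L y)
      L-· : ∀ a x → L (λ t → a * x t) ≈v (a · L x)

  span : ∀ {r} → (Fin r → V) → LinearMap r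
  span b = record { L = λ x → sumV (λ t → x t · b t) ; L-cong = cong b ; L-+ = add b ; L-· = scale b }
    where
    cong : ∀ {r} (b : Fin r → V) {x y : Fin r → Carrier} → (∀ t → x t ≈ y t) → sumV (λ t → x t · b t) ≈v sumV (λ t → y t · b t)
    cong {zero} b e i = refl
    cong {suc r} b e = vcong+ (vcong· (e zero) vrefl) (cong (b ∘ suc) (e ∘ suc))
    add : ∀ {r} (b : Fin r → V) (x y : Fin r → Carrier) → sumV (λ t → (x t + y t) · b t) ≈v (sumV (λ t → x t · b t) +v sumV (λ t → y t · b t))
    add {zero} b x y i = sym (+-identityʳ 0#)
    add {suc r} b x y i = trans (+-congˡ (add (b ∘ suc) (x ∘ suc) (y ∘ suc) i))
      (solve 5 (λ x y b s t → (x :+ y) :* b :+ (s :+ t) := (x :* b :+ s) :+ (y :* b :+ t)) refl (x zero) (y zero) (b zero i) _ _)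
    scale : ∀ {r} (b : Fin r → V) a (x : Fin r → Carrier) → sumV (λ t → (a * x t) · b t) ≈v (a · sumV (λ t → x t · b t))
    scale {zero} b a x i = sym (zeroʳ a)
    scale {suc r} b a x i = trans (+-congˡ (scale (b ∘ suc) a (x ∘ suc) i))
      (solve 4 (λ a x b s → a :* x :* b :+ a :* s := a :* (x :* b :+ s)) refl a (x zero) (b zero i) _)

  code : ∀ {r} → (Fin r → Carrier) → Fin (size ℕ.^ r)
  code x = Fin.funToFin (ι ∘ x)

  code-inj : ∀ {r} {x y : Fin r → Carrier} → code x ≡ code y → ∀ t → x t ≈ y t
  code-inj {x = x} {y} e t = ι-inj (≡.trans (≡.sym (Finₚ.finToFun-funToFin (ι ∘ x) t))
      (≡.trans (≡.cong (λ z → Fin.finToFun z t) e) (Finₚ.finToFun-funToFin (ι ∘ y) t)))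

  -- The vectors x + ζ y with x, y in a scattered set are pairwise distinct.
  module Bound {r} (Λ : LinearMap r) {N} (φ : Fin N → V) (φ-U : ∀ i → InU (φ i)) (φ-inj : ∀ {i j} → φ i ≈v φ j → i ≡ j)
    (x : Fin N → Fin r → Carrier) (φ≈ : ∀ i → φ i ≈v LinearMap.L Λ (x i)) where
    open LinearMap Λ

    -- Equal values give X = ζ Y with X and Y in U. If Y is nonzero, scatteredness leaves X = 0 or X
    -- = Y, that is ζ = 0 or ζ = 1.
    ζ-inj : ∀ {i j i' j'} → (φ i +v (ζ · φ j)) ≈v (φ i' +v (ζ · φ j')) → i ≡ i' × j ≡ j'
    ζ-inj {i} {j} {i'} {j'} e = decide (Y ≟v 0v)
      where
      X Y : V
      X = φ i +v φ i'
      Y = φ j +v φ j'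
      X≈ζY : X ≈v (ζ · Y)
      X≈ζY t = by₁ 1# (e t) (solve 5 (λ a b a' b' z → (a :+ a') :+ z :* (b :+ b') := con true :* ((a :+ z :* b) :+ (a' :+ z :* b'))) refl
          (φ i t) (φ j t) (φ i' t) (φ j' t) ζ)
      decide : Dec (Y ≈v 0v) → i ≡ i' × j ≡ j'
      decide (yes Y≈0) = φ-inj (x+y≈0⇒x≈vy (vtrans X≈ζY (λ t → trans (*-congˡ (Y≈0 t)) (zeroʳ ζ)))) , φ-inj (x+y≈0⇒x≈vy Y≈0)
      decide (no Y≉0) = contradiction (U-multiple (U-+ (φ-U i) (φ-U i')) (U-+ (φ-U j) (φ-U j')) Y≉0 X≈ζY)
        [ (λ X≈0 → Y≉0 (a·x≈0⇒x≈0 ζ≉0 (vtrans (vsym X≈ζY) X≈0)))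
        , (λ X≈Y → Y≉0 (a·x≈0⇒x≈0 1+ζ≉0 λ t → by₂ 1# (X≈ζY t) 1# (X≈Y t)
            (solve 3 (λ X Y z → (con true :+ z) :* Y :+ con false := con true :* (X :+ z :* Y) :+ con true :* (X :+ Y)) refl (X t) (Y t) ζ))) ]′

    bound : N ℕ.* N ≤ size ℕ.^ r
    bound = Finₚ.injective⇒≤ {f = λ e → code (point e)} λ {e} {e'} p → I-inj (ζ-inj (vtrans (at e) (vtrans (L-cong (code-inj p)) (vsym (at e')))))
      where
      point : Fin (N ℕ.* N) → Fin r → Carrier
      point e t = x (proj₁ (remQuot {N} N e)) t + ζ * x (proj₂ (remQuot {N} N e)) t
      at : ∀ e → (φ (proj₁ (remQuot {N} N e)) +v (ζ · φ (proj₂ (remQuot {N} N e)))) ≈v L (point e)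
      at e = vtrans (vcong+ (φ≈ _) (vtrans (vcong· refl (φ≈ _)) (vsym (L-· ζ _)))) (vsym (L-+ _ _))
      I-inj : ∀ {e e'} → proj₁ (remQuot {N} N e) ≡ proj₁ (remQuot {N} N e') × proj₂ (remQuot {N} N e) ≡ proj₂ (remQuot {N} N e') → e ≡ e'
      I-inj {e} {e'} (p , q) = ≡.trans (≡.sym (Finₚ.combine-remQuot {N} N e)) (≡.trans (≡.cong₂ combine p q) (Finₚ.combine-remQuot {N} N e'))

    -- If no line through f and a vector of the family is a secant, the vectors x + ζ y + s f are distinct
    -- up to adding f to x and to y; the two bits record which of x, x + f comes first in the enumeration of U.
    module Through {f : V} (f-U : InU f) (f≉0 : NonZeroV f) (xf : Fin r → Carrier) (f≈ : f ≈v L xf)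
      (φ-+ : ∀ i j → ∃ λ l → φ l ≈v (φ i +v φ j))
      (thin : ∀ l → NonZeroV (φ l) → ¬ φ l ≈v f → ∀ {y} → InU y → OnLine f (φ l) y → y ≈v 0v ⊎ y ≈v f ⊎ y ≈v φ l ⊎ y ≈v (f +v φ l)) where

      -- If Y is neither 0 nor f, then X = s f + ζ Y lies on the thin line of f and Y, so X is 0, f,
      -- Y or f + Y. In each case a nonzero multiple of Y is a multiple of f, against scatteredness.
      0-or-f : ∀ {X Y} → InU X → (∃ λ l → φ l ≈v Y) → ∀ {s} → (X +v (ζ · Y)) ≈v (s · f) → (X ≈v 0v ⊎ X ≈v f) × (Y ≈v 0v ⊎ Y ≈v f)
      0-or-f {X} {Y} UX (l , φl≈Y) {s} e = decide (Y ≟v 0v) (Y ≟v f)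
        where
        UY : InU Y
        UY = U-resp φl≈Y (φ-U l)
        no-multiple : NonZeroV Y → ¬ Y ≈v f → ∀ {a b} → ¬ a ≈ 0# → ¬ (a · Y) ≈v (b · f)
        no-multiple Y≉0 Y≉f {a} {b} a≉0 p = [ Y≉0 , Y≉f ]′
            (U-multiple {a = inv a a≉0 * b} UY f-U f≉0 λ t → trans (inv-· a≉0 (vsym p) t) (sym (*-assoc _ _ _)))
        decide : Dec (Y ≈v 0v) → Dec (Y ≈v f) → (X ≈v 0v ⊎ X ≈v f) × (Y ≈v 0v ⊎ Y ≈v f)
        decide (yes Y≈0) _ = U-multiple UX f-U f≉0
            (λ t → by₂ 1# (e t) ζ (Y≈0 t) (solve 4 (λ X Y z sf → X :+ sf := con true :* ((X :+ z :* Y) :+ sf) :+ z :* (Y :+ con false)) refl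
                (X t) (Y t) ζ (s * f t))) , inj₁ Y≈0
        decide (no _) (yes Y≈f) = U-multiple {a = s + ζ} UX f-U f≉0
            (λ t → by₂ 1# (e t) ζ (Y≈f t) (solve 5 (λ X Y z s f → X :+ (s :+ z) :* f := con true :* ((X :+ z :* Y) :+ s :* f) :+ z :*
                (Y :+ f)) refl (X t) (Y t) ζ s (f t))) , inj₂ Y≈f
        decide (no Y≉0) (no Y≉f) = ⊥-elim (cases
            (thin l (nonzero-resp (vsym φl≈Y) Y≉0) (λ p → Y≉f (vtrans (vsym φl≈Y) p)) UX (s , ζ , λ t → by₂ 1# (e t) ζ (φl≈Y t)
            (solve 5 (λ X Y W z sf → X :+ (sf :+ z :* W) := con true :* ((X :+ z :* Y) :+ sf) :+ z :* (W :+ Y)) refl (X t) (Y t) (φ l t) ζ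
                (s * f t)))))
          where
          cases : ¬ (X ≈v 0v ⊎ X ≈v f ⊎ X ≈v φ l ⊎ X ≈v (f +v φ l))
          cases (inj₁ p) = no-multiple Y≉0 Y≉f {b = s} ζ≉0 λ t → by₂ 1# (e t) 1# (p t)
              (solve 4 (λ X Y z sf → z :* Y :+ sf := con true :* ((X :+ z :* Y) :+ sf) :+ con true :* (X :+ con false)) refl (X t) (Y t) ζ (s * f t))
          cases (inj₂ (inj₁ p)) = no-multiple Y≉0 Y≉f {b = 1# + s} ζ≉0 λ t → by₂ 1# (e t) 1# (p t)
              (solve 5 (λ X Y z s f → z :* Y :+ (con true :+ s) :* f := con true :* ((X :+ z :* Y) :+ s :* f) :+ con true :* (X :+ f)) refl
                  (X t) (Y t) ζ s (f t))
          cases (inj₂ (inj₂ (inj₁ p))) = no-multiple Y≉0 Y≉f {b = s} 1+ζ≉0 λ t → by₃ 1# (e t) 1# (p t) 1# (φl≈Y t)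
            (solve 5 (λ X Y W z sf → (con true :+ z) :* Y :+ sf := con true :* ((X :+ z :* Y) :+ sf) :+
                (con true :* (X :+ W) :+ con true :* (W :+ Y))) refl (X t) (Y t) (φ l t) ζ (s * f t))
          cases (inj₂ (inj₂ (inj₂ p))) = no-multiple Y≉0 Y≉f {b = 1# + s} 1+ζ≉0 λ t → by₃ 1# (e t) 1# (p t) 1# (φl≈Y t)
            (solve 6 (λ X Y W z s f → (con true :+ z) :* Y :+ (con true :+ s) :* f := con true :* ((X :+ z :* Y) :+ s :* f) :+
                (con true :* (X :+ (f :+ W)) :+ con true :* (W :+ Y))) refl (X t) (Y t) (φ l t) ζ s (f t))

      first? : ∀ i → Dec (U-index (φ-U i) Fin.< U-index (U-+ (φ-U i) f-U))
      first? i = U-index (φ-U i) Finₚ.<? U-index (U-+ (φ-U i) f-U)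

      bit-separates : ∀ {i j} → (φ i +v φ j) ≈v 0v ⊎ (φ i +v φ j) ≈v f → bit (first? i) ≡ bit (first? j) → i ≡ j
      bit-separates (inj₁ e) _ = φ-inj (x+y≈0⇒x≈vy e)
      bit-separates {i} {j} (inj₂ e) b = ⊥-elim (separate (first? i) (first? j) b)
        where
        j≡i+f : U-index (φ-U j) ≡ U-index (U-+ (φ-U i) f-U)
        j≡i+f = U-index-cong (φ-U j) (U-+ (φ-U i) f-U) λ t → by₁ 1# (e t)
            (solve 3 (λ a b f → b :+ (a :+ f) := con true :* ((a :+ b) :+ f)) refl (φ i t) (φ j t) (f t))
        i≡j+f : U-index (φ-U i) ≡ U-index (U-+ (φ-U j) f-U)
        i≡j+f = U-index-cong (φ-U i) (U-+ (φ-U j) f-U) λ t → by₁ 1# (e t)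
            (solve 3 (λ a b f → a :+ (b :+ f) := con true :* ((a :+ b) :+ f)) refl (φ i t) (φ j t) (f t))
        i≢j : U-index (φ-U i) ≢ U-index (φ-U j)
        i≢j p = f≉0 (vtrans (vsym e) (≈v⇒+≈0 (U-index-inj (φ-U i) (φ-U j) p)))
        flip : ¬ U-index (φ-U i) Fin.< U-index (U-+ (φ-U i) f-U) → U-index (φ-U j) Fin.< U-index (U-+ (φ-U j) f-U)
        flip ¬lt = ≡.subst₂ Fin._<_ (≡.refl {x = U-index (φ-U j)}) i≡j+f
            (Finₚ.≤∧≢⇒< (ℕₚ.≮⇒≥ (λ lt → ¬lt (≡.subst (U-index (φ-U i) Fin.<_) j≡i+f lt))) (i≢j ∘ ≡.sym))
        separate : (di : Dec (U-index (φ-U i) Fin.< U-index (U-+ (φ-U i) f-U)))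
            (dj : Dec (U-index (φ-U j) Fin.< U-index (U-+ (φ-U j) f-U))) → bit di ≢ bit dj
        separate (yes lt) (yes lt') _ = Finₚ.<-asym (≡.subst (U-index (φ-U i) Fin.<_) (≡.sym j≡i+f) lt)
            (≡.subst (U-index (φ-U j) Fin.<_) (≡.sym i≡j+f) lt')
        separate (no ¬lt) (no ¬lt') _ = ¬lt' (flip ¬lt)
        separate (yes _) (no _) ()
        separate (no _) (yes _) ()

      -- Each of the two bits costs a factor 2. For a family with N² = q^r this would give q ≤ 4.
      bound-through : N ℕ.* N ℕ.* size ≤ size ℕ.^ r ℕ.* 2 ℕ.* 2
      bound-through = Finₚ.injective⇒≤ {f = g} inj
        where
        Dom = Fin (N ℕ.* N ℕ.* size)
        ij : Dom → Fin (N ℕ.* N)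
        ij e = proj₁ (remQuot {N ℕ.* N} size e)
        s : Dom → Carrier
        s e = enum (proj₂ (remQuot {N ℕ.* N} size e))
        i j : Dom → Fin N
        i e = proj₁ (remQuot {N} N (ij e))
        j e = proj₂ (remQuot {N} N (ij e))
        point : Dom → Fin r → Carrier
        point e t = (x (i e) t + ζ * x (j e) t) + s e * xf t
        g : Dom → Fin (size ℕ.^ r ℕ.* 2 ℕ.* 2)
        g e = combine (combine (code (point e)) (bit (first? (i e)))) (bit (first? (j e)))
        at : ∀ e → ((φ (i e) +v (ζ · φ (j e))) +v (s e · f)) ≈v L (point e)
        at e = vtrans (vcong+ (vtrans (vcong+ (φ≈ _) (vtrans (vcong· refl (φ≈ _)) (vsym (L-· ζ _)))) (vsym (L-+ _ _)))
            (vtrans (vcong· refl f≈) (vsym (L-· _ _)))) (vsym (L-+ _ _))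
        dom-inj : ∀ {e e'} → i e ≡ i e' → j e ≡ j e' → s e ≈ s e' → e ≡ e'
        dom-inj {e} {e'} p q w = ≡.trans (≡.sym (Finₚ.combine-remQuot {N ℕ.* N} size e)) (≡.trans (≡.cong₂ combine
          (≡.trans (≡.sym (Finₚ.combine-remQuot {N} N (ij e))) (≡.trans (≡.cong₂ combine p q) (Finₚ.combine-remQuot {N} N (ij e'))))
              (enum-inj _ _ w)) (Finₚ.combine-remQuot {N ℕ.* N} size e'))
        inj : ∀ {e e'} → g e ≡ g e' → e ≡ e'
        inj {e} {e'} p = dom-inj i≡ j≡ s≈
          where
          p₁ = Finₚ.combine-injective (combine (code (point e)) (bit (first? (i e)))) (bit (first? (j e)))
              (combine (code (point e')) (bit (first? (i e')))) (bit (first? (j e'))) p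
          p₂ = Finₚ.combine-injective (code (point e)) (bit (first? (i e))) (code (point e')) (bit (first? (i e'))) (proj₁ p₁)
          eq : ((φ (i e) +v (ζ · φ (j e))) +v (s e · f)) ≈v ((φ (i e') +v (ζ · φ (j e'))) +v (s e' · f))
          eq = vtrans (at e) (vtrans (L-cong (code-inj (proj₁ p₂))) (vsym (at e')))
          XY = 0-or-f {φ (i e) +v φ (i e')} {φ (j e) +v φ (j e')} (U-+ (φ-U _) (φ-U _)) (φ-+ _ _) {s e + s e'} λ t → by₁ 1# (eq t)
            (solve 8 (λ a b a' b' z s s' f → ((a :+ a') :+ z :* (b :+ b')) :+ (s :+ s') :* f := con true :*
                (((a :+ z :* b) :+ s :* f) :+ ((a' :+ z :* b') :+ s' :* f)))
              refl (φ (i e) t) (φ (j e) t) (φ (i e') t) (φ (j e') t) ζ (s e) (s e') (f t))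
          i≡ : i e ≡ i e'
          i≡ = bit-separates (proj₁ XY) (proj₂ p₂)
          j≡ : j e ≡ j e'
          j≡ = bit-separates (proj₂ XY) (proj₂ p₁)
          s≈ : s e ≈ s e'
          s≈ = ·-cancel f≉0 λ t → by₃ 1# (eq t) 1# (reflexive (≡.cong (λ l → φ l t) i≡)) ζ (reflexive (≡.cong (λ l → φ l t) j≡))
            (solve 7 (λ a b a' b' z sf sf' → sf :+ sf' := con true :* (((a :+ z :* b) :+ sf) :+ ((a' :+ z :* b') :+ sf')) :+
                (con true :* (a :+ a') :+ z :* (b :+ b')))
              refl (φ (i e) t) (φ (j e) t) (φ (i e') t) (φ (j e') t) ζ (s e * f t) (s e' * f t))

  U-indep : ∀ {x y} → InU x → InU y → NonZeroV x → NonZeroV y → ¬ x ≈v y → Indep2 x y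
  U-indep Ux Uy x≉0 y≉0 x≉y = indep x≉0 y≉0 (λ p → x≉y (U-scattered Ux Uy x≉0 y≉0 p))

  Thin : V → V → Set (c ⊔ ℓ)
  Thin x y = ∀ {w} → InU w → OnLine x y w → w ≈v 0v ⊎ w ≈v x ⊎ w ≈v y ⊎ w ≈v (x +v y)

  -- A vector of U on the line besides 0, x, y and x + y is a fourth point of D there.
  secant-or-thin : ∀ {x y} → InU x → InU y → NonZeroV x → NonZeroV y → ¬ x ≈v y → Is-secant x y ⊎ Thin x y
  secant-or-thin {x} {y} Ux Uy x≉0 y≉0 x≉y = decide (2-points⇒ ind x≉0 y≉0 (line-u , U-D x≉0 Ux) (line-v , U-D y≉0 Uy) (indep-≁ ind))
    where
    ind : Indep2 x y
    ind = U-indep Ux Uy x≉0 y≉0 x≉y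
    xy≉0 : NonZeroV (x +v y)
    xy≉0 e = x≉y (x+y≈0⇒x≈vy e)
    decide : NumPoints (LineD x y) 3 ⊎ Is-secant x y → Is-secant x y ⊎ Thin x y
    decide (inj₂ sec) = inj₁ sec
    decide (inj₁ np) = inj₂ λ {w} Uw lw → which Uw lw (w ≟v 0v) (w ≟v x) (w ≟v y) (w ≟v (x +v y))
      where
      which : ∀ {w} → InU w → OnLine x y w → Dec (w ≈v 0v) → Dec (w ≈v x) → Dec (w ≈v y) → Dec
          (w ≈v (x +v y)) → w ≈v 0v ⊎ w ≈v x ⊎ w ≈v y ⊎ w ≈v (x +v y)
      which _ _ (yes p) _ _ _ = inj₁ p
      which _ _ _ (yes p) _ _ = inj₂ (inj₁ p)
      which _ _ _ _ (yes p) _ = inj₂ (inj₂ (inj₁ p))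
      which _ _ _ _ _ (yes p) = inj₂ (inj₂ (inj₂ p))
      which {w} Uw lw (no w≉0) (no w≉x) (no w≉y) (no w≉xy) = contradiction (4-points⇒ ind
        ((w≉0 , lw , U-D w≉0 Uw) ∷ (x≉0 , line-u , U-D x≉0 Ux) ∷ (y≉0 , line-v , U-D y≉0 Uy) ∷ (xy≉0 , line-+ line-u line-v , U-D xy≉0 Uxy) ∷ [])
        (((λ p → w≉x (U-scattered Uw Ux w≉0 x≉0 p)) ∷ (λ p → w≉y (U-scattered Uw Uy w≉0 y≉0 p)) ∷ (λ p → w≉xy (U-scattered Uw Uxy w≉0 xy≉0 p)) ∷ [])
        ∷ ((λ p → x≉y (U-scattered Ux Uy x≉0 y≉0 p)) ∷
            (λ p → y≉0 (λ t → by₁ 1# (U-scattered Ux Uxy x≉0 xy≉0 p t)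
                (solve 2 (λ x y → y :+ con false := con true :* (x :+ (x :+ y))) refl (x t) (y t)))) ∷ [])
        ∷ ((λ p → x≉0 (λ t → by₁ 1# (U-scattered Uy Uxy y≉0 xy≉0 p t)
            (solve 2 (λ x y → x :+ con false := con true :* (y :+ (x :+ y))) refl (x t) (y t)))) ∷ []) ∷ [] ∷ [])) (not-both-secants np)
        where
        Uxy : InU (x +v y)
        Uxy = U-+ Ux Uy

  secant-through : ∀ {r} (Λ : LinearMap r) {N} (φ : Fin N → V) (φ-U : ∀ i → InU (φ i)) (φ-inj : ∀ {i j} → φ i ≈v φ j → i ≡ j)
    (x : Fin N → Fin r → Carrier) (φ≈ : ∀ i → φ i ≈v LinearMap.L Λ (x i)) (φ-+ : ∀ i j → ∃ λ l → φ l ≈v (φ i +v φ j))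
    {f : V} → InU f → NonZeroV f → (xf : Fin r → Carrier) → f ≈v LinearMap.L Λ xf →
    size ℕ.^ r ℕ.* 2 ℕ.* 2 < N ℕ.* N ℕ.* size → ∃ λ l → NonZeroV (φ l) × (¬ φ l ≈v f) × Is-secant f (φ l)
  secant-through {r} Λ {N} φ φ-U φ-inj x φ≈ φ-+ {f} f-U f≉0 xf f≈ big = decide (search each)
    where
    Good : Fin N → Set (c ⊔ ℓ)
    Good l = NonZeroV (φ l) × (¬ φ l ≈v f) × Is-secant f (φ l)
    Bad : Fin N → Set (c ⊔ ℓ)
    Bad l = NonZeroV (φ l) → ¬ φ l ≈v f → Thin f (φ l)
    each : ∀ l → Good l ⊎ Bad l
    each l = go (φ l ≟v 0v) (φ l ≟v f)
      where
      go : Dec (φ l ≈v 0v) → Dec (φ l ≈v f) → Good l ⊎ Bad l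
      go (yes p) _ = inj₂ (λ ≉0 → contradiction p ≉0)
      go (no _) (yes p) = inj₂ (λ _ ≉f → contradiction p ≉f)
      go (no ≉0) (no ≉f) = [ (λ sec → inj₁ (≉0 , ≉f , sec)) , (λ thin → inj₂ (λ _ _ {w} → thin {w})) ]′
          (secant-or-thin f-U (φ-U l) f≉0 ≉0 (λ p → ≉f (vsym p)))
    decide : ∃ Good ⊎ (∀ l → Bad l) → ∃ Good
    decide (inj₁ found) = found
    decide (inj₂ bad) = contradiction (Bound.Through.bound-through Λ φ φ-U φ-inj x φ≈ f-U f≉0 xf f≈ φ-+ (λ l ≉0 ≉f {y} → bad l ≉0 ≉f {y}))
        (ℕₚ.<⇒≱ big)

-- Secants and their two points outside D

module Frames {c ℓ} {F : FiniteField c ℓ} {m : ℕ} (S : DirectionSet F m) where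
  open Directions S
  open Translations S using (secant-resp)
  open Additive S using (u; o; u-inj; u-+; same-secant)
  open Scattered S
  open FiniteField F hiding (zero)
  open FieldBasics F
  open Char2 F 1+1≈0
  open Vectors m
  open PointSets F 1+1≈0 m

  4<q : 4 < size
  4<q = ℕₚ.≤-trans (ℕₚ.m≤m+n 5 11) 16≤q

  1<q : 1 < size
  1<q = ℕₚ.≤-trans (ℕₚ.m≤m+n 2 14) 16≤q

  0<q^ : ∀ r → 0 < size ℕ.^ r
  0<q^ r = ℕₚ.m^n>0 size ⦃ ℕ.>-nonZero (ℕₚ.≤-trans (s≤s z≤n) 16≤q) ⦄ r

  H∞ : LinearMap m
  H∞ = record
    { L = λ { x zero → 0# ; x (suc t) → x t }
    ; L-cong = λ { e zero → refl ; e (suc t) → e t }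
    ; L-+ = λ { x y zero → sym (+-identityʳ 0#) ; x y (suc t) → refl }
    ; L-· = λ { a x zero → sym (zeroʳ a) ; a x (suc t) → refl }
    }

  u-∞ : ∀ i → InH∞ (u i)
  u-∞ i = trans (+-cong (A-affine i) (A-affine o)) 1+1≈0

  U-∞ : ∀ {x} → InU x → InH∞ x
  U-∞ (i , e) = trans (e zero) (u-∞ i)

  abstract
    -- H∞ has dimension m as a vector space and the whole of U has n² = q^m, so `bound-through`
    -- would fail if every line through f were thin.
    secant-at : ∀ {f} → InU f → NonZeroV f → ∃ λ g → InU g × NonZeroV g × (¬ g ≈v f) × Is-secant f g
    secant-at {f} f-U f≉0 = let l , ≉0 , ≉f , sec = found in u l , (l , vrefl) , ≉0 , ≉f , sec
      where
      in-H∞ : ∀ {x} → InU x → x ≈v LinearMap.L H∞ (x ∘ suc)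
      in-H∞ Ux zero = U-∞ Ux
      in-H∞ Ux (suc t) = refl
      found : ∃ λ l → NonZeroV (u l) × (¬ u l ≈v f) × Is-secant f (u l)
      found = secant-through H∞ u (λ i → i , vrefl) u-inj (λ i → u i ∘ suc) (λ i → in-H∞ (i , vrefl)) u-+ f-U f≉0 (f ∘ suc) (in-H∞ f-U)
        (≡.subst (λ N → size ℕ.^ m ℕ.* 2 ℕ.* 2 < N ℕ.* size) (≡.sym n²≡) (n*2*2<n*q (0<q^ m) 4<q))

  -- A secant given by its two points outside D.
  record Frame (a b : V) : Set (c ⊔ ℓ) where
    field
      ind : Indep2 a b
      sec : Is-secant a b
      ¬Da : ¬ D a
      ¬Db : ¬ D b
      full : ∀ {p r} → ¬ p ≈ 0# → ¬ r ≈ 0# → D ((p · a) +v (r · b))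

  combo≉0 : ∀ {a b : V} {p r} → Indep2 a b → ¬ p ≈ 0# → NonZeroV ((p · a) +v (r · b))
  combo≉0 ind p≉0 e = p≉0 (proj₁ (ind _ _ e))

  combo-swap : ∀ {a b : V} {p r} → ((p · a) +v (r · b)) ≈v ((r · b) +v (p · a))
  combo-swap t = +-comm _ _

  combo-cong : ∀ {a b : V} {p p' r r'} → p ≈ p' → r ≈ r' → ((p · a) +v (r · b)) ≈v ((p' · a) +v (r' · b))
  combo-cong e e' t = +-cong (*-congʳ e) (*-congʳ e')

  combo-0ˡ : ∀ {a b : V} {p r} → p ≈ 0# → ((p · a) +v (r · b)) ≈v (r · b)
  combo-0ˡ p≈0 t = trans (+-congʳ (trans (*-congʳ p≈0) (zeroˡ _))) (+-identityˡ _)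

  combo-0ʳ : ∀ {a b : V} {p r} → r ≈ 0# → ((p · a) +v (r · b)) ≈v (p · a)
  combo-0ʳ r≈0 t = trans (+-congˡ (trans (*-congʳ r≈0) (zeroˡ _))) (+-identityʳ _)

  combo-+ : ∀ {a b : V} {p r p' r'} → (((p · a) +v (r · b)) +v ((p' · a) +v (r' · b))) ≈v (((p + p') · a) +v ((r + r') · b))
  combo-+ {a} {b} {p} {r} {p'} {r'} t = solve 6
      (λ p r p' r' a b → (p :* a :+ r :* b) :+ (p' :* a :+ r' :* b) := (p :+ p') :* a :+ (r :+ r') :* b) refl p r p' r' (a t) (b t)

  combo-1-0 : ∀ {a b : V} → a ≈v ((1# · a) +v (0# · b))
  combo-1-0 {a} {b} t = solve 2 (λ a b → a := con true :* a :+ con false :* b) refl (a t) (b t)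

  frame-swap : ∀ {a b} → Frame a b → Frame b a
  frame-swap T = record { ind = indep-swap ind ; sec = secant-resp ind (indep-swap ind) line-v line-u sec ; ¬Da = ¬Db ; ¬Db = ¬Da
    ; full = λ p≉0 r≉0 → D-resp (nonzero-resp combo-swap (combo≉0 ind r≉0)) (prop-refl combo-swap) (full r≉0 p≉0) }
    where open Frame T

  frame-scale : ∀ {a b p r} → ¬ p ≈ 0# → ¬ r ≈ 0# → Frame a b → Frame (p · a) (r · b)
  frame-scale {a} {b} {p} {r} p≉0 r≉0 T = record { ind = ind' ; sec = secant-resp ind ind' (line-· p line-u) (line-· r line-v) sec
    ; ¬Da = ¬Da ∘ D-resp (indep-u ind) (·-prop p≉0) ; ¬Db = ¬Db ∘ D-resp (indep-v ind) (·-prop r≉0)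
    ; full = λ s≉0 t≉0 → D-resp (nonzero-resp reassoc (combo≉0 ind (*≉0 s≉0 p≉0))) (prop-refl reassoc) (full (*≉0 s≉0 p≉0) (*≉0 t≉0 r≉0)) }
    where
    open Frame T
    reassoc : ∀ {s t} → (((s * p) · a) +v ((t * r) · b)) ≈v ((s · (p · a)) +v (t · (r · b)))
    reassoc i = +-cong (*-assoc _ _ _) (*-assoc _ _ _)
    ind' : Indep2 (p · a) (r · b)
    ind' s t e = let e₁ , e₂ = ind (s * p) (t * r) (vtrans reassoc e) in a*x≈0⇒x≈0 p≉0 (trans (*-comm _ _) e₁) , a*x≈0⇒x≈0 r≉0 (trans (*-comm _ _) e₂)

  private
    2-left : ∀ {s k} → 1 < s → s ∸ 1 ℕ.+ k ≡ suc s → k ≡ 2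
    2-left {suc s} {k} _ e = ℕₚ.+-cancelˡ-≡ s k 2 (≡.trans e (ℕₚ.+-comm 2 s))

  abstract
    -- a and b are the two points of the secant outside D. A combination with two nonzero
    -- coefficients is proportional to neither and hence belongs to D.
    frame-on : ∀ {f g} → Indep2 f g → Is-secant f g → ∃₂ λ a b → Frame a b × OnLine f g a × OnLine f g b
    frame-on {f} {g} indf sec = build (two-selected
        (≡.subst (Selection (λ i → ¬ D (pt indf i))) (2-left 1<q (pts-off-D indf sec))
            (select {P = λ i → ¬ D (pt indf i)} (λ i → ¬? (pt-D? indf i)))))
      where
      Off : Fin (suc size) → Set (c ⊔ ℓ)
      Off i = ¬ D (pt indf i)
      build : (∃₂ λ i j → i ≢ j × Off i × Off j × (∀ l → Off l → l ≡ i ⊎ l ≡ j)) → ∃₂ λ a b → Frame a b × OnLine f g a × OnLine f g b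
      build (i , j , i≢j , ¬Di , ¬Dj , only) = pt indf i , pt indf j , record { ind = ind'
          ; sec = secant-resp indf ind' (pt-on indf i) (pt-on indf j) sec ; ¬Da = ¬Di ; ¬Db = ¬Dj
              ; full = λ p≉0 r≉0 → full′ p≉0 r≉0 (D? _ (combo≉0 ind' p≉0)) } , pt-on indf i , pt-on indf j
        where
        a b : V
        a = pt indf i
        b = pt indf j
        ind' : Indep2 a b
        ind' = indep (pt-≉0 indf i) (pt-≉0 indf j) (i≢j ∘ pt-inj indf i j)
        full′ : ∀ {p r} → ¬ p ≈ 0# → ¬ r ≈ 0# → Dec (D ((p · a) +v (r · b))) → D ((p · a) +v (r · b))
        full′ _ _ (yes Dx) = Dx
        full′ {p} {r} p≉0 r≉0 (no ¬Dx) = ⊥-elim (hits (pt-all indf _ (combo≉0 ind' p≉0) (line-+ (line-· p (pt-on indf i)) (line-· r (pt-on indf j)))))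
          where
          ∼b : ¬ ((p · a) +v (r · b)) ∼ b
          ∼b (s , _ , e) = p≉0 (proj₁ (coords-unique ind' {p} {r} {0#} {s} (vtrans e (vsym (combo-0ˡ refl)))))
          ∼a : ¬ ((p · a) +v (r · b)) ∼ a
          ∼a (s , _ , e) = r≉0 (proj₂ (coords-unique ind' {p} {r} {s} {0#} (vtrans e (vsym (combo-0ʳ refl)))))
          hits : ¬ (∃ λ l → ((p · a) +v (r · b)) ∼ pt indf l)
          hits (l , q) = [ (λ l≡i → ∼a (≡.subst (λ l → ((p · a) +v (r · b)) ∼ pt indf l) l≡i q)) , (λ l≡j → ∼b
              (≡.subst (λ l → ((p · a) +v (r · b)) ∼ pt indf l) l≡j q)) ]′
            (only l (λ Dl → ¬Dx (D-resp (combo≉0 ind' p≉0) (prop-sym q) Dl)))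

    frame-at : ∀ {f} → InU f → NonZeroV f → ∃₂ λ a b → Frame a b × f ≈v (a +v b)
    frame-at {f} f-U f≉0 = let g , g-U , g≉0 , g≉f , sec = secant-at f-U f≉0 ; indf = U-indep f-U g-U f≉0 g≉0 (λ e → g≉f (vsym e)) in build indf (frame-on indf sec)
      where
      build : ∀ {g} → Indep2 f g → (∃₂ λ a b → Frame a b × OnLine f g a × OnLine f g b) → ∃₂ λ a b → Frame a b × f ≈v (a +v b)
      build indf (a , b , T , la , lb) = scaled (line-⊇ (Frame.ind T) la lb line-u)
        where
        Df : D f
        Df = U-D f≉0 f-U
        scaled : OnLine a b f → ∃₂ λ a b → Frame a b × f ≈v (a +v b)
        scaled (p , r , e) = (p · a) , (r · b) , frame-scale p≉0 r≉0 T , e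
          where
          p≉0 : ¬ p ≈ 0#
          p≉0 p≈0 = Frame.¬Db T (D-resp (indep-v (Frame.ind T)) (r , r≉0 , f≈) Df)
            where
            f≈ : f ≈v (r · b)
            f≈ = vtrans e (combo-0ˡ p≈0)
            r≉0 : ¬ r ≈ 0#
            r≉0 r≈0 = f≉0 (vtrans f≈ (0·x≈0 r≈0))
          r≉0 : ¬ r ≈ 0#
          r≉0 r≈0 = Frame.¬Da T (D-resp (indep-u (Frame.ind T)) (p , p≉0 , vtrans e (combo-0ʳ r≈0)) Df)

  module Coordinates {a b : V} (T : Frame a b) where
    open Frame T

    hole-∼ : ∀ {x} → NonZeroV x → ¬ D x → OnLine a b x → x ∼ a ⊎ x ∼ b
    hole-∼ {x} x≉0 ¬Dx (p , r , e) = decide (p ≟ 0#) (r ≟ 0#)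
      where
      decide : Dec (p ≈ 0#) → Dec (r ≈ 0#) → x ∼ a ⊎ x ∼ b
      decide (yes p≈0) (yes r≈0) = contradiction (vtrans e (vtrans (combo-0ˡ p≈0) (0·x≈0 r≈0))) x≉0
      decide (yes p≈0) (no r≉0) = inj₂ (r , r≉0 , vtrans e (combo-0ˡ p≈0))
      decide (no p≉0) (yes r≈0) = inj₁ (p , p≉0 , vtrans e (combo-0ʳ r≈0))
      decide (no p≉0) (no r≉0) = contradiction (D-resp x≉0 (prop-refl (vsym e)) (full p≉0 r≉0)) ¬Dx

    second-unique : ∀ {p p' r r'} → InU ((p · a) +v (r · b)) → InU ((p' · a) +v (r' · b)) → p ≈ p' → r ≈ r'
    second-unique {p} {p'} {r} {r'} U₁ U₂ p≈p' = decide ((r + r') ≟ 0#)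
      where
      diff : (((p · a) +v (r · b)) +v ((p' · a) +v (r' · b))) ≈v ((r + r') · b)
      diff = vtrans combo-+ (combo-0ˡ (trans (+-congʳ p≈p') (x+x≈0 p')))
      decide : Dec ((r + r') ≈ 0#) → r ≈ r'
      decide (yes e) = x+y≈0⇒x≈y e
      decide (no ≉0) = contradiction (D-resp (indep-v ind) (·-prop ≉0) (U-D (·≉0 ≉0 (indep-v ind)) (U-resp diff (U-+ U₁ U₂)))) ¬Db

    abstract
      -- The q - 1 directions of the secant and 0 provide q vectors of U on it. By `second-unique`
      -- their a-coordinates are distinct, so every scalar occurs: on the secant, U is the graph of
      -- a function `σ`.
      partner : ∀ p → ∃ λ r → InU ((p · a) +v (r · b))
      partner p = let i , e = surj (ι p) in proj₁ (proj₂ (on i)) , U-resp (vtrans (proj₂ (proj₂ (on i))) (combo-cong (ι-inj e) refl)) (y-U i)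
        where
        np-U : ∀ j → ∃ λ y → InU y × NonZeroV y × proj₁ sec j ∼ y
        np-U j = D⇒U (proj₁ (proj₁ (proj₂ sec) j)) (proj₂ (proj₂ (proj₁ (proj₂ sec) j)))
        y : Fin (suc (size ∸ 1)) → V
        y zero = 0v
        y (suc j) = proj₁ (np-U j)
        y-U : ∀ i → InU (y i)
        y-U zero = U-0
        y-U (suc j) = proj₁ (proj₂ (np-U j))
        on : ∀ i → OnLine a b (y i)
        on zero = line-0
        on (suc j) = line-prop (prop-sym (proj₂ (proj₂ (proj₂ (np-U j))))) (proj₁ (proj₂ (proj₁ (proj₂ sec) j)))
        y-inj : ∀ {i j} → y i ≈v y j → i ≡ j
        y-inj {zero} {zero} _ = ≡.refl
        y-inj {zero} {suc j} e = contradiction (vsym e) (proj₁ (proj₂ (proj₂ (np-U j))))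
        y-inj {suc i} {zero} e = contradiction e (proj₁ (proj₂ (proj₂ (np-U i))))
        y-inj {suc i} {suc j} e = ≡.cong suc (proj₁ (proj₂ (proj₂ sec)) i j
            (prop-trans (proj₂ (proj₂ (proj₂ (np-U i)))) (prop-trans (prop-refl e) (prop-sym (proj₂ (proj₂ (proj₂ (np-U j))))))))
        coord-inj : ∀ {i j} → ι (proj₁ (on i)) ≡ ι (proj₁ (on j)) → i ≡ j
        coord-inj {i} {j} e = y-inj (vtrans (proj₂ (proj₂ (on i)))
            (vtrans (combo-cong p≈ (second-unique (U-resp (proj₂ (proj₂ (on i))) (y-U i)) (U-resp (proj₂ (proj₂ (on j))) (y-U j)) p≈))
                (vsym (proj₂ (proj₂ (on j))))))
          where
          p≈ : proj₁ (on i) ≈ proj₁ (on j)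
          p≈ = ι-inj e
        suc-pred : ∀ {s} → 1 < s → suc (s ∸ 1) ≡ s
        suc-pred {suc s} _ = ≡.refl
        surj : ∀ t → ∃ λ i → ι (proj₁ (on i)) ≡ t
        surj = inj⇒surj-≡ (suc-pred 1<q) coord-inj

    σ : Carrier → Carrier
    σ p = proj₁ (partner p)

    σ-U : ∀ p → InU ((p · a) +v (σ p · b))
    σ-U p = proj₂ (partner p)

    σ-unique : ∀ {p r} → InU ((p · a) +v (r · b)) → r ≈ σ p
    σ-unique Ux = second-unique Ux (σ-U _) refl

    σ-cong : ∀ {p p'} → p ≈ p' → σ p ≈ σ p'
    σ-cong e = second-unique (σ-U _) (σ-U _) e

    point : Fin size → V
    point i = (enum i · a) +v (σ (enum i) · b)

    point-U : ∀ i → InU (point i)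
    point-U i = σ-U (enum i)

    point-inj : ∀ {i j} → point i ≈v point j → i ≡ j
    point-inj e = enum-inj _ _ (proj₁ (coords-unique ind e))

    point-on : ∀ i → OnLine a b (point i)
    point-on i = _ , _ , vrefl

    point-all : ∀ {x} → InU x → OnLine a b x → ∃ λ i → point i ≈v x
    point-all Ux (p , r , e) = ι p , vtrans (combo-cong (sym (ι-≈ p)) (sym (trans (σ-unique (U-resp e Ux)) (σ-cong (ι-≈ p))))) (vsym e)

    -- The line carries exactly q vectors of U, so any q distinct ones are all of them. In this form
    -- a map that carries U into U on a line also carries it onto.
    exhaust : ∀ {v v'} → OnLine a b v → OnLine a b v' → Indep2 v v' → (P R : Fin size → Carrier) → (∀ i → InU ((P i · v) +v (R i · v'))) →
      (∀ {i j} → P i ≈ P j → R i ≈ R j → i ≡ j) → ∀ {p r} → InU ((p · v) +v (r · v')) → ∃ λ i → P i ≈ p × R i ≈ r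
    exhaust {v} {v'} lv lv' ind' P R PR-U PR-inj {p} {r} Ux = finish (inj⇒surj which-inj (proj₁ (point-all Ux on)))
      where
      on : ∀ {p r} → OnLine a b ((p · v) +v (r · v'))
      on = line-+ (line-· _ lv) (line-· _ lv')
      which : ∀ i → ∃ λ j → point j ≈v ((P i · v) +v (R i · v'))
      which i = point-all (PR-U i) on
      same : ∀ {x y} (wx : ∃ λ j → point j ≈v x) (wy : ∃ λ j → point j ≈v y) → proj₁ wx ≡ proj₁ wy → x ≈v y
      same (_ , e) (_ , e') ≡.refl = vtrans (vsym e) e'
      which-inj : ∀ {i j} → proj₁ (which i) ≡ proj₁ (which j) → i ≡ j
      which-inj {i} {j} e = let p≈ , r≈ = coords-unique ind' (same (which i) (which j) e) in PR-inj p≈ r≈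
      finish : (∃ λ i → proj₁ (which i) ≡ proj₁ (point-all Ux on)) → ∃ λ i → P i ≈ p × R i ≈ r
      finish (i , e) = i , coords-unique ind' (same (which i) (point-all Ux on) e)

  Apart : V → V → V → V → Set (c ⊔ ℓ)
  Apart a b a' b' = ∀ {x} → NonZeroV x → D x → OnLine a b x → ¬ OnLine a' b' x

  module Sums {a b a' b'} (T : Frame a b) (T' : Frame a' b') (apart : Apart a b a' b') where
    private
      module C = Coordinates T
      module C' = Coordinates T'

    N : ℕ
    N = size ℕ.* size

    I J : Fin N → Fin size
    I e = proj₁ (remQuot {size} size e)
    J e = proj₂ (remQuot {size} size e)

    IJ-inj : ∀ {e e'} → I e ≡ I e' → J e ≡ J e' → e ≡ e'
    IJ-inj {e} {e'} p q = ≡.trans (≡.sym (Finₚ.combine-remQuot {size} size e)) (≡.trans (≡.cong₂ combine p q) (Finₚ.combine-remQuot {size} size e'))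

    φ : Fin N → V
    φ e = C.point (I e) +v C'.point (J e)

    φ-U : ∀ e → InU (φ e)
    φ-U e = U-+ (C.point-U (I e)) (C'.point-U (J e))

    U-direct : ∀ {x y x' y'} → InU x → InU x' → InU y → InU y' → OnLine a b x → OnLine a b x' → OnLine a' b' y → OnLine a' b' y' →
      (x +v y) ≈v (x' +v y') → x ≈v x' × y ≈v y'
    U-direct {x} {y} {x'} {y'} Ux Ux' Uy Uy' lx lx' ly ly' e = decide ((x +v x') ≟v 0v)
      where
      xx'≈yy' : (x +v x') ≈v (y +v y')
      xx'≈yy' t = by₁ 1# (e t) (solve 4 (λ x y x' y' → (x :+ x') :+ (y :+ y') := con true :* ((x :+ y) :+ (x' :+ y'))) refl (x t) (y t) (x' t) (y' t))
      decide : Dec ((x +v x') ≈v 0v) → x ≈v x' × y ≈v y'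
      decide (yes p) = x+y≈0⇒x≈vy p , x+y≈0⇒x≈vy (vtrans (vsym xx'≈yy') p)
      decide (no ≉0) = contradiction (line-resp (vsym xx'≈yy') (line-+ ly ly')) (apart ≉0 (U-D ≉0 (U-+ Ux Ux')) (line-+ lx lx'))

    φ-inj : ∀ {e e'} → φ e ≈v φ e' → e ≡ e'
    φ-inj {e} {e'} p = let p₁ , p₂ = U-direct (C.point-U (I e)) (C.point-U (I e')) (C'.point-U (J e)) (C'.point-U (J e')) (C.point-on (I e)) (C.point-on (I e')) (C'.point-on (J e)) (C'.point-on (J e')) p
      in IJ-inj (C.point-inj p₁) (C'.point-inj p₂)

    φ-all : ∀ {x y} → InU x → InU y → OnLine a b x → OnLine a' b' y → ∃ λ e → φ e ≈v (x +v y)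
    φ-all Ux Uy lx ly = let i , p = C.point-all Ux lx ; j , q = C'.point-all Uy ly in combine i j ,
      vtrans (λ t → reflexive (≡.cong (λ ij → (C.point (proj₁ ij) +v C'.point (proj₂ ij)) t) (Finₚ.remQuot-combine i j))) (vcong+ p q)

    φ-+ : ∀ e e' → ∃ λ l → φ l ≈v (φ e +v φ e')
    φ-+ e e' = let l , p = φ-all (U-+ (C.point-U (I e)) (C.point-U (I e'))) (U-+ (C'.point-U (J e)) (C'.point-U (J e'))) (line-+ (C.point-on (I e)) (C.point-on (I e'))) (line-+ (C'.point-on (J e)) (C'.point-on (J e')))
      in l , vtrans p (λ t → solve 4 (λ a b c d → (a :+ b) :+ (c :+ d) := (a :+ c) :+ (b :+ d)) refl (C.point (I e) t) (C.point (I e') t)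
          (C'.point (J e) t) (C'.point (J e') t))

    -- With a common hole the q² sums of vectors of U from the two secants would lie in the
    -- three-dimensional span of a', b and b', although (q²)² > q³.
    no-shared-hole : ¬ a ∼ a'
    no-shared-hole (s , _ , a≈) = contradiction (Bound.bound (span vs) φ φ-U φ-inj x φ≈) (ℕₚ.<⇒≱ q³<)
      where
      vs : Fin 3 → V
      vs zero = a'
      vs (suc zero) = b
      vs (suc (suc zero)) = b'
      x : Fin N → Fin 3 → Carrier
      x e zero = enum (I e) * s + enum (J e)
      x e (suc zero) = C.σ (enum (I e))
      x e (suc (suc zero)) = C'.σ (enum (J e))
      φ≈ : ∀ e → φ e ≈v LinearMap.L (span vs) (x e)
      φ≈ e t = by₁ (enum (I e)) (a≈ t) (solve 9
          (λ p r p' r' s a b a' b' → ((p :* a :+ r :* b) :+ (p' :* a' :+ r' :* b')) :+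
              ((p :* s :+ p') :* a' :+ (r :* b :+ (r' :* b' :+ con false))) := p :* (a :+ s :* a'))
        refl (enum (I e)) (C.σ (enum (I e))) (enum (J e)) (C'.σ (enum (J e))) s (a t) (b t) (a' t) (b' t))
      q³< : size ℕ.^ 3 < N ℕ.* N
      q³< = ≡.subst (size ℕ.^ 3 <_) (q⁴≡ size) (ℕₚ.^-monoʳ-< size 1<q {3} {4} ℕₚ.≤-refl)

  disjoint-frames : ∀ {a b a' b'} → Frame a b → Frame a' b' → Apart a b a' b' → ∀ {x} → NonZeroV x → OnLine a b x → ¬ OnLine a' b' x
  disjoint-frames {a} {b} {a'} {b'} T T' apart {x} x≉0 lx lx' = decide (D? x x≉0)
    where
    decide : ¬ Dec (D x)
    decide (yes Dx) = apart x≉0 Dx lx lx'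
    decide (no ¬Dx) = cases (Coordinates.hole-∼ T x≉0 ¬Dx lx) (Coordinates.hole-∼ T' x≉0 ¬Dx lx')
      where
      cases : x ∼ a ⊎ x ∼ b → ¬ (x ∼ a' ⊎ x ∼ b')
      cases (inj₁ p) (inj₁ q) = Sums.no-shared-hole T T' apart (prop-trans (prop-sym p) q)
      cases (inj₁ p) (inj₂ q) = Sums.no-shared-hole T (frame-swap T') (λ ≉0 Dx l l' → apart ≉0 Dx l (line-swap l')) (prop-trans (prop-sym p) q)
      cases (inj₂ p) (inj₁ q) = Sums.no-shared-hole (frame-swap T) T' (λ ≉0 Dx l l' → apart ≉0 Dx (line-swap l) l') (prop-trans (prop-sym p) q)
      cases (inj₂ p) (inj₂ q) = Sums.no-shared-hole (frame-swap T) (frame-swap T') (λ ≉0 Dx l l' → apart ≉0 Dx (line-swap l) (line-swap l'))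
          (prop-trans (prop-sym p) q)

  frames-apart : ∀ {a b a' b' w} → Frame a b → Frame a' b' → OnLine a' b' w → ¬ OnLine a b w → Apart a b a' b'
  frames-apart T T' lw' ¬lw x≉0 Dx lx lx' = ¬lw (same-secant (Frame.ind T') (Frame.sec T') (Frame.ind T) (Frame.sec T) x≉0 Dx lx' lx lw')

-- Secants as graphs of linear maps

module Graphs {c ℓ} {F : FiniteField c ℓ} {m : ℕ} (S : DirectionSet F m) where
  open Directions S
  open Additive S using (same-secant)
  open Scattered S
  open Frames S
  open FiniteField F hiding (zero)
  open FieldBasics F
  open Char2 F 1+1≈0
  open Vectors m
  open PointSets F 1+1≈0 m

  -- The secant ⟨f,y⟩, where f = v + w and y = v' + w', as the graph of v ↦ w, v' ↦ w' between the lines ⟨a,b⟩ and ⟨a',b'⟩.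
  record Graph (a b a' b' v w : V) : Set (c ⊔ ℓ) where
    field
      v' w' : V
      on₁ : OnLine a b v'
      on₂ : OnLine a' b' w'
      ind₁ : Indep2 v v'
      ind₂ : Indep2 w w'
      fwd : ∀ {p r} → InU ((p · v) +v (r · v')) → InU ((p · w) +v (r · w'))
      bwd : ∀ {p r} → InU ((p · w) +v (r · w')) → InU ((p · v) +v (r · v'))
      indΛ : Indep2 (v +v w) (v' +v w')
      secΛ : Is-secant (v +v w) (v' +v w')

  -- The same map on the basis a, b.
  record Iso (a b a' b' v w : V) : Set (c ⊔ ℓ) where
    field
      ga gb y : V
      onₐ : OnLine a' b' ga
      on_b : OnLine a' b' gb
      ind : Indep2 ga gb
      fwd : ∀ {s t} → InU ((s · a) +v (t · b)) → InU ((s · ga) +v (t · gb))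
      bwd : ∀ {s t} → InU ((s · ga) +v (t · gb)) → InU ((s · a) +v (t · b))
      at : ∀ {s t} → v ≈v ((s · a) +v (t · b)) → w ≈v ((s · ga) +v (t · gb))
      indΛ : Indep2 (v +v w) y
      secΛ : Is-secant (v +v w) y
      onΛ : ∀ s t → OnLine (v +v w) y (((s · a) +v (t · b)) +v ((s · ga) +v (t · gb)))
      only : ∀ {x} → OnLine a b x → OnLine (v +v w) y (x +v w) → x ≈v v

  module Pair {a b a' b' : V} (T : Frame a b) (T' : Frame a' b') (apart : Apart a b a' b') where
    open Sums T T' apart

    disjoint : ∀ {x} → NonZeroV x → OnLine a b x → ¬ OnLine a' b' x
    disjoint = disjoint-frames T T' apart

    direct : ∀ {x y x' y'} → OnLine a b x → OnLine a b x' → OnLine a' b' y → OnLine a' b' y' → (x +v y) ≈v (x' +v y') → x ≈v x' × y ≈v y'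
    direct {x} {y} {x'} {y'} lx lx' ly ly' e = decide ((x +v x') ≟v 0v)
      where
      xx'≈yy' : (x +v x') ≈v (y +v y')
      xx'≈yy' t = by₁ 1# (e t) (solve 4 (λ x y x' y' → (x :+ x') :+ (y :+ y') := con true :* ((x :+ y) :+ (x' :+ y'))) refl (x t) (y t) (x' t) (y' t))
      decide : Dec ((x +v x') ≈v 0v) → x ≈v x' × y ≈v y'
      decide (yes p) = x+y≈0⇒x≈vy p , x+y≈0⇒x≈vy (vtrans (vsym xx'≈yy') p)
      decide (no ≉0) = contradiction (line-resp (vsym xx'≈yy') (line-+ ly ly')) (disjoint ≉0 (line-+ lx lx'))

    vs : Fin 4 → V
    vs zero = a
    vs (suc zero) = b
    vs (suc (suc zero)) = a'
    vs (suc (suc (suc zero))) = b'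

    cs : Carrier → Carrier → Carrier → Carrier → Fin 4 → Carrier
    cs p r p' r' zero = p
    cs p r p' r' (suc zero) = r
    cs p r p' r' (suc (suc zero)) = p'
    cs p r p' r' (suc (suc (suc zero))) = r'

    cs≈ : ∀ p r p' r' → (((p · a) +v (r · b)) +v ((p' · a') +v (r' · b'))) ≈v LinearMap.L (span vs) (cs p r p' r')
    cs≈ p r p' r' t = solve 4 (λ w x y z → (w :+ x) :+ (y :+ z) := w :+ (x :+ (y :+ (z :+ con false)))) refl (p * a t) (r * b t) (p' * a' t)
        (r' * b' t)

    φ-coords : Fin N → Fin 4 → Carrier
    φ-coords e = cs (enum (I e)) (Coordinates.σ T (enum (I e))) (enum (J e)) (Coordinates.σ T' (enum (J e)))

    φ≈ : ∀ e → φ e ≈v LinearMap.L (span vs) (φ-coords e)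
    φ≈ e = cs≈ _ _ _ _

    -- Otherwise x would extend the q² sums to 2q² vectors of U in a 4-dimensional space.
    split-U : ∀ {x y y'} → InU x → OnLine a b y → OnLine a' b' y' → x ≈v (y +v y') → InU y
    split-U {x} {y} {y'} Ux ly@(p , r , ey) ly'@(p' , r' , ey') e = decide (inU? y)
      where
      module _ (¬Uy : ¬ InU y) where
        B C : Fin (2 ℕ.* N) → _
        B i = proj₁ (remQuot {2} N i)
        C i = proj₂ (remQuot {2} N i)
        β : Fin 2 → Carrier
        β zero = 0#
        β (suc _) = 1#
        ψ : Fin (2 ℕ.* N) → V
        ψ i = (β (B i) · x) +v φ (C i)
        βx-U : ∀ i → InU (β i · x)
        βx-U zero = U-resp (vsym (0·x≈0 refl)) U-0
        βx-U (suc _) = U-resp (λ t → sym (*-identityˡ _)) Ux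
        ψ-U : ∀ i → InU (ψ i)
        ψ-U i = U-+ (βx-U (B i)) (φ-U (C i))
        not-sum : ∀ e e' → ¬ x ≈v (φ e +v φ e')
        not-sum i j q = ¬Uy (U-resp (vsym (proj₁
            (direct ly (line-+ (Coordinates.point-on T (I i)) (Coordinates.point-on T (I j))) ly'
                (line-+ (Coordinates.point-on T' (J i)) (Coordinates.point-on T' (J j)))
          (vtrans (vsym e) (vtrans q λ t → solve 4 (λ a b c d → (a :+ b) :+ (c :+ d) := (a :+ c) :+ (b :+ d)) refl
              (Coordinates.point T (I i) t) (Coordinates.point T' (J i) t) (Coordinates.point T (I j) t) (Coordinates.point T' (J j) t))))))
                  (U-+ (Coordinates.point-U T (I i)) (Coordinates.point-U T (I j))))
        ψ-inj₂ : ∀ i i' {j j'} → ((β i · x) +v φ j) ≈v ((β i' · x) +v φ j') → i ≡ i' × j ≡ j'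
        ψ-inj₂ zero zero q = ≡.refl , φ-inj λ t → by₁ 1# (q t)
            (solve 3 (λ x y z → y :+ z := con true :* ((con false :* x :+ y) :+ (con false :* x :+ z))) refl (x t) (φ _ t) (φ _ t))
        ψ-inj₂ (suc zero) (suc zero) q = ≡.refl , φ-inj λ t → by₁ 1# (q t)
            (solve 3 (λ x y z → y :+ z := con true :* ((con true :* x :+ y) :+ (con true :* x :+ z))) refl (x t) (φ _ t) (φ _ t))
        ψ-inj₂ zero (suc zero) {j} {j'} q = contradiction
            (λ t → by₁ 1# (q t) (solve 3 (λ x y z → x :+ (y :+ z) := con true :* ((con false :* x :+ y) :+ (con true :* x :+ z))) refl (x t)
                (φ j t) (φ j' t))) (not-sum j j')
        ψ-inj₂ (suc zero) zero {j} {j'} q = contradiction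
            (λ t → by₁ 1# (q t) (solve 3 (λ x y z → x :+ (y :+ z) := con true :* ((con true :* x :+ y) :+ (con false :* x :+ z))) refl (x t)
                (φ j t) (φ j' t))) (not-sum j j')
        ψ-inj : ∀ {i i'} → ψ i ≈v ψ i' → i ≡ i'
        ψ-inj {i} {i'} q = let q₁ , q₂ = ψ-inj₂ (B i) (B i') q in
          ≡.trans (≡.sym (Finₚ.combine-remQuot {2} N i)) (≡.trans (≡.cong₂ combine q₁ q₂) (Finₚ.combine-remQuot {2} N i'))
        coords : Fin (2 ℕ.* N) → Fin 4 → Carrier
        coords i t = β (B i) * cs p r p' r' t + φ-coords (C i) t
        ψ≈ : ∀ i → ψ i ≈v LinearMap.L (span vs) (coords i)
        ψ≈ i = vtrans (vcong+ (vtrans (vcong· refl (vtrans e (vtrans (vcong+ ey ey') (cs≈ p r p' r'))))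
            (vsym (LinearMap.L-· (span vs) (β (B i)) (cs p r p' r')))) (φ≈ (C i)))
          (vsym (LinearMap.L-+ (span vs) (λ t → β (B i) * cs p r p' r' t) (φ-coords (C i))))
        too-many : ⊥
        too-many = contradiction (Bound.bound (span vs) ψ ψ-U ψ-inj coords ψ≈)
            (ℕₚ.<⇒≱ (≡.subst (_< (2 ℕ.* N) ℕ.* (2 ℕ.* N)) (≡.sym (q⁴≡ size)) (ℕₚ.*-mono-< N<2N N<2N)))
          where
          N<2N : N < 2 ℕ.* N
          N<2N = ≡.subst (N <_) (≡.cong (N ℕ.+_) (≡.sym (ℕₚ.+-identityʳ N)))
              (ℕₚ.m<m+n N (ℕₚ.*-mono-≤ {1} {size} {1} {size} (ℕₚ.<⇒≤ 1<q) (ℕₚ.<⇒≤ 1<q)))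
      decide : Dec (InU y) → InU y
      decide (yes Uy) = Uy
      decide (no ¬Uy) = ⊥-elim (too-many ¬Uy)

    split-U₂ : ∀ {x y y'} → InU x → OnLine a b y → OnLine a' b' y' → x ≈v (y +v y') → InU y × InU y'
    split-U₂ {x} {y} {y'} Ux ly ly' e = Uy , U-resp
        (λ t → by₁ 1# (e t) (solve 3 (λ x y y' → (x :+ y) :+ y' := con true :* (x :+ (y :+ y'))) refl (x t) (y t) (y' t))) (U-+ Ux Uy)
      where
      Uy : InU y
      Uy = split-U Ux ly ly' e

    abstract
      -- The solid of the two secants has dimension 4 and contains q² sums; as (q²)² = q⁴, a secant
      -- through f = v + w exists whose second vector is one of these sums. By `split-U₂` its q
      -- vectors of U decompose into vectors of U on the two lines, and by `exhaust` these are all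
      -- such vectors on either line, which gives both `fwd` and `bwd`.
      graph : ∀ {v w} → InU v → NonZeroV v → OnLine a b v → InU w → NonZeroV w → OnLine a' b' w → Graph a b a' b' v w
      graph {v} {w} Uv v≉0 lv Uw w≉0 lw = build
          (secant-through (span vs) φ φ-U φ-inj φ-coords φ≈ φ-+ Uf f≉0 (cs (proj₁ lv) (proj₁ (proj₂ lv)) (proj₁ lw) (proj₁ (proj₂ lw)))
          (vtrans (vcong+ (proj₂ (proj₂ lv)) (proj₂ (proj₂ lw))) (cs≈ _ _ _ _))
              (≡.subst (λ M → size ℕ.^ 4 ℕ.* 2 ℕ.* 2 < M ℕ.* size) (q⁴≡ size) (n*2*2<n*q (0<q^ 4) 4<q)))
        where
        f : V
        f = v +v w
        Uf : InU f
        Uf = U-+ Uv Uw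
        f≉0 : NonZeroV f
        f≉0 e = disjoint v≉0 lv (line-resp (vsym (x+y≈0⇒x≈vy e)) lw)
        build : (∃ λ l → NonZeroV (φ l) × (¬ φ l ≈v f) × Is-secant f (φ l)) → Graph a b a' b' v w
        build (l , y≉0 , y≉f , sec) = record
          { v' = v' ; w' = w' ; on₁ = lv' ; on₂ = lw' ; ind₁ = ind₁ ; ind₂ = ind₂
          ; fwd = λ Ux → let i , p≈ , r≈ = Coordinates.exhaust T lv lv' ind₁ P R Pv-U (λ e e' → PR-inj e e') Ux in U-resp (combo-cong p≈ r≈) (Pw-U i)
          ; bwd = λ Ux → let i , p≈ , r≈ = Coordinates.exhaust T' lw lw' ind₂ P R Pw-U (λ e e' → PR-inj e e') Ux in U-resp (combo-cong p≈ r≈) (Pv-U i)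
          ; indΛ = indf ; secΛ = sec }
          where
          v' w' : V
          v' = Coordinates.point T (I l)
          w' = Coordinates.point T' (J l)
          Uv' : InU v'
          Uv' = Coordinates.point-U T (I l)
          Uw' : InU w'
          Uw' = Coordinates.point-U T' (J l)
          lv' : OnLine a b v'
          lv' = Coordinates.point-on T (I l)
          lw' : OnLine a' b' w'
          lw' = Coordinates.point-on T' (J l)
          indf : Indep2 f (φ l)
          indf = U-indep Uf (φ-U l) f≉0 y≉0 (λ e → y≉f (vsym e))
          -- A U-vector of either line on the secant ⟨f,y⟩ would make the secant equal to that line.
          none₁ : ∀ {x} → NonZeroV x → InU x → OnLine a b x → ¬ OnLine f (φ l) x
          none₁ x≉0 Ux lx lx' = disjoint w≉0 (line-+⁻¹
              (line-resp (λ t → +-comm _ _) (same-secant indf sec (Frame.ind T) (Frame.sec T) x≉0 (U-D x≉0 Ux) lx' lx line-u)) lv) lw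
          none₂ : ∀ {x} → NonZeroV x → InU x → OnLine a' b' x → ¬ OnLine f (φ l) x
          none₂ x≉0 Ux lx lx' = disjoint v≉0 lv (line-+⁻¹ (same-secant indf sec (Frame.ind T') (Frame.sec T') x≉0 (U-D x≉0 Ux) lx' lx line-u) lw)
          fy≉0 : NonZeroV (f +v φ l)
          fy≉0 e = y≉f (vsym (x+y≈0⇒x≈vy e))
          v'≉0 : NonZeroV v'
          v'≉0 e = none₂ (λ w'≈0 → y≉0 (vtrans (vcong+ e w'≈0) (λ t → +-identityʳ 0#))) Uw' lw'
              (line-resp (λ t → by₁ 1# (e t) (solve 2 (λ v w → (v :+ w) :+ w := con true :* (v :+ con false)) refl (v' t) (w' t))) line-v)
          w'≉0 : NonZeroV w'
          w'≉0 e = none₁ v'≉0 Uv' lv' (line-resp (λ t → by₁ 1# (e t)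
              (solve 2 (λ v w → (v :+ w) :+ v := con true :* (w :+ con false)) refl (v' t) (w' t))) line-v)
          v≉v' : ¬ v ≈v v'
          v≉v' e = none₂ (λ p → fy≉0 (vtrans eq p)) (U-+ Uw Uw') (line-+ lw lw') (line-resp eq (line-+ line-u line-v))
            where
            eq : (f +v φ l) ≈v (w +v w')
            eq t = by₁ 1# (e t) (solve 4 (λ v v' w w' → ((v :+ w) :+ (v' :+ w')) :+ (w :+ w') := con true :* (v :+ v')) refl (v t) (v' t)
                (w t) (w' t))
          w≉w' : ¬ w ≈v w'
          w≉w' e = none₁ (λ p → fy≉0 (vtrans eq p)) (U-+ Uv Uv') (line-+ lv lv') (line-resp eq (line-+ line-u line-v))
            where
            eq : (f +v φ l) ≈v (v +v v')
            eq t = by₁ 1# (e t) (solve 4 (λ v v' w w' → ((v :+ w) :+ (v' :+ w')) :+ (v :+ v') := con true :* (w :+ w')) refl (v t) (v' t)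
                (w t) (w' t))
          ind₁ : Indep2 v v'
          ind₁ = U-indep Uv Uv' v≉0 v'≉0 v≉v'
          ind₂ : Indep2 w w'
          ind₂ = U-indep Uw Uw' w≉0 w'≉0 w≉w'
          framed : ∃₂ λ a₃ b₃ → Frame a₃ b₃ × OnLine f (φ l) a₃ × OnLine f (φ l) b₃
          framed = frame-on indf sec
          T₃ : Frame (proj₁ framed) (proj₁ (proj₂ framed))
          T₃ = proj₁ (proj₂ (proj₂ framed))
          χ : Fin size → V
          χ = Coordinates.point T₃
          χ-on : ∀ i → OnLine f (φ l) (χ i)
          χ-on i = line-⊆ (proj₁ (proj₂ (proj₂ (proj₂ framed)))) (proj₂ (proj₂ (proj₂ (proj₂ framed)))) (Coordinates.point-on T₃ i)
          P R : Fin size → Carrier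
          P i = proj₁ (χ-on i)
          R i = proj₁ (proj₂ (χ-on i))
          χ≈ : ∀ i → χ i ≈v (((P i · v) +v (R i · v')) +v ((P i · w) +v (R i · w')))
          χ≈ i t = trans (proj₂ (proj₂ (χ-on i)) t)
              (solve 6 (λ p r v w v' w' → p :* (v :+ w) :+ r :* (v' :+ w') := (p :* v :+ r :* v') :+ (p :* w :+ r :* w')) refl (P i) (R i)
                  (v t) (w t) (v' t) (w' t))
          halves : ∀ i → InU ((P i · v) +v (R i · v')) × InU ((P i · w) +v (R i · w'))
          halves i = split-U₂ (Coordinates.point-U T₃ i) (line-+ (line-· _ lv) (line-· _ lv')) (line-+ (line-· _ lw) (line-· _ lw')) (χ≈ i)
          Pv-U : ∀ i → InU ((P i · v) +v (R i · v'))
          Pv-U i = proj₁ (halves i)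
          Pw-U : ∀ i → InU ((P i · w) +v (R i · w'))
          Pw-U i = proj₂ (halves i)
          PR-inj : ∀ {i j} → P i ≈ P j → R i ≈ R j → i ≡ j
          PR-inj {i} {j} e e' = Coordinates.point-inj T₃ (vtrans (proj₂ (proj₂ (χ-on i))) (vtrans (combo-cong e e') (vsym (proj₂ (proj₂ (χ-on j))))))

      iso : ∀ {v w} → InU v → NonZeroV v → OnLine a b v → InU w → NonZeroV w → OnLine a' b' w → Iso a b a' b' v w
      iso {v} {w} Uv v≉0 lv Uw w≉0 lw = build (graph Uv v≉0 lv Uw w≉0 lw)
        where
        build : Graph a b a' b' v w → Iso a b a' b' v w
        build G = record
          { ga = (pa · w) +v (ra · w') ; gb = (pb · w) +v (rb · w') ; y = v' +v w'
          ; onₐ = line-+ (line-· pa lw) (line-· ra on₂) ; on_b = line-+ (line-· pb lw) (line-· rb on₂)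
          ; ind = λ s t e → let P≈0 , R≈0 = ind₂ (P s t) (R s t) (vtrans (vsym (to-w s t)) e) in
              Frame.ind T s t (vtrans (to-v s t) (vtrans (combo-0ˡ P≈0) (0·x≈0 R≈0)))
          ; fwd = λ {s} {t} Ux → U-resp (vsym (to-w s t)) (fwd (U-resp (to-v s t) Ux))
          ; bwd = λ {s} {t} Ux → U-resp (vsym (to-v s t)) (bwd (U-resp (to-w s t) Ux))
          ; at = λ {s} {t} e → let P≈1 , R≈0 = coords-unique ind₁ {P s t} {R s t} {1#} {0#} (vtrans (vsym (to-v s t)) (vtrans (vsym e) combo-1-0)) in
              vsym (vtrans (to-w s t) (vtrans (combo-cong P≈1 R≈0) (vsym combo-1-0)))
          ; indΛ = indΛ ; secΛ = secΛ
          ; onΛ = λ s t → P s t , R s t , vtrans (vcong+ (to-v s t) (to-w s t)) (regroup (P s t) (R s t))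
          ; only = λ { {x} lx (p , r , e) → let x≈ , w≈ = direct lx (line-+ (line-· p lv) (line-· r on₁)) lw (line-+ (line-· p lw) (line-· r on₂)) (vtrans e (vsym (regroup p r)))
                                                p≈1 , r≈0 = coords-unique ind₂ {p} {r} {1#} {0#} (vtrans (vsym w≈) combo-1-0)
                                            in vtrans x≈ (vtrans (combo-cong p≈1 r≈0) (vsym combo-1-0)) }
          }
          where
          open Graph G
          ca : OnLine v v' a
          ca = line-⊇ ind₁ lv on₁ line-u
          cb : OnLine v v' b
          cb = line-⊇ ind₁ lv on₁ line-v
          pa ra pb rb : Carrier
          pa = proj₁ ca
          ra = proj₁ (proj₂ ca)
          pb = proj₁ cb
          rb = proj₁ (proj₂ cb)
          P R : Carrier → Carrier → Carrier
          P s t = s * pa + t * pb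
          R s t = s * ra + t * rb
          expand : ∀ {x y : V} s t i → s * (pa * x i + ra * y i) + t * (pb * x i + rb * y i) ≈ P s t * x i + R s t * y i
          expand {x} {y} s t i = solve 8 (λ s t pa ra pb rb x y → s :* (pa :* x :+ ra :* y) :+ t :*
              (pb :* x :+ rb :* y) := (s :* pa :+ t :* pb) :* x :+ (s :* ra :+ t :* rb) :* y) refl s t pa ra pb rb (x i) (y i)
          to-w : ∀ s t → ((s · ((pa · w) +v (ra · w'))) +v (t · ((pb · w) +v (rb · w')))) ≈v ((P s t · w) +v (R s t · w'))
          to-w s t = expand {w} {w'} s t
          to-v : ∀ s t → ((s · a) +v (t · b)) ≈v ((P s t · v) +v (R s t · v'))
          to-v s t = vtrans (vcong+ (vcong· refl (proj₂ (proj₂ ca))) (vcong· refl (proj₂ (proj₂ cb)))) (expand {v} {v'} s t)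
          regroup : ∀ p r → (((p · v) +v (r · v')) +v ((p · w) +v (r · w'))) ≈v ((p · (v +v w)) +v (r · (v' +v w')))
          regroup p r t = solve 6 (λ p r v w v' w' → (p :* v :+ r :* v') :+ (p :* w :+ r :* w') := p :* (v :+ w) :+ r :*
              (v' :+ w')) refl p r (v t) (w t) (v' t) (w' t)

    -- An injective linear map ⟨a,b⟩ → ⟨a',b'⟩ preserving U permutes the q vectors of U, hence does not map a into D.
    a-to-hole : ∀ {ha hb} → OnLine a' b' ha → OnLine a' b' hb → Indep2 ha hb → (∀ {s t} → InU ((s · a) +v (t · b)) → InU
        ((s · ha) +v (t · hb))) → ¬ D ha
    a-to-hole {ha} {hb} la lb indh h-U Dha = in-U (D⇒U (indep-u indh) Dha)
      where
      in-U : ¬ (∃ λ y → InU y × NonZeroV y × ha ∼ y)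
      in-U (y , Uy , y≉0 , q) = hit (prop-sym q)
        where
        hit : ¬ y ∼ ha
        hit (s , s≉0 , e) = from (Coordinates.exhaust T' la lb indh enum (λ i → Coordinates.σ T (enum i))
            (λ i → h-U (Coordinates.σ-U T (enum i))) (λ e _ → enum-inj _ _ e) {s} {0#}
            (U-resp (vtrans e (vsym (combo-0ʳ refl))) Uy))
          where
          from : ¬ (∃ λ i → enum i ≈ s × Coordinates.σ T (enum i) ≈ 0#)
          from (i , p≈ , r≈) = Frame.¬Da T (D-resp (indep-u (Frame.ind T)) (·-prop s≉0) (U-D (·≉0 s≉0 (indep-u (Frame.ind T)))
            (U-resp (vtrans (combo-cong p≈ r≈) (combo-0ʳ refl)) (Coordinates.σ-U T (enum i)))))

-- The field automorphism

module Splitting {c ℓ} {F : FiniteField c ℓ} {m : ℕ} (S : DirectionSet F m) where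
  open Directions S
  open Translations S using (secant-resp)
  open Additive S using (u; o; u-≉0)
  open Scattered S
  open Frames S
  open Graphs S
  open FiniteField F hiding (zero)
  open FieldBasics F
  open Char2 F 1+1≈0
  open Vectors m
  open PointSets F 1+1≈0 m

  secants-disjoint : ∀ {x y x' y' p} → Indep2 x y → Is-secant x y → Indep2 x' y' → Is-secant x' y' → OnLine x' y' p → ¬ OnLine x y p →
    ∀ {z} → NonZeroV z → OnLine x y z → ¬ OnLine x' y' z
  secants-disjoint {x} {y} {x'} {y'} ind sec ind' sec' lp ¬lp z≉0 lz lz' = go (frame-on ind sec) (frame-on ind' sec')
    where
    go : (∃₂ λ a b → Frame a b × OnLine x y a × OnLine x y b) → ¬ (∃₂ λ a b → Frame a b × OnLine x' y' a × OnLine x' y' b)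
    go (a , b , T , la , lb) (a' , b' , T' , la' , lb') = disjoint-frames T T'
        (frames-apart T T' (line-⊇ (Frame.ind T') la' lb' lp) (λ l → ¬lp (line-⊆ la lb l))) z≉0
      (line-⊇ (Frame.ind T) la lb lz) (line-⊇ (Frame.ind T') la' lb' lz')

  -- The points outside D on a secant are the two points of its frame, so any two of them frame it.
  reframe : ∀ {a b p q} → Frame a b → OnLine a b p → OnLine a b q → ¬ D p → ¬ D q → Indep2 p q → Frame p q
  reframe {a} {b} {p} {q} T lp lq ¬Dp ¬Dq indpq = record { ind = indpq ; sec = secant-resp ind indpq lp lq sec ; ¬Da = ¬Dp ; ¬Db = ¬Dq
    ; full = λ x≉0 y≉0 → cases x≉0 y≉0 (hole-∼ (indep-u indpq) ¬Dp lp) (hole-∼ (indep-v indpq) ¬Dq lq) }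
    where
    open Frame T
    open Coordinates T
    rescaled : ∀ {x y s t a b} → p ≈v (s · a) → q ≈v (t · b) → (((x * s) · a) +v ((y * t) · b)) ≈v ((x · p) +v (y · q))
    rescaled e e' i = +-cong (trans (*-assoc _ _ _) (*-congˡ (sym (e i)))) (trans (*-assoc _ _ _) (*-congˡ (sym (e' i))))
    cases : ∀ {x y} → ¬ x ≈ 0# → ¬ y ≈ 0# → p ∼ a ⊎ p ∼ b → q ∼ a ⊎ q ∼ b → D ((x · p) +v (y · q))
    cases x≉0 y≉0 (inj₁ (s , s≉0 , e)) (inj₂ (t , t≉0 , e')) = D-resp (combo≉0 indpq x≉0) (prop-refl (rescaled e e'))
        (full (*≉0 x≉0 s≉0) (*≉0 y≉0 t≉0))
    cases x≉0 y≉0 (inj₂ (s , s≉0 , e)) (inj₁ (t , t≉0 , e')) = D-resp (combo≉0 indpq x≉0) (prop-refl (rescaled e e'))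
        (Frame.full (frame-swap T) (*≉0 x≉0 s≉0) (*≉0 y≉0 t≉0))
    cases _ _ (inj₁ e) (inj₁ e') = contradiction (prop-trans e (prop-sym e')) (indep-≁ indpq)
    cases _ _ (inj₂ e) (inj₂ e') = contradiction (prop-trans e (prop-sym e')) (indep-≁ indpq)

  holes-to-holes : ∀ {a b a' b' ha hb} → Frame a b → Frame a' b' → Apart a b a' b' → OnLine a' b' ha → OnLine a' b' hb → Indep2 ha hb →
    (∀ {s t} → InU ((s · a) +v (t · b)) → InU ((s · ha) +v (t · hb))) → ¬ D ha × ¬ D hb
  holes-to-holes T T' apart la lb indh h-U = Pair.a-to-hole T T' apart la lb indh h-U ,
    Pair.a-to-hole (frame-swap T) T' (λ ≉0 Dx l l' → apart ≉0 Dx (line-swap l) l') lb la (indep-swap indh)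
        (λ Ux → U-resp combo-swap (h-U (U-resp combo-swap Ux)))

  module Diagonal {a b : V} (T : Frame a b) (U₁ : InU (a +v b)) {w : V} (Uw : InU w) (w∉ : ¬ OnLine a b w) where
    f₀ : V
    f₀ = a +v b

    f₀-on : OnLine a b f₀
    f₀-on = line-+ line-u line-v

    f₀≈ : f₀ ≈v ((1# · a) +v (1# · b))
    f₀≈ t = sym (+-cong (*-identityˡ _) (*-identityˡ _))

    f₀≉0 : NonZeroV f₀
    f₀≉0 e = 1≉0 (proj₁ (Frame.ind T 1# 1# (vtrans (vsym f₀≈) e)))

    w≉0 : NonZeroV w
    w≉0 e = w∉ (line-resp (vsym e) line-0)

    framed : ∃₂ λ a' b' → Frame a' b' × w ≈v (a' +v b')
    framed = frame-at Uw w≉0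

    a' b' : V
    a' = proj₁ framed
    b' = proj₁ (proj₂ framed)

    T' : Frame a' b'
    T' = proj₁ (proj₂ (proj₂ framed))

    w-on : OnLine a' b' w
    w-on = line-resp (vsym (proj₂ (proj₂ (proj₂ framed)))) (line-+ line-u line-v)

    apart : Apart a b a' b'
    apart = frames-apart T T' w-on w∉

    iso-at : ∀ {v} → InU v → NonZeroV v → OnLine a b v → Iso a b a' b' v w
    iso-at Uv v≉0 lv = Pair.iso T T' apart Uv v≉0 lv Uw w≉0 w-on

    iso₁ : Iso a b a' b' f₀ w
    iso₁ = iso-at U₁ f₀≉0 f₀-on

    open Iso iso₁ public

    w≈ : w ≈v (ga +v gb)
    w≈ = vtrans (at f₀≈) (λ t → +-cong (*-identityˡ _) (*-identityˡ _))

    holes₁ : ¬ D ga × ¬ D gb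
    holes₁ = holes-to-holes T T' apart onₐ on_b ind fwd

    T₁ : Frame ga gb
    T₁ = reframe T' onₐ on_b (proj₁ holes₁) (proj₂ holes₁) ind

    -- U on the reference secant is invariant under the diagonal map that takes the given vector of
    -- U to a + b. This is what makes `σ` multiplicative.
    Scaling : Carrier → Carrier → Set (c ⊔ ℓ)
    Scaling x y = ∃₂ λ s t → x * s ≈ 1# × y * t ≈ 1# × (∀ {p r} → InU ((p · a) +v (r · b)) → InU (((p * s) · a) +v ((r * t) · b)))

    -- The map of v is diagonal with respect to that of a + b: otherwise their sum, which again maps U to U
    -- injectively, would map a to a point of D.
    module _ {x y : Carrier} (Uv : InU ((x · a) +v (y · b))) (v≉0 : NonZeroV ((x · a) +v (y · b))) where
      v : V
      v = (x · a) +v (y · b)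

      scaling≉ : ¬ v ≈v f₀ → Scaling x y
      scaling≉ v≉f₀ = diagonal (hole-∼ (indep-u (Iso.ind g)) (proj₁ holes-g) (to-T₁ (Iso.onₐ g)))
          (hole-∼ (indep-v (Iso.ind g)) (proj₂ holes-g) (to-T₁ (Iso.on_b g)))
        where
        open Coordinates T₁ using (hole-∼)
        g : Iso a b a' b' v w
        g = iso-at Uv v≉0 (_ , _ , vrefl)
        ka kb : V
        ka = Iso.ga g
        kb = Iso.gb g
        holes-g : ¬ D ka × ¬ D kb
        holes-g = holes-to-holes T T' apart (Iso.onₐ g) (Iso.on_b g) (Iso.ind g) (Iso.fwd g)
        to-T₁ : ∀ {z} → OnLine a' b' z → OnLine ga gb z
        to-T₁ = line-⊇ ind onₐ on_b
        split-sum : ∀ s t → ((s · (ga +v ka)) +v (t · (gb +v kb))) ≈v (((s · ga) +v (t · gb)) +v ((s · ka) +v (t · kb)))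
        split-sum s t i = solve 6 (λ s t a b c d → s :* (a :+ c) :+ t :* (b :+ d) := (s :* a :+ t :* b) :+ (s :* c :+ t :* d)) refl s t
            (ga i) (gb i) (ka i) (kb i)
        -- If the sum of the two maps kills X, both send X to the same Y, so X + Y lies on both
        -- graphs. These are different secants, since by `only` a common v + w would force v = a +
        -- b, and so they are disjoint.
        sum-ind : Indep2 (ga +v ka) (gb +v kb)
        sum-ind s t e = decide ((X +v Y) ≟v 0v)
          where
          X Y Y' : V
          X = (s · a) +v (t · b)
          Y = (s · ga) +v (t · gb)
          Y' = (s · ka) +v (t · kb)
          Y≈Y' : Y ≈v Y'
          Y≈Y' = x+y≈0⇒x≈vy (vtrans (vsym (split-sum s t)) e)
          decide : Dec ((X +v Y) ≈v 0v) → s ≈ 0# × t ≈ 0#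
          decide (yes p) = ind s t (decide₀ (Y ≟v 0v))
            where
            decide₀ : Dec (Y ≈v 0v) → Y ≈v 0v
            decide₀ (yes q) = q
            decide₀ (no Y≉0) = contradiction (line-+ (line-· s onₐ) (line-· t on_b))
                (Pair.disjoint T T' apart Y≉0 (line-resp (x+y≈0⇒x≈vy p) (s , t , vrefl)))
          decide (no ≉0) = contradiction (line-resp (vcong+ vrefl (vsym Y≈Y')) (Iso.onΛ g s t))
            (secants-disjoint indΛ secΛ (Iso.indΛ g) (Iso.secΛ g) line-u (λ l → v≉f₀ (only (_ , _ , vrefl) l)) ≉0 (onΛ s t))
        sum-holes : ¬ D (ga +v ka) × ¬ D (gb +v kb)
        sum-holes = holes-to-holes T T' apart (line-+ onₐ (Iso.onₐ g)) (line-+ on_b (Iso.on_b g)) sum-ind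
            (λ {s} {t} Ux → U-resp (vsym (split-sum s t)) (U-+ (fwd Ux) (Iso.fwd g Ux)))
        diagonal : ka ∼ ga ⊎ ka ∼ gb → kb ∼ ga ⊎ kb ∼ gb → Scaling x y
        -- If the holes were swapped, the sum would send a to ga + s gb, a combination with two
        -- nonzero coefficients in the frame `T₁`, hence a point of D.
        diagonal (inj₂ (s , s≉0 , e)) _ = contradiction
            (D-resp (indep-u sum-ind) (prop-refl λ i → +-cong (*-identityˡ _) (sym (e i))) (Frame.full T₁ 1≉0 s≉0)) (proj₁ sum-holes)
        diagonal _ (inj₁ (s , s≉0 , e)) = contradiction
            (D-resp (indep-v sum-ind) (prop-refl λ i → trans (+-comm _ _) (+-cong (*-identityˡ _) (sym (e i)))) (Frame.full T₁ s≉0 1≉0))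
                (proj₂ sum-holes)
        -- The scaling is the map of v followed by the inverse of the map of a + b. Both maps reach
        -- the same w, one from v and the other from a + b, so x s = y t = 1.
        diagonal (inj₁ (s , _ , e)) (inj₂ (t , _ , e')) = s , t , proj₁ ones , proj₂ ones , λ {p} {r} Ux → bwd (U-resp (scaled p r) (Iso.fwd g Ux))
          where
          scaled : ∀ p r → ((p · ka) +v (r · kb)) ≈v (((p * s) · ga) +v ((r * t) · gb))
          scaled p r i = +-cong (trans (*-congˡ (e i)) (sym (*-assoc _ _ _))) (trans (*-congˡ (e' i)) (sym (*-assoc _ _ _)))
          ones : x * s ≈ 1# × y * t ≈ 1#
          ones = coords-unique ind {x * s} {y * t} {1#} {1#} (vtrans (vsym (scaled x y)) (vtrans (vsym (Iso.at g vrefl)) (at f₀≈)))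

      scaling : Scaling x y
      scaling = decide (v ≟v f₀)
        where
        decide : Dec (v ≈v f₀) → Scaling x y
        decide (no v≉f₀) = scaling≉ v≉f₀
        decide (yes v≈f₀) = 1# , 1# , trans (*-identityʳ x) (proj₁ ones) , trans (*-identityʳ y) (proj₂ ones) , λ Ux → U-resp
            (combo-cong (sym (*-identityʳ _)) (sym (*-identityʳ _))) Ux
          where
          ones : x ≈ 1# × y ≈ 1#
          ones = coords-unique (Frame.ind T) {x} {y} {1#} {1#} (vtrans v≈f₀ f₀≈)

  -- Diagonal maps come from comparing two graphs over a second secant, so a vector `w` of U off the
  -- reference secant is fixed along with the frame. The scaling by which a + b lies in U makes σ(1)
  -- = 1.
  record Base : Set (c ⊔ ℓ) where
    field
      a b : V
      T : Frame a b
      U₁ : InU (a +v b)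
      w : V
      Uw : InU w
      w∉ : ¬ OnLine a b w

  abstract
    base : Base
    base = build (missed {1} {n} (ℕₚ.≤-trans (s≤s (ℕₚ.<⇒≤ 1<q)) q<n) (λ _ → o))
      where
      build : (∃ λ i → Fin 1 → o ≢ i) → Base
      build (i , o≢i) = framed (frame-at (i , vrefl) (u-≉0 (λ e → o≢i zero (≡.sym e))))
        where
        framed : (∃₂ λ a b → Frame a b × u i ≈v (a +v b)) → Base
        framed (a , b , T , e) = record { a = a ; b = b ; T = T ; U₁ = (i , vsym e) ; w = u (proj₁ off) ; Uw = (proj₁ off , vrefl)
            ; w∉ = λ l → proj₂ off (line-⊇ indf f-on line-u l) }
          where
          f : V
          f = a +v b
          f-on : OnLine a b f
          f-on = line-+ line-u line-v
          f≉0 : NonZeroV f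
          f≉0 p = u-≉0 (λ e → o≢i zero (≡.sym e)) (vtrans e p)
          Df : D f
          Df = U-D f≉0 (i , vsym e)
          indf : Indep2 f a
          indf = indep f≉0 (indep-u (Frame.ind T)) (λ p → Frame.¬Da T (D-resp (indep-u (Frame.ind T)) p Df))
          off : ∃ λ x → ¬ OnLine f a (u x)
          off = off-plane Df indf o

  open Base base public
  open Coordinates T public using (σ; σ-U; σ-unique; σ-cong)

  σ-1 : σ 1# ≈ 1#
  σ-1 = sym (σ-unique (U-resp (λ t → sym (+-cong (*-identityˡ _) (*-identityˡ _))) U₁))

  σ-+ : ∀ x y → σ (x + y) ≈ σ x + σ y
  σ-+ x y = sym (σ-unique (U-resp combo-+ (U-+ (σ-U x) (σ-U y))))

  σ-0 : ∀ {x} → x ≈ 0# → σ x ≈ 0#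
  σ-0 {x} x≈0 = sym (σ-unique (U-resp (λ t → sym (trans (combo-0ˡ {a} {b} x≈0 t) (zeroˡ _))) U-0))

  σ≉0 : ∀ {x} → ¬ x ≈ 0# → ¬ σ x ≈ 0#
  σ≉0 {x} x≉0 e = Frame.¬Da T (D-resp (indep-u (Frame.ind T)) (·-prop x≉0) (U-D (·≉0 x≉0 (indep-u (Frame.ind T))) (U-resp (combo-0ʳ e) (σ-U x))))

  σ-* : ∀ x y → σ (x * y) ≈ σ x * σ y
  σ-* x y = decide (y ≟ 0#)
    where
    decide : Dec (y ≈ 0#) → σ (x * y) ≈ σ x * σ y
    decide (yes y≈0) = trans (σ-0 (trans (*-congˡ y≈0) (zeroʳ x))) (sym (trans (*-congˡ (σ-0 y≈0)) (zeroʳ _)))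
    -- The scaling belonging to the vector of U with a-coordinate 1/y has s = y. Applied to 1 it
    -- shows t = σ(y), and applied to x it gives the product rule.
    decide (no y≉0) = go (Diagonal.scaling T U₁ Uw w∉ (σ-U y⁻¹) (combo≉0 (Frame.ind T) (inv≉0 y y≉0)))
      where
      y⁻¹ : Carrier
      y⁻¹ = inv y y≉0
      go : Diagonal.Scaling T U₁ Uw w∉ y⁻¹ (σ y⁻¹) → σ (x * y) ≈ σ x * σ y
      go (s , t , e , e' , act) = trans (σ-cong (*-congˡ (sym s≈y))) (trans (sym (σ-unique (act (σ-U x)))) (*-congˡ t≈σy))
        where
        s≈y : s ≈ y
        s≈y = by₂ y e s (inv-r y y≉0) (solve 3 (λ s y y' → s :+ y := y :* (y' :* s :+ con true) :+ s :* (y :* y' :+ con true)) refl s y y⁻¹)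
        t≈σy : t ≈ σ y
        t≈σy = trans (sym (trans (*-congʳ σ-1) (*-identityˡ t))) (trans (σ-unique (act (σ-U 1#))) (σ-cong (trans (*-identityˡ s) s≈y)))

  σ-surj : ∀ y → ∃ λ x → σ x ≈ y
  σ-surj y = let x , Ux = Coordinates.partner (frame-swap T) y in x , sym (σ-unique (U-resp combo-swap Ux))

  -- With both coordinates nonzero the point is in D, so some multiple of it lies in U.
  σ-ratio : ∀ {p r} → ¬ p ≈ 0# → ¬ r ≈ 0# → ∃ λ s → ¬ s ≈ 0# × σ (s * p) ≈ s * r
  σ-ratio {p} {r} p≉0 r≉0 = let y , Uy , y≉0 , q = D⇒U (combo≉0 (Frame.ind T) p≉0) (Frame.full T p≉0 r≉0) in go Uy (prop-sym q)
    where
    go : ∀ {y} → InU y → y ∼ ((p · a) +v (r · b)) → ∃ λ s → ¬ s ≈ 0# × σ (s * p) ≈ s * r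
    go Uy (s , s≉0 , e) = s , s≉0 , sym (σ-unique
        (U-resp (vtrans e (λ t → trans (distribˡ s _ _) (+-cong (sym (*-assoc _ _ _)) (sym (*-assoc _ _ _))))) Uy))

  -- Otherwise ζ (a + b) lies in U next to a + b, and scatteredness puts ζ into F₂. So `σ` moves
  -- every scalar outside F₂; one such scalar suffices to place α and β in H∞.
  σζ≉ζ : ¬ σ ζ ≈ ζ
  σζ≉ζ e = [ (λ p → ζ≉0 (proj₁ (Frame.ind T ζ ζ (vtrans (vsym ζf) p)))) , (λ p → 1+ζ≉0 (proj₁ (Frame.ind T (1# + ζ) (1# + ζ) λ t → by₁ 1# (p t)
      (solve 3 (λ z a b → ((con true :+ z) :* a :+ (con true :+ z) :* b) :+ con false := con true :* (z :* (a :+ b) :+ (a :+ b))) refl ζ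
          (a t) (b t))))) ]′
    (U-multiple {a = ζ} (U-resp (vsym ζf) (U-resp (combo-cong refl e) (σ-U ζ))) U₁ f≉0 vrefl)
    where
    ζf : (ζ · (a +v b)) ≈v ((ζ · a) +v (ζ · b))
    ζf t = distribˡ ζ _ _
    f≉0 : NonZeroV (a +v b)
    f≉0 p = 1≉0 (proj₁ (Frame.ind T 1# 1# λ t → trans (+-cong (*-identityˡ _) (*-identityˡ _)) (p t)))

  record Split (α β : V) : Set (c ⊔ ℓ) where
    field
      ind : Indep2 α β
      act : ∀ p → InU ((p · α) +v (σ p · β))

  abstract
    -- Off the reference secant, α and β are the images of a and b under the graph map that takes a
    -- + b to w. On it, w = p a + σ(p) b, and multiplicativity of `σ` makes p a and σ(p) b a
    -- splitting.
    split : ∀ {w} → InU w → NonZeroV w → ∃₂ λ α β → Split α β × w ≈v (α +v β)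
    split {w'} Uw' w'≉0 = decide (online? w')
      where
      decide : Dec (OnLine a b w') → ∃₂ λ α β → Split α β × w' ≈v (α +v β)
      decide (no w'∉) = Δ.ga , Δ.gb , record { ind = Δ.ind ; act = λ p → Δ.fwd (σ-U p) } , Δ.w≈
        where module Δ = Diagonal T U₁ Uw' w'∉
      decide (yes (p , r , e)) = (p · a) , (σ p · b) , record { ind = ind'
          ; act = λ s → U-resp (λ t → +-cong (*-assoc _ _ _) (trans (*-congʳ (σ-* s p)) (*-assoc _ _ _))) (σ-U (s * p)) } , e'
        where
        e' : w' ≈v ((p · a) +v (σ p · b))
        e' = vtrans e (combo-cong refl (σ-unique (U-resp e Uw')))
        p≉0 : ¬ p ≈ 0#
        p≉0 p≈0 = w'≉0 (vtrans e' (vtrans (combo-0ˡ p≈0) (0·x≈0 (σ-0 p≈0))))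
        ind' : Indep2 (p · a) (σ p · b)
        ind' s t q = let q₁ , q₂ = Frame.ind T (s * p) (t * σ p) (vtrans (λ i → +-cong (*-assoc _ _ _) (*-assoc _ _ _)) q)
          in a*x≈0⇒x≈0 p≉0 (trans (*-comm _ _) q₁) , a*x≈0⇒x≈0 (σ≉0 p≉0) (trans (*-comm _ _) q₂)

    -- The closing 0# makes the four scalars nonzero as well as distinct; they give four points of D
    -- on a split line.
    four-scalars : ∃₂ λ x y → ∃₂ λ z t → AllPairs (λ p r → ¬ p ≈ r) (x ∷ y ∷ z ∷ t ∷ 0# ∷ [])
    four-scalars =
      let x , ax = scalar-avoiding (0# ∷ []) (ℕₚ.≤-trans (ℕₚ.m≤m+n 2 14) 16≤q)
          y , ay = scalar-avoiding (x ∷ 0# ∷ []) (ℕₚ.≤-trans (ℕₚ.m≤m+n 3 13) 16≤q)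
          z , az = scalar-avoiding (y ∷ x ∷ 0# ∷ []) (ℕₚ.≤-trans (ℕₚ.m≤m+n 4 12) 16≤q)
          t , at = scalar-avoiding (z ∷ y ∷ x ∷ 0# ∷ []) (ℕₚ.≤-trans (ℕₚ.m≤m+n 5 11) 16≤q)
      in t , z , y , x , at ∷ az ∷ ay ∷ ax ∷ [] ∷ []

  module SplitLine {α β : V} (σαβ : Split α β) where
    open Split σαβ

    pnt : Carrier → V
    pnt p = (p · α) +v (σ p · β)

    pnt-≉0 : ∀ {p} → ¬ p ≈ 0# → NonZeroV (pnt p)
    pnt-≉0 = combo≉0 ind

    pnt-≁ : ∀ {p r} → ¬ p ≈ 0# → ¬ r ≈ 0# → ¬ p ≈ r → ¬ pnt p ∼ pnt r
    pnt-≁ p≉0 r≉0 p≉r q = p≉r (proj₁ (coords-unique ind (U-scattered (act _) (act _) (pnt-≉0 p≉0) (pnt-≉0 r≉0) q)))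

    abstract
      secant : Is-secant α β
      secant = go four-scalars
        where
        ok : ∀ {p} → ¬ p ≈ 0# → NonZeroV (pnt p) × LineD α β (pnt p)
        ok p≉0 = pnt-≉0 p≉0 , (_ , _ , vrefl) , U-D (pnt-≉0 p≉0) (act _)
        go : (∃₂ λ x y → ∃₂ λ z t → AllPairs (λ p r → ¬ p ≈ r) (x ∷ y ∷ z ∷ t ∷ 0# ∷ [])) → Is-secant α β
        go (x , y , z , t , (xy ∷ xz ∷ xt ∷ x0 ∷ []) ∷ (yz ∷ yt ∷ y0 ∷ []) ∷ (zt ∷ z0 ∷ []) ∷ (t0 ∷ []) ∷ [] ∷ []) =
          4-points⇒ ind (ok x0 ∷ ok y0 ∷ ok z0 ∷ ok t0 ∷ [])
            ((pnt-≁ x0 y0 xy ∷ pnt-≁ x0 z0 xz ∷ pnt-≁ x0 t0 xt ∷ []) ∷ (pnt-≁ y0 z0 yz ∷ pnt-≁ y0 t0 yt ∷ []) ∷ (pnt-≁ z0 t0 zt ∷ []) ∷ [] ∷ [])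

      -- The q vectors p α + σ(p) β are distinct, so by `exhaust` U has no others on this line.
      U-on : ∀ {p r} → InU ((p · α) +v (r · β)) → r ≈ σ p
      U-on {p} {r} Ux = go (frame-on ind secant)
        where
        go : (∃₂ λ a b → Frame a b × OnLine α β a × OnLine α β b) → r ≈ σ p
        go (_ , _ , T₃ , la , lb) = let i , e , e' = Coordinates.exhaust T₃ (line-⊇ (Frame.ind T₃) la lb line-u) (line-⊇ (Frame.ind T₃) la lb line-v) ind enum (λ i → σ (enum i)) (λ i → act (enum i)) (λ e _ → enum-inj _ _ e) Ux
          in trans (sym e') (σ-cong e)

      frame : Frame α β
      frame = record { ind = ind ; sec = secant
        ; ¬Da = λ Dα → let y , Uy , y≉0 , q = D⇒U (indep-u ind) Dα in ¬α Uy (prop-sym q)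
        ; ¬Db = λ Dβ → let y , Uy , y≉0 , q = D⇒U (indep-v ind) Dβ in ¬β Uy (prop-sym q)
        ; full = full′ }
        where
        ¬α : ∀ {y} → InU y → ¬ y ∼ α
        ¬α Uy (s , s≉0 , e) = σ≉0 s≉0 (sym (U-on {s} {0#} (U-resp (vtrans e (vsym (combo-0ʳ refl))) Uy)))
        ¬β : ∀ {y} → InU y → ¬ y ∼ β
        ¬β Uy (s , s≉0 , e) = s≉0 (trans (U-on {0#} {s} (U-resp (vtrans e (vsym (combo-0ˡ refl))) Uy)) (σ-0 refl))
        full′ : ∀ {p r} → ¬ p ≈ 0# → ¬ r ≈ 0# → D ((p · α) +v (r · β))
        full′ {p} {r} p≉0 r≉0 = let s , s≉0 , e = σ-ratio p≉0 r≉0 in D-resp (combo≉0 ind p≉0)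
          (s , s≉0 , λ t → trans (+-congˡ (*-congʳ e))
              (solve 5 (λ s p r a b → s :* p :* a :+ s :* r :* b := s :* (p :* a :+ r :* b)) refl s p r (α t) (β t)))
          (U-D (pnt-≉0 (*≉0 s≉0 p≉0)) (act (s * p)))

    private
      -- Two combinations of α and β lie in H∞, with independent coefficients (1 , 1) and (ζ , σ ζ).
      α₀≈β₀ : α zero ≈ β zero
      α₀≈β₀ = by₂ 1# (U-∞ (act 1#)) (β zero) σ-1
          (solve 3 (λ a b s → a :+ b := con true :* ((con true :* a :+ s :* b) :+ con false) :+ b :* (s :+ con true)) refl (α zero) (β zero) (σ 1#))

    α-∞ : InH∞ α
    α-∞ = a*x≈0⇒x≈0 {σ ζ + ζ} (λ e → σζ≉ζ (x+y≈0⇒x≈y e)) (by₂ 1# (U-∞ (act ζ)) (σ ζ) α₀≈β₀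
      (solve 4 (λ s z a b → (s :+ z) :* a :+ con false := con true :* ((z :* a :+ s :* b) :+ con false) :+ s :* (a :+ b)) refl (σ ζ) ζ
          (α zero) (β zero)))

    β-∞ : InH∞ β
    β-∞ = trans (sym α₀≈β₀) α-∞

  -- α + β lies in U, and by `U-on` the listed vectors are all of U on the second line, so `new`
  -- puts α + β off that line. Distinct secants are disjoint.
  split-disjoint : ∀ {α β α' β'} → Split α β → Split α' β' → (∀ p → ¬ (α +v β) ≈v ((p · α') +v (σ p · β'))) →
    ∀ {z} → NonZeroV z → OnLine α β z → ¬ OnLine α' β' z
  split-disjoint {α} {β} {α'} {β'} s s' new z≉0 lz lz' =
    secants-disjoint (Split.ind s') (SplitLine.secant s') (Split.ind s) (SplitLine.secant s) (line-+ line-u line-v) off z≉0 lz' lz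
    where
    off : ¬ OnLine α' β' (α +v β)
    off (p , r , e) = new p (vtrans e (combo-cong refl
        (SplitLine.U-on s' (U-resp e (U-resp (λ t → +-cong (*-identityˡ _) (trans (*-congʳ σ-1) (*-identityˡ _))) (Split.act s 1#))))))

-- Normal form and transversal spaces

module ProjectivePoints {c ℓ} (F : FiniteField c ℓ) where
  open FiniteField F hiding (zero)
  open FieldBasics F

  NonzeroS : ∀ {k} → (Fin k → Carrier) → Set ℓ
  NonzeroS x = ∃ λ i → ¬ x i ≈ 0#

  nonzeroS? : ∀ {k} (x : Fin k → Carrier) → Dec (NonzeroS x)
  nonzeroS? x = Finₚ.any? (λ i → ¬? (x i ≟ 0#))

  zeroS : ∀ {k} {x : Fin k → Carrier} → ¬ NonzeroS x → ∀ i → x i ≈ 0#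
  zeroS {x = x} ¬nz i = decide (x i ≟ 0#)
    where
    decide : Dec (x i ≈ 0#) → x i ≈ 0#
    decide (yes e) = e
    decide (no ≉0) = contradiction (i , ≉0) ¬nz

  _∼S_ : ∀ {k} → (Fin k → Carrier) → (Fin k → Carrier) → Set (c ⊔ ℓ)
  x ∼S y = ∃ λ a → ¬ a ≈ 0# × (∀ i → x i ≈ a * y i)

  #pts : ℕ → ℕ
  #pts zero = 0
  #pts (suc k) = size ℕ.^ k ℕ.+ #pts k

  private
    normal : ∀ k → Fin (size ℕ.^ k) ⊎ Fin (#pts k) → Fin (suc k) → Carrier

  -- Representatives of the points of PG(k-1,q): the first nonzero coordinate is 1.
  pts : ∀ k → Fin (#pts k) → Fin k → Carrier
  pts (suc k) i = normal k (Fin.splitAt (size ℕ.^ k) i)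

  normal k (inj₁ e) zero = 1#
  normal k (inj₁ e) (suc t) = enum (Fin.finToFun e t)
  normal k (inj₂ j) zero = 0#
  normal k (inj₂ j) (suc t) = pts k j t

  #pts-size : ∀ k → 0 < size → suc (#pts k ℕ.* (size ∸ 1)) ≡ size ℕ.^ k
  #pts-size zero _ = ≡.refl
  #pts-size (suc k) 0<q = go size (size ℕ.^ k) (#pts k) 0<q (#pts-size k 0<q)
    where
    go : ∀ q Q N → 0 < q → suc (N ℕ.* (q ∸ 1)) ≡ Q → suc ((Q ℕ.+ N) ℕ.* (q ∸ 1)) ≡ q ℕ.* Q
    go (suc q) Q N _ e = ≡.trans (≡.cong suc (ℕₚ.*-distribʳ-+ q Q N)) (≡.trans (≡.sym (ℕₚ.+-suc (Q ℕ.* q) (N ℕ.* q)))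
      (≡.trans (≡.cong (Q ℕ.* q ℕ.+_) e) (≡.trans (ℕₚ.+-comm (Q ℕ.* q) Q) (≡.cong (Q ℕ.+_) (ℕₚ.*-comm Q q)))))

  pts-nonzero : ∀ k i → NonzeroS (pts k i)
  pts-nonzero (suc k) i = go (Fin.splitAt (size ℕ.^ k) i)
    where
    go : ∀ s → NonzeroS (normal k s)
    go (inj₁ e) = zero , 1≉0
    go (inj₂ j) = let t , ≉0 = pts-nonzero k j in suc t , ≉0

  pts-inj : ∀ k i j → pts k i ∼S pts k j → i ≡ j
  pts-inj (suc k) i j p = ≡.trans (≡.sym (Finₚ.join-splitAt (size ℕ.^ k) (#pts k) i))
      (≡.trans (≡.cong (Fin.join (size ℕ.^ k) (#pts k)) (go (Fin.splitAt (size ℕ.^ k) i) (Fin.splitAt (size ℕ.^ k) j) p))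
          (Finₚ.join-splitAt (size ℕ.^ k) (#pts k) j))
    where
    go : ∀ s s' → normal k s ∼S normal k s' → s ≡ s'
    go (inj₁ e) (inj₁ e') (a , _ , p) = ≡.cong inj₁
        (finToFun-inj {size} {k} λ t → enum-inj _ _ (trans (p (suc t)) (trans (*-congʳ (sym (trans (p zero) (*-identityʳ a)))) (*-identityˡ _))))
    go (inj₁ e) (inj₂ j) (a , _ , p) = contradiction (trans (p zero) (zeroʳ a)) 1≉0
    go (inj₂ i) (inj₁ e) (a , a≉0 , p) = contradiction (trans (sym (*-identityʳ a)) (sym (p zero))) a≉0
    go (inj₂ i) (inj₂ j) (a , a≉0 , p) = ≡.cong inj₂ (pts-inj k i j (a , a≉0 , p ∘ suc))

  pts-all : ∀ k (x : Fin k → Carrier) → NonzeroS x → ∃ λ i → x ∼S pts k i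
  pts-all (suc k) x nz = decide (x zero ≟ 0#)
    where
    at : ∀ s → x ∼S normal k s → ∃ λ i → x ∼S pts (suc k) i
    at s p = Fin.join (size ℕ.^ k) (#pts k) s , ≡.subst (λ s → x ∼S normal k s) (≡.sym (Finₚ.splitAt-join (size ℕ.^ k) (#pts k) s)) p
    tail-nonzero : x zero ≈ 0# → NonzeroS x → NonzeroS (x ∘ suc)
    tail-nonzero x₀≈0 (zero , ≉0) = contradiction x₀≈0 ≉0
    tail-nonzero x₀≈0 (suc t , ≉0) = t , ≉0
    decide : Dec (x zero ≈ 0#) → ∃ λ i → x ∼S pts (suc k) i
    decide (yes x₀≈0) = let j , a , a≉0 , p = pts-all k (x ∘ suc) (tail-nonzero x₀≈0 nz) in
      at (inj₂ j) (a , a≉0 , λ { zero → trans x₀≈0 (sym (zeroʳ a)) ; (suc t) → p t })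
    decide (no x₀≉0) = at (inj₁ (Fin.funToFin y)) (x zero , x₀≉0 , λ { zero → sym (*-identityʳ _) ; (suc t) → tail t })
      where
      y : Fin k → Fin size
      y t = ι (inv (x zero) x₀≉0 * x (suc t))
      tail : ∀ t → x (suc t) ≈ x zero * enum (Fin.finToFun (Fin.funToFin y) t)
      tail t = sym (trans (*-congˡ (trans (reflexive (≡.cong enum (Finₚ.finToFun-funToFin y t))) (sym (ι-≈ _))))
        (trans (sym (*-assoc _ _ _)) (trans (*-congʳ (inv-r (x zero) x₀≉0)) (*-identityˡ _))))

module NormalForm {c ℓ} {F : FiniteField c ℓ} {m : ℕ} (S : DirectionSet F m) (k : ℕ) (n≡ : DirectionSet.n S ≡ FiniteField.size F ℕ.^ k) where
  open Directions S
  open Additive S using (u; same-secant)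
  open Scattered S
  open Frames S
  open Splitting S
  open FiniteField F hiding (zero)
  open FieldBasics F
  open Char2 F 1+1≈0
  open Vectors m
  open PointSets F 1+1≈0 m
  open ProjectivePoints F

  Scalars : ℕ → Set c
  Scalars j = Fin j → Carrier

  module Combination {j} (αs βs : Fin j → V) where
    module LA = LinearMap (span αs)
    module LB = LinearMap (span βs)

    -- `Bv` is σ-semilinear: multiplying x by p moves `cv x` along the secant of `Av x` and `Bv x`.
    Av Bv cv : Scalars j → V
    Av x = LA.L x
    Bv x = LB.L (σ ∘ x)
    cv x = Av x +v Bv x

    Av-cong : ∀ {x y} → (∀ t → x t ≈ y t) → Av x ≈v Av y
    Av-cong = LA.L-cong

    Bv-cong : ∀ {x y} → (∀ t → x t ≈ y t) → Bv x ≈v Bv y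
    Bv-cong e = LB.L-cong (λ t → σ-cong (e t))

    cv-cong : ∀ {x y} → (∀ t → x t ≈ y t) → cv x ≈v cv y
    cv-cong e = vcong+ (Av-cong e) (Bv-cong e)

    Av-· : ∀ p x → Av (λ t → p * x t) ≈v (p · Av x)
    Av-· = LA.L-·

    Bv-· : ∀ p x → Bv (λ t → p * x t) ≈v (σ p · Bv x)
    Bv-· p x = vtrans (LB.L-cong (λ t → σ-* p (x t))) (LB.L-· (σ p) (σ ∘ x))

    Av-+ : ∀ x y → Av (λ t → x t + y t) ≈v (Av x +v Av y)
    Av-+ = LA.L-+

    Bv-+ : ∀ x y → Bv (λ t → x t + y t) ≈v (Bv x +v Bv y)
    Bv-+ x y = vtrans (LB.L-cong (λ t → σ-+ (x t) (y t))) (LB.L-+ (σ ∘ x) (σ ∘ y))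

    Av-0 : ∀ {x} → (∀ t → x t ≈ 0#) → Av x ≈v 0v
    Av-0 {x} x≈0 = vtrans (Av-cong (λ t → trans (x≈0 t) (sym (zeroˡ (x t))))) (vtrans (Av-· 0# x) (0·x≈0 refl))

    Bv-0 : ∀ {x} → (∀ t → x t ≈ 0#) → Bv x ≈v 0v
    Bv-0 {x} x≈0 = vtrans (Bv-cong (λ t → trans (x≈0 t) (sym (zeroˡ (x t))))) (vtrans (Bv-· 0# x) (0·x≈0 (σ-0 refl)))

  -- The invariant `cv-ind` is stronger than injectivity of `cv`. It turns every nonzero x into a
  -- `Split`, hence a secant, so that a new splitting can be shown disjoint from all secants
  -- obtained so far.
  record Partial (j : ℕ) : Set (c ⊔ ℓ) where
    field
      αs βs : Fin j → V
      αs-∞ : ∀ i → InH∞ (αs i)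
      βs-∞ : ∀ i → InH∞ (βs i)
    open Combination αs βs public
    field
      cv-U : ∀ x → InU (cv x)
      cv-ind : ∀ x → NonzeroS x → Indep2 (Av x) (Bv x)

    cv-act : ∀ x p → InU ((p · Av x) +v (σ p · Bv x))
    cv-act x p = U-resp (vcong+ (Av-· p x) (Bv-· p x)) (cv-U (λ t → p * x t))

    cv-split : ∀ x → NonzeroS x → Split (Av x) (Bv x)
    cv-split x nz = record { ind = cv-ind x nz ; act = cv-act x }

    cv-inj : ∀ {x y} → cv x ≈v cv y → ∀ t → x t ≈ y t
    cv-inj {x} {y} e t = x+y≈0⇒x≈y (zeroS (λ nz → 1≉0 (proj₁ (cv-ind (λ t → x t + y t) nz 1# 1# (vtrans sum (≈v⇒+≈0 e))))) t)
      where
      sum : ((1# · Av (λ t → x t + y t)) +v (1# · Bv (λ t → x t + y t))) ≈v (cv x +v cv y)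
      sum i = trans (+-cong (trans (*-identityˡ _) (Av-+ x y i)) (trans (*-identityˡ _) (Bv-+ x y i)))
        (solve 4 (λ a b c d → (a :+ b) :+ (c :+ d) := (a :+ c) :+ (b :+ d)) refl (Av x i) (Av y i) (Bv x i) (Bv y i))

    decoded : Fin (size ℕ.^ j) → Scalars j
    decoded e t = enum (Fin.finToFun e t)

    decoded-code : ∀ x t → decoded (code x) t ≈ x t
    decoded-code x t = trans (reflexive (≡.cong enum (Finₚ.finToFun-funToFin (ι ∘ x) t))) (sym (ι-≈ (x t)))

    cv-index : Fin (size ℕ.^ j) → Fin n
    cv-index e = U-index (cv-U (decoded e))

  start : Partial 0
  start = record { αs = λ () ; βs = λ () ; αs-∞ = λ () ; βs-∞ = λ () ; cv-U = λ x → U-resp (λ t → sym (+-identityʳ 0#)) U-0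
      ; cv-ind = λ { x (() , _) } }

  abstract
    -- The q^j combinations are fewer than the n = q^k vectors of U. Any vector of U that is missed
    -- is split, and its two parts become the next pair of basis vectors.
    extend : ∀ {j} → j < k → Partial j → Partial (suc j)
    extend {j} j<k P = build (missed {size ℕ.^ j} {n} (≡.subst (size ℕ.^ j <_) (≡.sym n≡) (ℕₚ.^-monoʳ-< size 1<q j<k)) cv-index)
      where
      open Partial P
      build : (∃ λ i → ∀ e → cv-index e ≢ i) → Partial (suc j)
      build (i , new) = extended (split (i , vrefl) ui≉0)
        where
        ui≉c : ∀ x → ¬ u i ≈v cv x
        ui≉c x e = new (code x) (U-index-cong (cv-U (decoded (code x))) (i , vrefl) (vtrans (cv-cong (decoded-code x)) (vsym e)))
        ui≉0 : NonZeroV (u i)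
        ui≉0 e = ui≉c (λ _ → 0#) (vtrans e (vsym (vtrans (vcong+ (Av-0 (λ _ → refl)) (Bv-0 (λ _ → refl))) (λ t → +-identityʳ 0#))))
        extended : (∃₂ λ α β → Split α β × u i ≈v (α +v β)) → Partial (suc j)
        extended (α , β , sp , e) = record
          { αs = αs' ; βs = βs' ; αs-∞ = λ { zero → SplitLine.α-∞ sp ; (suc t) → αs-∞ t } ; βs-∞ = λ { zero → SplitLine.β-∞ sp ; (suc t) → βs-∞ t }
          ; cv-U = λ x → U-resp (λ t → solve 4 (λ a b c d → (a :+ b) :+ (c :+ d) := (a :+ c) :+ (b :+ d)) refl (x zero * α t)
              (σ (x zero) * β t) (Av (x ∘ suc) t) (Bv (x ∘ suc) t)) (U-+ (Split.act sp (x zero)) (cv-U (x ∘ suc)))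
          ; cv-ind = λ x nz → ind x (x zero ≟ 0#) (nonzeroS? (x ∘ suc)) nz }
          where
          αs' βs' : Fin (suc j) → V
          αs' zero = α
          αs' (suc t) = αs t
          βs' zero = β
          βs' (suc t) = βs t
          module C' = Combination αs' βs'
          head-≈ : ∀ x → x zero ≈ 0# → C'.Av x ≈v Av (x ∘ suc) × C'.Bv x ≈v Bv (x ∘ suc)
          head-≈ x x₀≈0 = (λ t → trans (+-congʳ (trans (*-congʳ x₀≈0) (zeroˡ _))) (+-identityˡ _)) , (λ t → trans
              (+-congʳ (trans (*-congʳ (σ-0 x₀≈0)) (zeroˡ _))) (+-identityˡ _))
          ind-resp : ∀ {y z y' z' : V} → y' ≈v y → z' ≈v z → Indep2 y z → Indep2 y' z'
          ind-resp e e' i p r q = i p r (vtrans (vcong+ (vcong· refl (vsym e)) (vcong· refl (vsym e'))) q)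
          disj : ∀ y → NonzeroS y → ∀ {z} → NonZeroV z → OnLine α β z → ¬ OnLine (Av y) (Bv y) z
          disj y nz = split-disjoint sp (cv-split y nz) λ p q → ui≉c (λ t → p * y t)
              (vtrans e (vtrans q (vcong+ (vsym (Av-· p y)) (vsym (Bv-· p y)))))
          ind : ∀ x → Dec (x zero ≈ 0#) → Dec (NonzeroS (x ∘ suc)) → NonzeroS x → Indep2 (C'.Av x) (C'.Bv x)
          ind x (yes x₀≈0) (yes nz) _ = ind-resp (proj₁ (head-≈ x x₀≈0)) (proj₂ (head-≈ x x₀≈0)) (cv-ind (x ∘ suc) nz)
          ind x (yes x₀≈0) (no ¬nz) (zero , ≉0) = contradiction x₀≈0 ≉0
          ind x (yes x₀≈0) (no ¬nz) (suc t , ≉0) = contradiction (t , ≉0) ¬nz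
          ind x (no x₀≉0) (no ¬nz) _ p r q = a*x≈0⇒x≈0 x₀≉0 (trans (*-comm _ _) (proj₁ q')) , a*x≈0⇒x≈0 (σ≉0 x₀≉0) (trans (*-comm _ _) (proj₂ q'))
            where
            q' : p * x zero ≈ 0# × r * σ (x zero) ≈ 0#
            q' = Split.ind sp _ _ λ t → by₃ 1# (q t) p (Av-0 (zeroS ¬nz) t) r (Bv-0 (zeroS ¬nz) t)
              (solve 8 (λ p r x s a b A B → (p :* x :* a :+ r :* s :* b) :+ con false := con true :*
                  ((p :* (x :* a :+ A) :+ r :* (s :* b :+ B)) :+ con false) :+ (p :* (A :+ con false) :+ r :* (B :+ con false)))
                refl p r (x zero) (σ (x zero)) (α t) (β t) (Av (x ∘ suc) t) (Bv (x ∘ suc) t))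
          -- A dependency puts the vector z of the new split line also on the line of the remaining
          -- coordinates. The lines are disjoint, so z = 0, and independence of α and β finishes.
          ind x (no x₀≉0) (yes nz) _ p r q = a*x≈0⇒x≈0 x₀≉0 (trans (*-comm _ _) (proj₁ q')) , a*x≈0⇒x≈0 (σ≉0 x₀≉0) (trans (*-comm _ _) (proj₂ q'))
            where
            z : V
            z = ((p * x zero) · α) +v ((r * σ (x zero)) · β)
            z≈ : z ≈v ((p · Av (x ∘ suc)) +v (r · Bv (x ∘ suc)))
            z≈ t = by₁ 1# (q t) (solve 8 (λ p r x s a b A B → (p :* x :* a :+ r :* s :* b) :+ (p :* A :+ r :* B) := con true :*
                ((p :* (x :* a :+ A) :+ r :* (s :* b :+ B)) :+ con false))
                refl p r (x zero) (σ (x zero)) (α t) (β t) (Av (x ∘ suc) t) (Bv (x ∘ suc) t))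
            decide : Dec (z ≈v 0v) → z ≈v 0v
            decide (yes z≈0) = z≈0
            decide (no z≉0) = contradiction (p , r , z≈) (disj (x ∘ suc) nz z≉0 (_ , _ , vrefl))
            q' : p * x zero ≈ 0# × r * σ (x zero) ≈ 0#
            q' = Split.ind sp _ _ (decide (z ≟v 0v))

    partial : ∀ j → j ≤ k → Partial j
    partial zero _ = start
    partial (suc j) j<k = extend j<k (partial j (ℕₚ.<⇒≤ j<k))

    full-partial : Partial k
    full-partial = partial k ℕₚ.≤-refl

  open Partial full-partial public

  cv-surj : ∀ {w} → InU w → ∃ λ x → w ≈v cv x
  cv-surj (i , e) = let e' , q = inj⇒surj-≡ (≡.sym n≡) {f = cv-index} inj i in decoded e' , vtrans e (vtrans (λ t → reflexive (≡.cong (λ i → u i t) (≡.sym q))) (vsym (proj₂ (cv-U (decoded e')))))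
    where
    inj : ∀ {e e'} → cv-index e ≡ cv-index e' → e ≡ e'
    inj {e} {e'} q = finToFun-inj {size} {k} (λ t → enum-inj _ _ (cv-inj (U-index-inj (cv-U (decoded e)) (cv-U (decoded e')) q) t))

  cv-nonzero : ∀ {x} → NonZeroV (cv x) → NonzeroS x
  cv-nonzero {x} c≉0 = decide (nonzeroS? x)
    where
    decide : Dec (NonzeroS x) → NonzeroS x
    decide (yes nz) = nz
    decide (no ¬nz) = contradiction (vtrans (vcong+ (Av-0 (zeroS ¬nz)) (Bv-0 (zeroS ¬nz))) (λ t → +-identityʳ 0#)) c≉0

  cv≉0 : ∀ {x} → NonzeroS x → NonZeroV (cv x)
  cv≉0 {x} nz e = 1≉0 (proj₁ (cv-ind x nz 1# 1# (vtrans (λ t → +-cong (*-identityˡ _) (*-identityˡ _)) e)))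

  N : ℕ
  N = #pts k

  N-size : N ℕ.* (size ∸ 1) ≡ size ℕ.^ k ∸ 1
  N-size = ≡.cong (_∸ 1) (#pts-size k (ℕₚ.<⇒≤ 1<q))

  us vs : Fin N → V
  us i = Av (pts k i)
  vs i = Bv (pts k i)

  s-split : ∀ i → Split (us i) (vs i)
  s-split i = cv-split (pts k i) (pts-nonzero k i)

  s-frame : ∀ i → Frame (us i) (vs i)
  s-frame i = SplitLine.frame (s-split i)

  secants-apart : ∀ i j → i ≢ j → DisjointLines (us i) (vs i) (us j) (vs j)
  secants-apart i j i≢j x = split-disjoint (s-split i) (s-split j) λ p e → i≢j (pts-inj k i j (p , p≉0 p e , eq p e))
    where
    eq : ∀ p → cv (pts k i) ≈v ((p · us j) +v (σ p · vs j)) → ∀ t → pts k i t ≈ p * pts k j t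
    eq p e = cv-inj (vtrans e (vcong+ (vsym (Av-· p (pts k j))) (vsym (Bv-· p (pts k j)))))
    p≉0 : ∀ p → cv (pts k i) ≈v ((p · us j) +v (σ p · vs j)) → ¬ p ≈ 0#
    p≉0 p e p≈0 = let t , ≉0 = pts-nonzero k i in ≉0 (trans (eq p e t) (trans (*-congʳ p≈0) (zeroˡ _)))

  cv-on : ∀ {x i} → x ∼S pts k i → OnLine (us i) (vs i) (cv x)
  cv-on {x} {i} (a , _ , e) = a , σ a , vtrans (cv-cong e) (vcong+ (Av-· a (pts k i)) (Bv-· a (pts k i)))

  -- Any direction on the secant is spanned by some `cv x`, which lies on the listed line of the
  -- point of x; secants with a common direction coincide.
  secant-is-listed : ∀ {u' v'} → Indep2 u' v' → Is-secant u' v' → ∃ λ i → SameLine u' v' (us i) (vs i)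
  secant-is-listed {u'} {v'} ind' sec' = let d≉0 , ld , Dd = proj₁ (proj₂ sec') zeroth ; y , Uy , y≉0 , q = D⇒U d≉0 Dd in
      listed (line-prop (prop-sym q) ld) Uy y≉0 (cv-surj Uy)
    where
    zeroth : Fin (size ∸ 1)
    zeroth = Fin.fromℕ< (ℕₚ.≤-trans (s≤s z≤n) 3≤q-1)
    listed : ∀ {y} → OnLine u' v' y → InU y → NonZeroV y → (∃ λ x → y ≈v cv x) → ∃ λ i → SameLine u' v' (us i) (vs i)
    listed {y} ly Uy y≉0 (x , e) = found (pts-all k x (cv-nonzero (nonzero-resp e y≉0)))
      where
      found : (∃ λ i → x ∼S pts k i) → ∃ λ i → SameLine u' v' (us i) (vs i)
      found (i , p) = i , λ z → same-secant ind' sec' (Frame.ind (s-frame i)) (Frame.sec (s-frame i)) y≉0 Dy ly ly' , same-secant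
          (Frame.ind (s-frame i)) (Frame.sec (s-frame i)) ind' sec' y≉0 Dy ly' ly
        where
        Dy : D y
        Dy = U-D y≉0 Uy
        ly' : OnLine (us i) (vs i) y
        ly' = line-resp (vsym e) (cv-on p)

  αs-indep : Indep αs
  αs-indep a e = zeroS λ nz → indep-u (cv-ind a nz) e

  coefficients : ∀ (a : Scalars k) → ∃ λ x → ∀ t → σ (x t) ≈ a t
  coefficients a = (λ t → proj₁ (σ-surj (a t))) , λ t → proj₂ (σ-surj (a t))

  Bv-hits : ∀ (a : Scalars k) → ∃ λ x → sumV (λ i → a i · βs i) ≈v Bv x
  Bv-hits a = let x , e = coefficients a in x , vsym (LB.L-cong e)

  -- `Bv` only produces coefficients of the form σ(x), but `σ` is onto, so every combination of `βs`
  -- is a value of `Bv`.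
  βs-indep : Indep βs
  βs-indep a e t = let x , q = coefficients a in trans (sym (q t)) (σ-0 (zeroS {x = x} (λ nz → indep-v (cv-ind x nz) (vtrans (LB.L-cong q) e)) t))

  Meeting : (Fin k → V) → Set (c ⊔ ℓ)
  Meeting b = DisjointFrom b D × (∀ i → MeetsLine b (us i) (vs i))

  αs-meeting : Meeting αs
  αs-meeting = (λ { x x≉0 (a , e) Dx → disjoint x≉0 e Dx (nonzeroS? a) })
    , λ i → us i , indep-u (Frame.ind (s-frame i)) , (pts k i , vrefl) , line-u
    where
    disjoint : ∀ {x a} → NonZeroV x → x ≈v Av a → D x → ¬ Dec (NonzeroS a)
    disjoint {x} {a} x≉0 e Dx (yes nz) = Frame.¬Da (SplitLine.frame (cv-split a nz)) (D-resp (nonzero-resp e x≉0) (prop-refl e) Dx)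
    disjoint x≉0 e Dx (no ¬nz) = x≉0 (vtrans e (Av-0 (zeroS ¬nz)))

  βs-meeting : Meeting βs
  βs-meeting = (λ { x x≉0 (a , e) Dx → let y , q = Bv-hits a in disjoint x≉0 (vtrans e q) Dx (nonzeroS? y) })
    , λ i → vs i , indep-v (Frame.ind (s-frame i)) , (σ ∘ pts k i , vrefl) , line-v
    where
    disjoint : ∀ {x a} → NonZeroV x → x ≈v Bv a → D x → ¬ Dec (NonzeroS a)
    disjoint {x} {a} x≉0 e Dx (yes nz) = Frame.¬Db (SplitLine.frame (cv-split a nz)) (D-resp (nonzero-resp e x≉0) (prop-refl e) Dx)
    disjoint x≉0 e Dx (no ¬nz) = x≉0 (vtrans e (Bv-0 (zeroS ¬nz)))

  module _ (b : Fin k → V) where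
    private module L = LinearMap (span b)

    span-resp : ∀ {x y} → x ≈v y → InSpan b x → InSpan b y
    span-resp e (a , p) = a , vtrans (vsym e) p

    span-+ : ∀ {x y} → InSpan b x → InSpan b y → InSpan b (x +v y)
    span-+ (a , p) (a' , p') = (λ t → a t + a' t) , vtrans (vcong+ p p') (vsym (L.L-+ a a'))

    span-· : ∀ s {x} → InSpan b x → InSpan b (s · x)
    span-· s (a , p) = (λ t → s * a t) , vtrans (vcong· refl p) (vsym (L.L-· s a))

    span-∼ : ∀ {x y} → x ∼ y → InSpan b y → InSpan b x
    span-∼ (s , _ , e) l = span-resp (vsym e) (span-· s l)

    span-+⁻¹ : ∀ {x y} → InSpan b (x +v y) → InSpan b y → InSpan b x
    span-+⁻¹ {x} {y} l l' = span-resp (λ i → solve 2 (λ x y → (x :+ y) :+ y := x) refl (x i) (y i)) (span-+ l l')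

    span-0 : InSpan b 0v
    span-0 = (λ _ → 0#) , vsym (vtrans (L.L-cong (λ t → sym (zeroˡ 0#))) (vtrans (L.L-· 0# (λ _ → 0#)) (0·x≈0 refl)))

    -- The coordinate map between the two sets of q^k combinations is injective, hence bijective.
    span-eq : ∀ {d : Fin k → V} → Indep d → (∀ x → InSpan b (sumV (λ i → x i · d i))) → SameSubspace b d
    span-eq {d} ind-d d⊆ z = b⊆d , λ { (x , e) → span-resp (vsym e) (d⊆ x) }
      where
      module Ld = LinearMap (span d)
      γ : Fin (size ℕ.^ k) → Scalars k
      γ e = proj₁ (d⊆ (decoded e))
      γ-inj : ∀ {e e'} → code (γ e) ≡ code (γ e') → e ≡ e'
      γ-inj {e} {e'} q = decoded-inj λ t → x+y≈0⇒x≈y (ind-d (λ t → decoded e t + decoded e' t) (vtrans (Ld.L-+ (decoded e) (decoded e'))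
          (≈v⇒+≈0 (vtrans (proj₂ (d⊆ (decoded e))) (vtrans (L.L-cong (code-inj q)) (vsym (proj₂ (d⊆ (decoded e')))))))) t)
        where
        decoded-inj : ∀ {e e'} → (∀ t → decoded e t ≈ decoded e' t) → e ≡ e'
        decoded-inj {e} {e'} h = finToFun-inj {size} {k} ((λ t → enum-inj _ _ (h t)))
      b⊆d : InSpan b z → InSpan d z
      b⊆d (y , e) = let e' , q = inj⇒surj {f = code ∘ γ} γ-inj (code y) in decoded e' ,
        vtrans e (vtrans (L.L-cong (λ t → sym (code-inj q t))) (vsym (proj₂ (d⊆ (decoded e')))))

  x₀ : ∃ λ x → NonzeroS x
  x₀ = let x , e = cv-surj U₁ in x , cv-nonzero (nonzero-resp e (λ p → 1≉0 (proj₁ (Frame.ind T 1# 1# (λ t → trans (+-cong (*-identityˡ _) (*-identityˡ _)) (p t))))))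

  -- The sum of the two parts is a nonzero vector of U, hence a point of D.
  not-both : ∀ {b} → DisjointFrom b D → ∀ {x} → NonzeroS x → InSpan b (Av x) → ¬ InSpan b (Bv x)
  not-both {b} disj {x} nz lA lB = disj (cv x) (cv≉0 nz) (span-+ b lA lB) (U-D (cv≉0 nz) (cv-U x))

  αs≢βs : ¬ SameSubspace αs βs
  αs≢βs same = let x , nz = x₀ in not-both (proj₁ αs-meeting) nz (x , vrefl) (proj₂ (same (Bv x)) (σ ∘ x , vrefl))

  module _ {b : Fin k → V} (meeting : Meeting b) where
    -- b avoids D, so it can meet the secant of x only in one of its two holes, which are the two
    -- parts of x up to scalars.
    either : ∀ x → NonzeroS x → InSpan b (Av x) ⊎ InSpan b (Bv x)
    either x nz = at (pts-all k x nz)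
      where
      at : (∃ λ i → x ∼S pts k i) → InSpan b (Av x) ⊎ InSpan b (Bv x)
      at (i , a , a≉0 , e) = meets (proj₂ meeting i)
        where
        Av-∼ : Av x ∼ us i
        Av-∼ = a , a≉0 , vtrans (Av-cong e) (Av-· a (pts k i))
        Bv-∼ : Bv x ∼ vs i
        Bv-∼ = σ a , σ≉0 a≉0 , vtrans (Bv-cong e) (Bv-· a (pts k i))
        meets : MeetsLine b (us i) (vs i) → InSpan b (Av x) ⊎ InSpan b (Bv x)
        meets (z , z≉0 , lb , lz) = [ (λ p → inj₁ (span-∼ b (prop-trans Av-∼ (prop-sym p)) lb)) , (λ p → inj₂
            (span-∼ b (prop-trans Bv-∼ (prop-sym p)) lb)) ]′
          (Coordinates.hole-∼ (s-frame i) z≉0 (proj₁ meeting z z≉0 lb) lz)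

    -- If b contains the α-part of x and the β-part of y, then it contains neither part of x + y.
    one-sided : ∀ {x y} → NonzeroS x → NonzeroS y → InSpan b (Av x) → InSpan b (Bv y) → ⊥
    one-sided {x} {y} nzx nzy lA lB = decide (nonzeroS? z)
      where
      z : Scalars k
      z t = x t + y t
      decide : ¬ Dec (NonzeroS z)
      decide (no ¬nz) = not-both (proj₁ meeting) nzx lA (span-resp b (Bv-cong (λ t → sym (x+y≈0⇒x≈y (zeroS ¬nz t)))) lB)
      decide (yes nz) = [ (λ l → not-both (proj₁ meeting) nzy (span-+⁻¹ b (span-resp b (vtrans (Av-+ x y) (λ t → +-comm _ _)) l) lA) lB)
                        , (λ l → not-both (proj₁ meeting) nzx lA (span-+⁻¹ b (span-resp b (Bv-+ x y) l) lB)) ]′ (either z nz)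

    one-of-two : SameSubspace b αs ⊎ SameSubspace b βs
    one-of-two = decide (either (proj₁ x₀) (proj₂ x₀))
      where
      nz₀ = proj₂ x₀
      decide : InSpan b (Av (proj₁ x₀)) ⊎ InSpan b (Bv (proj₁ x₀)) → SameSubspace b αs ⊎ SameSubspace b βs
      decide (inj₁ lA) = inj₁ (span-eq b αs-indep λ x → all x (nonzeroS? x))
        where
        all : ∀ x → Dec (NonzeroS x) → InSpan b (Av x)
        all x (no ¬nz) = span-resp b (vsym (Av-0 (zeroS ¬nz))) (span-0 b)
        all x (yes nz) = [ (λ l → l) , (λ l → ⊥-elim (one-sided nz₀ nz lA l)) ]′ (either x nz)
      decide (inj₂ lB) = inj₂ (span-eq b βs-indep λ a → let x , e = Bv-hits a in span-resp b (vsym e) (all x (nonzeroS? x)))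
        where
        all : ∀ x → Dec (NonzeroS x) → InSpan b (Bv x)
        all x (no ¬nz) = span-resp b (vsym (Bv-0 (zeroS ¬nz))) (span-0 b)
        all x (yes nz) = [ (λ l → ⊥-elim (one-sided nz nz₀ l lB)) , (λ l → l) ]′ (either x nz)

  -- `Good` is left open because the conclusion is needed twice, once with spaces meeting every
  -- secant and once with spaces meeting the listed lines.
  two-transversals : ∀ (Good : (Fin k → V) → Set (c ⊔ ℓ)) → (∀ {b} → Meeting b → Good b) → (∀ {b} → Good b → Meeting b) → ExactlyTwoSubspaces k Good
  two-transversals Good to from = αs , βs , (αs-indep , αs-∞) , to αs-meeting , (βs-indep , βs-∞) , to βs-meeting , αs≢βs , λ b _ good → one-of-two (from good)

  us-∞ : ∀ i → LineInH∞ (us i) (vs i)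
  us-∞ i = SplitLine.α-∞ (s-split i) , SplitLine.β-∞ (s-split i)

-- An F₂-basis of U and the linear set D

module F₂-Basis {c ℓ} {F : FiniteField c ℓ} {m : ℕ} (S : DirectionSet F m) (r : ℕ) (n≡ : DirectionSet.n S ≡ 2 ℕ.^ r) where
  open Directions S
  open Additive S using (u)
  open Scattered S using (InU; U-0; U-+; U-D; D⇒U; U-index; U-index-cong; U-index-inj)
  open Frames S using (u-∞)
  open FiniteField F hiding (zero)
  open Char2 F 1+1≈0
  open Vectors m
  open PointSets F 1+1≈0 m

  bool : Fin 2 → Bool
  bool zero = false
  bool (suc _) = true

  unbool : Bool → Fin 2
  unbool false = zero
  unbool true = suc zero

  bool-unbool : ∀ b → bool (unbool b) ≡ b
  bool-unbool false = ≡.refl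
  bool-unbool true = ≡.refl

  bool-inj : ∀ {i j} → bool i ≡ bool j → i ≡ j
  bool-inj {zero} {zero} _ = ≡.refl
  bool-inj {suc zero} {suc zero} _ = ≡.refl
  bool-inj {zero} {suc zero} ()
  bool-inj {suc zero} {zero} ()

  xor-false : ∀ {a b} → a xor b ≡ false → a ≡ b
  xor-false {false} {false} _ = ≡.refl
  xor-false {true} {true} _ = ≡.refl

  subset-cong : ∀ {j} (g : Fin j → V) {s t : Fin j → Bool} → (∀ i → s i ≡ t i) → subsetSum g s ≈v subsetSum g t
  subset-cong {zero} g e i = refl
  subset-cong {suc j} g e = vcong+ (λ t → reflexive (≡.cong (λ b → (if b then g zero else 0v) t) (e zero))) (subset-cong (g ∘ suc) (e ∘ suc))

  subset-xor : ∀ {j} (g : Fin j → V) (s t : Fin j → Bool) → subsetSum g (λ i → s i xor t i) ≈v (subsetSum g s +v subsetSum g t)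
  subset-xor {zero} g s t i = sym (+-identityʳ 0#)
  subset-xor {suc j} g s t i = trans (+-cong (head (s zero) (t zero)) (subset-xor (g ∘ suc) (s ∘ suc) (t ∘ suc) i))
    (solve 4 (λ a b c d → (a :+ b) :+ (c :+ d) := (a :+ c) :+ (b :+ d)) refl ((if s zero then g zero else 0v) i)
        ((if t zero then g zero else 0v) i) (subsetSum (g ∘ suc) (s ∘ suc) i) (subsetSum (g ∘ suc) (t ∘ suc) i))
    where
    head : ∀ a b → (if a xor b then g zero else 0v) i ≈ (if a then g zero else 0v) i + (if b then g zero else 0v) i
    head false b = sym (+-identityˡ _)
    head true false = sym (+-identityʳ _)
    head true true = sym (x+x≈0 _)

  record Family (j : ℕ) : Set (c ⊔ ℓ) where
    field
      g : Fin j → V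
      g-∞ : ∀ i → InH∞ (g i)
      sum-U : ∀ s → InU (subsetSum g s)
      g-indep : F₂Indep g

    sum-inj : ∀ {s t} → subsetSum g s ≈v subsetSum g t → ∀ i → s i ≡ t i
    sum-inj {s} {t} e i = xor-false (g-indep (λ i → s i xor t i) (vtrans (subset-xor g s t) (≈v⇒+≈0 e)) i)

    subset : Fin (2 ℕ.^ j) → Fin j → Bool
    subset e i = bool (Fin.finToFun e i)

    subset-code : ∀ s i → subset (Fin.funToFin (unbool ∘ s)) i ≡ s i
    subset-code s i = ≡.trans (≡.cong bool (Finₚ.finToFun-funToFin (unbool ∘ s) i)) (bool-unbool (s i))

    sum-index : Fin (2 ℕ.^ j) → Fin n
    sum-index e = U-index (sum-U (subset e))

  abstract
    extend : ∀ {j} → j < r → Family j → Family (suc j)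
    extend {j} j<r P = build (missed {2 ℕ.^ j} {n} (≡.subst (2 ℕ.^ j <_) (≡.sym n≡) (ℕₚ.^-monoʳ-< 2 ℕₚ.≤-refl j<r)) sum-index)
      where
      open Family P
      build : (∃ λ i → ∀ e → sum-index e ≢ i) → Family (suc j)
      build (i , new) = record { g = g' ; g-∞ = λ { zero → u-∞ i ; (suc t) → g-∞ t } ; sum-U = λ s → U-+ (head-U (s zero)) (sum-U (s ∘ suc))
          ; g-indep = λ s → ind s (s zero) ≡.refl }
        where
        ui≉sum : ∀ s → ¬ u i ≈v subsetSum g s
        ui≉sum s e = new (Fin.funToFin (unbool ∘ s))
            (U-index-cong (sum-U (subset (Fin.funToFin (unbool ∘ s)))) (i , vrefl) (vtrans (subset-cong g (subset-code s)) (vsym e)))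
        g' : Fin (suc j) → V
        g' zero = u i
        g' (suc t) = g t
        head-U : ∀ b → InU (if b then u i else 0v)
        head-U false = U-0
        head-U true = i , vrefl
        ind : ∀ s b → s zero ≡ b → subsetSum g' s ≈v 0v → ∀ t → s t ≡ false
        ind s true e q = contradiction (x+y≈0⇒x≈vy
            (vtrans (vcong+ (λ t → reflexive (≡.cong (λ b → (if b then u i else 0v) t) (≡.sym e))) vrefl) q)) (ui≉sum (s ∘ suc))
        ind s false e q zero = e
        ind s false e q (suc t) = g-indep (s ∘ suc)
            (λ x → trans (sym (+-identityˡ _)) (trans (+-congʳ (reflexive (≡.cong (λ b → (if b then u i else 0v) x) (≡.sym e)))) (q x))) t

    family : ∀ j → j ≤ r → Family j
    family zero _ = record { g = λ () ; g-∞ = λ () ; sum-U = λ _ → U-0 ; g-indep = λ _ _ () }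
    family (suc j) j<r = extend j<r (family j (ℕₚ.<⇒≤ j<r))

  open Family (family r ℕₚ.≤-refl)

  sum-surj : ∀ {w} → InU w → ∃ λ s → w ≈v subsetSum g s
  sum-surj (i , e) = let e' , q = inj⇒surj-≡ (≡.sym n≡) {f = sum-index} inj i in subset e' , vtrans e (vtrans (λ t → reflexive (≡.cong (λ i → u i t) (≡.sym q))) (vsym (proj₂ (sum-U (subset e')))))
    where
    inj : ∀ {e e'} → sum-index e ≡ sum-index e' → e ≡ e'
    inj {e} {e'} q = finToFun-inj {2} {r} (λ t → bool-inj (sum-inj {subset e} {subset e'} (U-index-inj (sum-U (subset e)) (sum-U (subset e')) q) t))

  linear-set : IsF₂LinearSetOfRank r D
  linear-set = g , g-∞ , g-indep , λ x x≉0 → to x≉0 , from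
    where
    to : ∀ {x} → NonZeroV x → D x → InLinSet g x
    to x≉0 Dx = let y , Uy , y≉0 , q = D⇒U x≉0 Dx ; s , e = sum-surj Uy in s , nonzero-resp e y≉0 , prop-respʳ e q
    from : ∀ {x} → InLinSet g x → D x
    from (s , s≉0 , q) = D-resp (prop-nonzero q s≉0) (prop-sym q) (U-D s≉0 (sum-U s))

-- Proof of the theorem

-- The setup is repeated with q as a variable: `conclude` can then match `size F ≡ q` with
-- reflexivity, which is impossible for 2 ^ h, and Q becomes indexed by a power of `size`.
module AffinePointSet {c ℓ} (F : FiniteField c ℓ) (q k : ℕ) (Q : Fin (q ℕ.^ k) → Geom.V F (2 ℕ.* k)) where
  open Geom F hiding (V; module Setup)
  V : Set c
  V = Geom.V F (2 ℕ.* k)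

  InD : V → Set (c ⊔ ℓ)
  InD x = ∃₂ λ i j → i ≢ j × InH∞ x × OnLine (Q i) (Q j) x

  Secant : V → V → Set (c ⊔ ℓ)
  Secant u v = Indep2 u v × NumPoints (λ x → OnLine u v x × InD x) (q ∸ 1)

  record Hypotheses : Set (c ⊔ ℓ) where
    field
      2≤k : 2 ≤ k
      affine : ∀ i → ¬ InH∞ (Q i)
      Q-inj : ∀ i j → Proportional (Q i) (Q j) → i ≡ j
      numD : NumPoints InD (q ℕ.^ k ∸ 1)
      lines : ∀ u v → Indep2 u v → let P = λ x → OnLine u v x × InD x in
        NumPoints P 0 ⊎ NumPoints P 1 ⊎ NumPoints P 3 ⊎ NumPoints P (q ∸ 1)

  record Conclusion (r : ℕ) : Set (c ⊔ ℓ) where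
    field
      N : ℕ
      N-size : N ℕ.* (q ∸ 1) ≡ q ℕ.^ k ∸ 1
      us vs : Fin N → V
      listed : ∀ i → Secant (us i) (vs i)
      at-∞ : ∀ i → LineInH∞ (us i) (vs i)
      all-listed : ∀ u' v' → Secant u' v' → ∃ λ i → SameLine u' v' (us i) (vs i)
      disjoint : ∀ i j → i ≢ j → DisjointLines (us i) (vs i) (us j) (vs j)
      transversals : ExactlyTwoSubspaces k (λ b → DisjointFrom b InD × (∀ u' v' → Secant u' v' → MeetsLine b u' v'))
      transversals′ : ExactlyTwoSubspaces k (λ b → DisjointFrom b InD × (∀ i → MeetsLine b (us i) (vs i)))
      linear : IsF₂LinearSetOfRank r InD

module Normalised {c ℓ} (F : FiniteField c ℓ) (h k : ℕ) (size≡ : FiniteField.size F ≡ 2 ℕ.^ h) (4≤h : 4 ≤ h)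
  (Q : Fin (FiniteField.size F ℕ.^ k) → Geom.V F (2 ℕ.* k)) (hyp : AffinePointSet.Hypotheses F (FiniteField.size F) k Q) where
  open FiniteField F hiding (zero)
  open FieldBasics F
  open AffinePointSet F size k Q
  open Hypotheses hyp

  private
    2=0 : 1# + 1# ≈ 0#
    2=0 = char2 h size≡

  open Char2 F 2=0
  open Vectors (2 ℕ.* k)

  A : Fin (size ℕ.^ k) → V
  A i = inv (Q i zero) (affine i) · Q i

  A≈ : ∀ i → Q i ≈v (Q i zero · A i)
  A≈ i t = by₁ (Q i t) (inv-r (Q i zero) (affine i))
      (solve 3 (λ s s' x → x :+ s :* (s' :* x) := x :* (s :* s' :+ con true)) refl (Q i zero) (inv (Q i zero) (affine i)) (Q i t))

  A-one : ∀ i → A i zero ≈ 1#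
  A-one i = inv-l (Q i zero) (affine i)

  A-injective : ∀ {i j} → A i ≈v A j → i ≡ j
  A-injective {i} {j} e = Q-inj i j (prop-trans (prop-trans (Q i zero , affine i , A≈ i) (prop-refl e)) (·-prop (inv≉0 (Q j zero) (affine j))))

  -- At infinity the zeroth coordinate of a Q i + b Q j vanishes, so in terms of the scaled points
  -- the two coefficients agree and x is a multiple of A i + A j.
  D-directions : ∀ {x} → NonZeroV x → InD x → ∃₂ λ i j → i ≢ j × Proportional x (A i +v A j)
  D-directions {x} x≉0 (i , j , i≢j , x∞ , a , b , e) = i , j , i≢j , a * Q i zero , s≉0 , x≈
    where
    s≈ : a * Q i zero ≈ b * Q j zero
    s≈ = by₂ 1# (e zero) 1# x∞ (solve 3 (λ x p r → p :+ r := con true :* (x :+ (p :+ r)) :+ con true :* (x :+ con false)) refl (x zero)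
        (a * Q i zero) (b * Q j zero))
    x≈ : x ≈v ((a * Q i zero) · (A i +v A j))
    x≈ t = by₃ 1# (trans (e t) (+-cong (*-congˡ (A≈ i t)) (*-congˡ (A≈ j t)))) (A j t) s≈ 0# (refl {0#})
      (solve 7 (λ x a b s s' y z → x :+ (a :* s) :* (y :+ z) := con true :* (x :+ (a :* (s :* y) :+ b :* (s' :* z))) :+
          (z :* (a :* s :+ b :* s') :+ con false :* (con false :+ con false)))
        refl (x t) a b (Q i zero) (Q j zero) (A i t) (A j t))
    s≉0 : ¬ a * Q i zero ≈ 0#
    s≉0 s≈0 = x≉0 (vtrans x≈ (0·x≈0 s≈0))

  directions-D : ∀ {x i j} → i ≢ j → Proportional x (A i +v A j) → InD x
  directions-D {x} {i} {j} i≢j (s , _ , e) = i , j , i≢j , trans (e zero) (trans (*-congˡ (trans (+-cong (A-one i) (A-one j)) 2=0)) (zeroʳ s)) ,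
    s * inv (Q i zero) (affine i) , s * inv (Q j zero) (affine j) , λ t → trans (e t)
        (trans (distribˡ s _ _) (+-cong (sym (*-assoc _ _ _)) (sym (*-assoc _ _ _))))

  16≤size : 16 ≤ size
  16≤size = ≡.subst (16 ≤_) (≡.sym size≡) (ℕₚ.^-monoʳ-≤ 2 4≤h)

  size<size^k : size < size ℕ.^ k
  size<size^k = ≡.subst (_< size ℕ.^ k) (ℕₚ.*-identityʳ size) (ℕₚ.^-monoʳ-< size (ℕₚ.≤-trans (ℕₚ.m≤m+n 2 14) 16≤size) {1} {k} 2≤k)

  square : size ℕ.^ k ℕ.* size ℕ.^ k ≡ size ℕ.^ (2 ℕ.* k)
  square = ≡.sym (≡.trans (≡.cong (λ l → size ℕ.^ (k ℕ.+ l)) (ℕₚ.+-identityʳ k)) (ℕₚ.^-distribˡ-+-* size k k))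

  directionSet : DirectionSet F (2 ℕ.* k)
  directionSet = record
    { 1+1≈0 = 2=0 ; n = size ℕ.^ k ; A = A ; A-inj = A-injective ; D = InD ; D⇒ = D-directions ; D⇐ = directions-D
    ; numD = numD ; lines = lines ; 16≤q = 16≤size ; q<n = size<size^k ; A-affine = A-one ; n²≡ = square }

  size^k≡ : size ℕ.^ k ≡ 2 ℕ.^ (h ℕ.* k)
  size^k≡ = ≡.trans (≡.cong (ℕ._^ k) size≡) (ℕₚ.^-*-assoc 2 h k)

  conclusion : Conclusion (h ℕ.* k)
  conclusion = record
    { N = N ; N-size = N-size ; us = us ; vs = vs
    ; listed = λ i → Frame.ind (s-frame i) , Frame.sec (s-frame i)
    ; at-∞ = us-∞
    ; all-listed = λ { u' v' (ind , sec) → secant-is-listed ind sec }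
    ; disjoint = secants-apart
    ; transversals = two-transversals _
        (λ { (disj , meets) → disj , λ { u' v' (ind , sec) → let i , same = secant-is-listed ind sec ; z , z≉0 , lb , lz = meets i in z , z≉0 , lb , proj₂ (same z) lz } })
        (λ { (disj , meets) → disj , λ i → meets (us i) (vs i) (Frame.ind (s-frame i) , Frame.sec (s-frame i)) })
    ; transversals′ = two-transversals _ (λ m → m) (λ m → m)
    ; linear = F₂-Basis.linear-set directionSet (h ℕ.* k) size^k≡
    }
    where
    open NormalForm directionSet k ≡.refl
    open Frames directionSet using (module Frame)

conclude : ∀ {c ℓ} (F : FiniteField c ℓ) (h k q : ℕ) (Q : Fin (q ℕ.^ k) → Geom.V F (2 ℕ.* k)) → FiniteField.size F ≡ q → q ≡ 2 ℕ.^ h → 4 ≤ h →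
  AffinePointSet.Hypotheses F q k Q → AffinePointSet.Conclusion F q k Q (h ℕ.* k)
conclude F h k q Q ≡.refl q≡ 4≤h hyp = Normalised.conclusion F h k q≡ 4≤h Q hyp

theorem3p12 : ∀ {c ℓ : Level} (F : FiniteField c ℓ) (h k : ℕ)
    (Q : Fin ((2 ^ h) ^ k) → Geom.V F (2 Data.Nat.* k)) →
    Geom.Setup.StandingHypotheses F h k Q →
    Geom.Setup.SecantsFormPseudoregulus F h k Q ×
    Geom.IsScatteredOfPseudoregulusType F h k (Geom.Setup.InD F h k Q)
theorem3p12 F h k Q (size≡ , 4≤h , 2≤k , affine , Q-inj , numD , lines) =
  (N , N-size , us , vs , listed , all-listed , disjoint , transversals) ,
  ((linear , ≡.subst (λ M → Geom.NumPoints F InD (M ∸ 1)) (ℕₚ.^-*-assoc 2 h k) numD) ,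
   N , N-size , us , vs , (λ i → proj₁ (listed i) , at-∞ i , proj₂ (listed i)) , disjoint , transversals′)
  where
  open AffinePointSet F (2 ℕ.^ h) k Q
  hyp : Hypotheses
  hyp = record { 2≤k = 2≤k ; affine = λ i → proj₂ (affine i) ; Q-inj = Q-inj ; numD = numD ; lines = lines }
  open Conclusion (conclude F h k (2 ℕ.^ h) Q size≡ ≡.refl 4≤h hyp)
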